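{- Consider the generalized inversion and descent statistics on the symmetric groups $S_n$. Let $d_1=d_1(n)\in\{1,\dots,n-1\}$ satisfy $d_1=o\bigl(n^{1/3}(\log(n^{4/3}))^{ -7/3}\bigr)$ and let $d_2=d_2(n)\in\{1,\dots,n-1\}$ be arbitrary. For the limiting correlation $$\rho=\lim_{n\to\infty}\mathrm{Corr}\bigl(X_{\mathrm{inv}}^{(d_1)},X_{\mathrm{des}}^{(d_2)}\bigr)$$ the following holds: (a) If $d_1<d_2$ for all $n$, then $\rho$ exists and $\rho=0$. (b) If $d_1\ge d_2$ for all $n$ and $d_1$ is eventually constant, then $\rho$ exists and $\rho=1/\sqrt{d_1}$ (with $d_1$ denoting the eventual constant value). If $d_1\ge d_2$ for all $n$ and $d_1$ is bounded but has multiple accumulation points, then the limit $\rho$ does not exist. (c) If $d_1\ge d_2$ for all $n$ and $d_1\to\infty$ as $n\to\infty$, then $\rho$ exists and $\rho=0$.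
   Context: Let $Z_1,\dots,Z_n$ be i.i.d. uniform on $(0,1)$. For $d\in\{1,\dots,n-1\}$, on the symmetric group $S_n$ define $$X_{\mathrm{inv}}^{(d)}=\sum_{1\le i<j\le n,\ j-i\le d}\mathbf 1\{Z_i>Z_j\},\qquad X_{\mathrm{des}}^{(d)}=\sum_{i=1}^{n-d}\mathbf 1\{Z_i>Z_{i+d}\}.$$ Both statistics are built from the same $Z_1,\dots,Z_n$. $\mathrm{Corr}(X,Y)=\mathrm{Cov}(X,Y)/\sqrt{\mathrm{Var}(X)\mathrm{Var}(Y)}$. -}

module Defs where

open import Algebra.Bundles using (CommutativeRing; Semiring)
open import Axiom.ExcludedMiddle using (ExcludedMiddle)
open import Data.Fin.Base using (Fin; toℕ)
open import Data.Integer.Base as ℤ using (ℤ)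
open import Data.Nat.Base as ℕ using (ℕ; zero; suc)
open import Data.Product.Base using (Σ; ∃; _×_; _,_)
open import Data.Rational.Base as ℚ using (ℚ; ↥_; ↧ₙ_)
open import Level using (Level; 0ℓ) renaming (suc to lsuc)
open import Relation.Binary.Core using (Rel)
open import Relation.Binary.Definitions using (tri<; tri≈; tri>)
open import Relation.Binary.PropositionalEquality.Core using (_≡_; _≢_)
open import Relation.Binary.Structures using (IsStrictTotalOrder)
open import Relation.Nullary.Decidable.Core using (yes; no)
open import Relation.Nullary.Negation.Core using (¬_)
open import Relation.Unary using (Pred; _≐_; ∁; U; _∩_; ⋃; Empty)
import Algebra.Definitions.RawSemiring as RawSemiringDefinitions
import Relation.Binary.Construct.StrictToNonStrict as StrictToNonStrict

-- The real numbers, axiomatised as a Dedekind-complete ordered field; classically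
-- this determines them up to isomorphism.
record CompleteOrderedField : Set₁ where
  infix  4 _<_
  infixl 7 _/_
  infix  8 _⁻¹
  field
    commutativeRing : CommutativeRing 0ℓ 0ℓ

  open CommutativeRing commutativeRing public
  open RawSemiringDefinitions (Semiring.rawSemiring semiring) public
    using (sum; product; _^_) renaming (_×_ to _·_)

  field
    _<_                : Rel Carrier 0ℓ
    isStrictTotalOrder : IsStrictTotalOrder _≈_ _<_
    0<1                : 0# < 1#
    +-monoʳ-<          : ∀ x {y z} → y < z → x + y < x + z
    *-pos              : ∀ {x y} → 0# < x → 0# < y → 0# < x * y
    -- Nothing is assumed about the value of 0# ⁻¹.
    _⁻¹                : Carrier → Carrier
    ⁻¹-inverseʳ        : ∀ {x} → ¬ (x ≈ 0#) → x * x ⁻¹ ≈ 1#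

  open IsStrictTotalOrder isStrictTotalOrder public using (compare)
  open StrictToNonStrict _≈_ _<_ public using (_≤_)

  IsUpperBound : Pred Carrier 0ℓ → Pred Carrier 0ℓ
  IsUpperBound S b = ∀ x → S x → x ≤ b

  IsSupremum : Pred Carrier 0ℓ → Pred Carrier 0ℓ
  IsSupremum S s = IsUpperBound S s × (∀ b → IsUpperBound S b → s ≤ b)

  field
    complete : (S : Pred Carrier 0ℓ) → ∃ S → ∃ (IsUpperBound S) → ∃ (IsSupremum S)

  _/_ : Carrier → Carrier → Carrier
  x / y = x * y ⁻¹

  fromℕ : ℕ → Carrier
  fromℕ n = n · 1#

  ∣_∣ : Carrier → Carrier
  ∣ x ∣ with compare 0# x
  ... | tri< _ _ _ = x
  ... | tri≈ _ _ _ = x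
  ... | tri> _ _ _ = - x

-- Excluded middle is a parameter because the mathematics is classical: indicator
-- functions of real inequalities and definite descriptions are functions only classically.
module Probability (lem : ∀ {ℓ} → ExcludedMiddle ℓ) (ℝ : CompleteOrderedField) where
  open CompleteOrderedField ℝ public renaming (Carrier to R)

  -- Definite description, with value 0# when nothing satisfies P.
  the : ∀ {ℓ : Level} → Pred R ℓ → R
  the P with lem {P = ∃ P}
  ... | yes (x , _) = x
  ... | no _        = 0#

  infix 4 _⟶_ _=o_

  _⟶_ : (ℕ → R) → R → Set
  u ⟶ l = ∀ ε → 0# < ε → ∃ λ N → ∀ n → N ℕ.≤ n → ∣ u n - l ∣ < ε

  _=o_ : (ℕ → R) → (ℕ → R) → Set
  f =o g = ∀ ε → 0# < ε → ∃ λ N → ∀ n → N ℕ.≤ n → ∣ f n ∣ ≤ ε * ∣ g n ∣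

  IsAccumulationPoint : (ℕ → R) → Pred R 0ℓ
  IsAccumulationPoint u a =
    ∀ ε → 0# < ε → ∀ N → ∃ λ n → N ℕ.≤ n × ∣ u n - a ∣ < ε

  lim : (ℕ → R) → R
  lim u = the (u ⟶_)

  exp : R → R
  exp x = lim (λ m → (1# + x / fromℕ m) ^ m)

  log : R → R
  log y = the (λ x → exp x ≈ y)

  root : ℕ → R → R
  root q x = the (λ y → 0# ≤ y × y ^ q ≈ x)

  √_ : R → R
  √ x = root 2 x

  infixr 8 _^ℤ_ _^ℚ_

  _^ℤ_ : R → ℤ → R
  x ^ℤ (ℤ.+ p)    = x ^ p
  x ^ℤ ℤ.-[1+ p ] = (x ^ suc p) ⁻¹

  _^ℚ_ : R → ℚ → R
  x ^ℚ r = root (↧ₙ r) x ^ℤ (↥ r)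

  growthBound : ℕ → R
  growthBound n =
    fromℕ n ^ℚ (ℤ.+ 1 ℚ./ 3) * log (fromℕ n ^ℚ (ℤ.+ 4 ℚ./ 3)) ^ℚ (ℤ.- (ℤ.+ 7) ℚ./ 3)

  data Borel : Pred R 0ℓ → Set₁ where
    half-line : ∀ x → Borel (_≤ x)
    ∁-closed  : ∀ {B} → Borel B → Borel (∁ B)
    ⋃-closed  : ∀ {B : ℕ → Pred R 0ℓ} → (∀ k → Borel (B k)) → Borel (⋃ ℕ B)
    resp      : ∀ {B C} → B ≐ C → Borel B → Borel C

  record ProbabilitySpace : Set₂ where
    field
      Ω          : Set
      Event      : Pred (Pred Ω 0ℓ) (lsuc 0ℓ)
      Event-resp : ∀ {A B} → A ≐ B → Event A → Event B
      Event-U    : Event U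
      Event-∁    : ∀ {A} → Event A → Event (∁ A)
      Event-⋃    : ∀ {A : ℕ → Pred Ω 0ℓ} → (∀ k → Event (A k)) → Event (⋃ ℕ A)
      -- Values of ℙ outside Event are unconstrained junk.
      ℙ          : Pred Ω 0ℓ → R
      ℙ-cong     : ∀ {A B} → Event A → A ≐ B → ℙ A ≈ ℙ B
      ℙ-nonneg   : ∀ {A} → Event A → 0# ≤ ℙ A
      ℙ-U        : ℙ U ≈ 1#
      ℙ-⋃        : ∀ {A : ℕ → Pred Ω 0ℓ} → (∀ k → Event (A k)) →
                   (∀ i j → i ≢ j → Empty (A i ∩ A j)) →
                   (λ N → sum {N} (λ k → ℙ (A (toℕ k)))) ⟶ ℙ (⋃ ℕ A)

    𝟙 : Pred Ω 0ℓ → Ω → R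
    𝟙 A ω with lem {P = A ω}
    ... | yes _ = 1#
    ... | no _  = 0#

    -- e is the integral of X, for X a finite linear combination of indicators of events.
    -- All random variables considered here take finitely many values, so the integral
    -- of simple functions is all that is needed.
    IsExpectation : (Ω → R) → R → Set₁
    IsExpectation X e =
      Σ ℕ λ m → Σ (Fin m → R) λ a → Σ (Fin m → Pred Ω 0ℓ) λ A →
        (∀ k → Event (A k)) ×
        (∀ ω → X ω ≈ sum (λ k → a k * 𝟙 (A k) ω)) ×
        e ≈ sum (λ k → a k * ℙ (A k))

    𝔼 : (Ω → R) → R
    𝔼 X = the (IsExpectation X)

    Cov : (Ω → R) → (Ω → R) → R
    Cov X Y = 𝔼 (λ ω → (X ω - 𝔼 X) * (Y ω - 𝔼 Y))

    Var : (Ω → R) → R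
    Var X = Cov X X

    Corr : (Ω → R) → (Ω → R) → R
    Corr X Y = Cov X Y / √ (Var X * Var Y)

    IsRandomVariable : (Ω → R) → Set₁
    IsRandomVariable X = ∀ {B} → Borel B → Event (λ ω → B (X ω))

    IsUniform01 : (Ω → R) → Set
    IsUniform01 X = ∀ x → 0# ≤ x → x ≤ 1# → ℙ (λ ω → X ω ≤ x) ≈ x

    IsIndependent : ∀ {n} → (Fin n → Ω → R) → Set₁
    IsIndependent {n} X =
      (B : Fin n → Pred R 0ℓ) → (∀ i → Borel (B i)) →
      ℙ (λ ω → ∀ i → B i (X i ω)) ≈ product (λ i → ℙ (λ ω → B i (X i ω)))

  -- Z i stands for Z_{i+1}; only differences of indices occur in the statistics below.
  record UniformSample (n : ℕ) : Set₂ where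
    field
      space : ProbabilitySpace
    open ProbabilitySpace space public
    field
      Z                : Fin n → Ω → R
      Z-randomVariable : ∀ i → IsRandomVariable (Z i)
      Z-uniform        : ∀ i → IsUniform01 (Z i)
      Z-independent    : IsIndependent Z

    Xinv : ℕ → Ω → R
    Xinv d ω = sum λ i → sum λ j →
      𝟙 (λ ω′ → toℕ i ℕ.< toℕ j × toℕ j ℕ.∸ toℕ i ℕ.≤ d × Z j ω′ < Z i ω′) ω

    Xdes : ℕ → Ω → R
    Xdes d ω = sum λ i → sum λ j →
      𝟙 (λ ω′ → toℕ j ≡ toℕ i ℕ.+ d × Z j ω′ < Z i ω′) ω

    correlation : ℕ → ℕ → R
    correlation d₁ d₂ = Corr (Xinv d₁) (Xdes d₂)

{-# OPTIONS --safe #-}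

-- Write Y(i,j) for the indicator of Z i > Z j. For i < j and k < l,
--
--   12 Cov (Y(i,j), Y(k,l)) = ⟨e i - e j , e k - e l⟩ + [(i,j) = (k,l)],
--
-- so for statistics X = Σ w(i,j) Y(i,j) and X′ = Σ w′(i,j) Y(i,j) with weights supported on
-- i < j, and with A m = Σ_j w(m,j) - Σ_i w(i,m),
--
--   12 Cov (X, X′) = Σ_m A m A′ m + Σ w(i,j) w′(i,j).
--
-- For both families A vanishes except near the two ends of the index range, so the second
-- sum dominates: it is about n d₁ for the variance of Xinv, n - d₂ for that of Xdes, and for
-- the covariance it is n - d₂ if d₂ ≤ d₁ and zero otherwise. Cauchy-Schwarz controls the
-- first sum as soon as d₁² = o(n), which the growth condition implies because
-- log (n^(4/3)) ≥ 1 for large n.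
--
-- The joint probabilities are obtained from independence on half-lines only: conditioning on
-- Z i ∈ (s,t] squeezes the increments of t ↦ ℙ(A ∩ {Z i ≤ t}) between those of a
-- polynomial, which determines ℙ(A).
module Submission where

open import Defs
open import Axiom.ExcludedMiddle using (ExcludedMiddle)
open import Data.Nat.Base as ℕ using (ℕ; zero; suc)
import Data.Nat.Properties as ℕₚ
open import Data.Integer.Base as ℤ using (ℤ; -[1+_]) renaming (+_ to pos)
import Data.Integer.Properties as ℤₚ
open import Data.Product.Base using (∃; ∃₂; _×_; _,_; proj₁; proj₂; map₂)
open import Data.Sum.Base using (_⊎_; inj₁; inj₂; [_,_]′)
open import Data.Maybe.Base using (Maybe; just; nothing)
open import Data.Empty using (⊥)
open import Level using (0ℓ)
open import Relation.Binary.Bundles using (StrictPartialOrder)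
open import Relation.Binary.Definitions using (tri<; tri≈; tri>)
open import Relation.Binary.PropositionalEquality.Core as ≡ using (_≡_; _≢_)
open import Relation.Binary.Structures using (IsStrictTotalOrder)
open import Relation.Nullary.Decidable.Core using (Dec; yes; no)
open import Relation.Nullary.Negation.Core using (¬_; contradiction)
open import Relation.Unary using (Pred; _∩_; _∪_; ∁; U; ⋃)
open import Data.Unit.Base using (⊤; tt)
open import Data.List.Base using (List; []; _∷_)
open import Data.Fin.Properties as Finₚ using ()
open import Data.Fin.Base as Fin using (Fin; zero; suc; toℕ)
open import Data.Vec.Functional as Vector using (Vector)
import Algebra.Solver.Ring
import Algebra.Solver.Ring.AlmostCommutativeRing as ACR
import Algebra.Properties.Group
import Algebra.Properties.Ring
import Algebra.Properties.Semiring.Mult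
import Algebra.Properties.Semiring.Exp
import Algebra.Properties.Semiring.Sum
import Relation.Binary.Reasoning.StrictPartialOrder
import Relation.Binary.Construct.StrictToNonStrict

-- The two statistics cannot be treated alike. `d₂` may be as large as `n - 1`, and then the
-- imbalance sum of `Xdes` exceeds its entrywise sum (they are 2 and 1 for `d₂ = n - 1`). Smallness
-- therefore has to come from `Xinv`: the mixed imbalance sum is bounded by the product of the two
-- individual ones, and it is enough that the one of `Xinv` is small against its entrywise sum. That
-- ratio is of order `d₁² / n`, because at most `2 d₁` indices carry an imbalance, of size at most
-- `d₁`. For bounded `d₁ ≥ d₂` the correlation lies within O(1/n) of `1 / √ d₁`, uniformly in `d₁`.
-- This one estimate yields both the limit for constant `d₁` and the divergence in the presence of
-- several accumulation points. A second obstacle is that `root`, `log`, `exp` and `𝔼` are definite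
-- descriptions with default `0#`. Existence is shown by suprema for roots and logarithms, and by
-- explicit combinations of indicators for expectations, where uniqueness is shown as well.

module Development (lem : ∀ {ℓ} → ExcludedMiddle ℓ) (ℝ : CompleteOrderedField) where

  open Probability lem ℝ hiding (zero)
  open IsStrictTotalOrder isStrictTotalOrder
    using (isStrictPartialOrder; <-resp-≈; <-respˡ-≈; <-respʳ-≈)
    renaming (trans to <-trans; irrefl to <-irrefl)
  open ACR.AlmostCommutativeRing (ACR.fromCommutativeRing commutativeRing) using (-‿+-comm)
  open Algebra.Properties.Semiring.Mult semiring using (×-homo-+; ×1-homo-*)
  open Algebra.Properties.Group +-group using (⁻¹-involutive; ε⁻¹≈ε)
  open Algebra.Properties.Ring ring using (-‿distribˡ-*; -‿distribʳ-*)
  open Algebra.Properties.Semiring.Sum semiring using (sum-cong-≋; sum-replicate-zero; ∑-distrib-+; ∑-comm;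
           *-distribˡ-sum; *-distribʳ-sum)
  open Algebra.Properties.Semiring.Exp semiring using (^-congˡ)

  -- Ordered fields

  <-strictPartialOrder : StrictPartialOrder 0ℓ 0ℓ 0ℓ
  <-strictPartialOrder = record { isStrictPartialOrder = isStrictPartialOrder }

  module ≤ = Relation.Binary.Construct.StrictToNonStrict _≈_ _<_
  module Reasoning = Relation.Binary.Reasoning.StrictPartialOrder <-strictPartialOrder
  open Reasoning

  -- Integers serve as coefficients of the ring solver: their equality computes, whereas equality of
  -- reals is decided only through `lem`. The first clause makes `con (pos 12)` denote `fromℕ 12`
  -- definitionally.
  fromℤ : ℤ → R
  fromℤ (pos n)  = fromℕ n
  fromℤ -[1+ n ] = - fromℕ (suc n)

  fromℕ-+ : ∀ m n → fromℕ (m ℕ.+ n) ≈ fromℕ m + fromℕ n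
  fromℕ-+ = ×-homo-+ 1#

  fromℕ-* : ∀ m n → fromℕ (m ℕ.* n) ≈ fromℕ m * fromℕ n
  fromℕ-* = ×1-homo-*

  fromℤ-neg : ∀ i → fromℤ (ℤ.- i) ≈ - fromℤ i
  fromℤ-neg (pos zero)    = sym ε⁻¹≈ε
  fromℤ-neg (pos (suc n)) = refl
  fromℤ-neg -[1+ n ]      = sym (⁻¹-involutive _)

  cancel-1 : ∀ x y → (1# + x) - (1# + y) ≈ x - y
  cancel-1 x y = begin-equality
    (1# + x) - (1# + y)       ≈⟨ +-cong (+-comm 1# x) (sym (-‿+-comm 1# y)) ⟩
    (x + 1#) + (- 1# + - y)   ≈⟨ +-assoc x 1# _ ⟩
    x + (1# + (- 1# + - y))   ≈⟨ +-congˡ (sym (+-assoc 1# _ _)) ⟩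
    x + ((1# - 1#) + - y)     ≈⟨ +-congˡ (+-congʳ (-‿inverseʳ 1#)) ⟩
    x + (0# + - y)            ≈⟨ +-congˡ (+-identityˡ _) ⟩
    x - y                     ∎

  fromℤ-⊖ : ∀ m n → fromℤ (m ℤ.⊖ n) ≈ fromℕ m - fromℕ n
  fromℤ-⊖ zero    zero    = sym (-‿inverseʳ 0#)
  fromℤ-⊖ zero    (suc n) = sym (+-identityˡ _)
  fromℤ-⊖ (suc m) zero    = sym (trans (+-congˡ ε⁻¹≈ε) (+-identityʳ _))
  fromℤ-⊖ (suc m) (suc n) = begin-equality
    fromℤ (suc m ℤ.⊖ suc n)        ≡⟨ ≡.cong fromℤ (ℤₚ.[1+m]⊖[1+n]≡m⊖n m n) ⟩
    fromℤ (m ℤ.⊖ n)                ≈⟨ fromℤ-⊖ m n ⟩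
    fromℕ m - fromℕ n              ≈⟨ cancel-1 (fromℕ m) (fromℕ n) ⟨
    fromℕ (suc m) - fromℕ (suc n)  ∎

  fromℤ-+ : ∀ i j → fromℤ (i ℤ.+ j) ≈ fromℤ i + fromℤ j
  fromℤ-+ (pos m)  (pos n)  = fromℕ-+ m n
  fromℤ-+ (pos m)  -[1+ n ] = fromℤ-⊖ m (suc n)
  fromℤ-+ -[1+ m ] (pos n)  = trans (fromℤ-⊖ n (suc m)) (+-comm _ _)
  fromℤ-+ -[1+ m ] -[1+ n ] = begin-equality
    - fromℕ (suc (suc (m ℕ.+ n)))        ≡⟨ ≡.cong (λ k → - fromℕ (suc k)) (ℕₚ.+-suc m n) ⟨
    - fromℕ (suc m ℕ.+ suc n)            ≈⟨ -‿cong (fromℕ-+ (suc m) (suc n)) ⟩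
    - (fromℕ (suc m) + fromℕ (suc n))    ≈⟨ -‿+-comm _ _ ⟨
    - fromℕ (suc m) + - fromℕ (suc n)    ∎

  fromℤ-*-pos : ∀ m j → fromℤ (pos m ℤ.* j) ≈ fromℕ m * fromℤ j
  fromℤ-*-pos m (pos n) = begin-equality
    fromℤ (pos m ℤ.* pos n)  ≡⟨ ≡.cong fromℤ (ℤₚ.pos-* m n) ⟨
    fromℕ (m ℕ.* n)          ≈⟨ fromℕ-* m n ⟩
    fromℕ m * fromℕ n        ∎
  fromℤ-*-pos m -[1+ n ] = begin-equality
    fromℤ (pos m ℤ.* -[1+ n ])           ≡⟨ ≡.cong fromℤ (ℤₚ.neg-distribʳ-* (pos m) (pos (suc n))) ⟨
    fromℤ (ℤ.- (pos m ℤ.* pos (suc n)))  ≈⟨ fromℤ-neg (pos m ℤ.* pos (suc n)) ⟩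
    - fromℤ (pos m ℤ.* pos (suc n))      ≈⟨ -‿cong (fromℤ-*-pos m (pos (suc n))) ⟩
    - (fromℕ m * fromℕ (suc n))          ≈⟨ -‿distribʳ-* _ _ ⟩
    fromℕ m * - fromℕ (suc n)            ∎
  fromℤ-* : ∀ i j → fromℤ (i ℤ.* j) ≈ fromℤ i * fromℤ j
  fromℤ-* (pos m) j = fromℤ-*-pos m j
  fromℤ-* -[1+ m ] j = begin-equality
    fromℤ (-[1+ m ] ℤ.* j)               ≡⟨ ≡.cong fromℤ (ℤₚ.neg-distribˡ-* (pos (suc m)) j) ⟨
    fromℤ (ℤ.- (pos (suc m) ℤ.* j))      ≈⟨ fromℤ-neg (pos (suc m) ℤ.* j) ⟩
    - fromℤ (pos (suc m) ℤ.* j)          ≈⟨ -‿cong (fromℤ-*-pos (suc m) j) ⟩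
    - (fromℕ (suc m) * fromℤ j)          ≈⟨ -‿distribˡ-* _ _ ⟩
    - fromℕ (suc m) * fromℤ j            ∎

  fromℤ-≟ : ∀ i j → Maybe (fromℤ i ≈ fromℤ j)
  fromℤ-≟ i j with i ℤₚ.≟ j
  ... | yes i≡j = just (reflexive (≡.cong fromℤ i≡j))
  ... | no _    = nothing

  fromℤ-morphism : ℤ.+-*-rawRing ACR.-Raw-AlmostCommutative⟶ ACR.fromCommutativeRing commutativeRing
  fromℤ-morphism = record
    { ⟦_⟧    = fromℤ
    ; +-homo = fromℤ-+
    ; *-homo = fromℤ-*
    ; -‿homo = fromℤ-neg
    ; 0-homo = refl
    ; 1-homo = +-identityʳ 1#
    }

  module RingSolver = Algebra.Solver.Ring
    ℤ.+-*-rawRing (ACR.fromCommutativeRing commutativeRing) fromℤ-morphism fromℤ-≟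
  open RingSolver using (solve; _:=_; _:+_; _:*_; _:-_; :-_; _:^_; con; Polynomial)

  -- Unlike con (pos 1), which denotes 1# + 0#, this denotes 1# on the nose.
  :1 : ∀ {n} → Polynomial n
  :1 = con (pos 0) :^ 0

  :0 : ∀ {n} → Polynomial n
  :0 = con (pos 0)


  ≤-refl : ∀ {x} → x ≤ x
  ≤-refl = inj₂ refl

  ≤-reflexive : ∀ {x y} → x ≈ y → x ≤ y
  ≤-reflexive = inj₂

  <⇒≤ : ∀ {x y} → x < y → x ≤ y
  <⇒≤ = inj₁

  ≤-trans : ∀ {x y z} → x ≤ y → y ≤ z → x ≤ z
  ≤-trans = ≤.trans isEquivalence <-resp-≈ <-trans

  <-≤-trans : ∀ {x y z} → x < y → y ≤ z → x < z
  <-≤-trans = ≤.<-≤-trans <-trans <-respʳ-≈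

  ≤-<-trans : ∀ {x y z} → x ≤ y → y < z → x < z
  ≤-<-trans = ≤.≤-<-trans sym <-trans <-respˡ-≈

  ≤-antisym : ∀ {x y} → x ≤ y → y ≤ x → x ≈ y
  ≤-antisym = ≤.antisym isEquivalence <-trans <-irrefl

  ≤-respʳ-≈ : ∀ {x y z} → y ≈ z → x ≤ y → x ≤ z
  ≤-respʳ-≈ y≈z x≤y = ≤-trans x≤y (≤-reflexive y≈z)

  ≤-respˡ-≈ : ∀ {x y z} → y ≈ z → y ≤ x → z ≤ x
  ≤-respˡ-≈ y≈z y≤x = ≤-trans (≤-reflexive (sym y≈z)) y≤x

  ≤-<-connex : ∀ x y → x ≤ y ⊎ y < x
  ≤-<-connex x y with compare x y
  ... | tri< x<y _ _ = inj₁ (inj₁ x<y)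
  ... | tri≈ _ x≈y _ = inj₁ (inj₂ x≈y)
  ... | tri> _ _ y<x = inj₂ y<x

  ≤-total : ∀ x y → x ≤ y ⊎ y ≤ x
  ≤-total = ≤.total compare

  ≤⇒≯ : ∀ {x y} → x ≤ y → ¬ (y < x)
  ≤⇒≯ x≤y y<x = <-irrefl refl (≤-<-trans x≤y y<x)

  ≮⇒≥ : ∀ {x y} → ¬ (x < y) → y ≤ x
  ≮⇒≥ {x} {y} x≮y with ≤-<-connex y x
  ... | inj₁ y≤x = y≤x
  ... | inj₂ x<y = contradiction x<y x≮y

  ≰⇒> : ∀ {x y} → ¬ (x ≤ y) → y < x
  ≰⇒> {x} {y} x≰y with ≤-<-connex x y
  ... | inj₁ x≤y = contradiction x≤y x≰y
  ... | inj₂ y<x = y<x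

  x<y⇒0<y-x : ∀ {x y} → x < y → 0# < y - x
  x<y⇒0<y-x {x} {y} x<y = begin-strict
    0#       ≈⟨ -‿inverseˡ x ⟨
    - x + x  <⟨ +-monoʳ-< (- x) x<y ⟩
    - x + y  ≈⟨ +-comm (- x) y ⟩
    y - x    ∎

  x≤y⇒0≤y-x : ∀ {x y} → x ≤ y → 0# ≤ y - x
  x≤y⇒0≤y-x (inj₁ x<y) = inj₁ (x<y⇒0<y-x x<y)
  x≤y⇒0≤y-x {x} {y} (inj₂ x≈y) = inj₂ (sym (trans (+-congʳ (sym x≈y)) (-‿inverseʳ x)))

  -- A polynomial inequality is proved by exhibiting the difference of its two sides as
  -- something positive.
  <-by : ∀ {x y z} → 0# < z → y - x ≈ z → x < y
  <-by {x} {y} {z} 0<z y-x≈z = begin-strict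
    x            ≈⟨ +-identityʳ x ⟨
    x + 0#       <⟨ +-monoʳ-< x 0<z ⟩
    x + z        ≈⟨ +-congˡ y-x≈z ⟨
    x + (y - x)  ≈⟨ solve 2 (λ x y → x :+ (y :- x) := y) refl x y ⟩
    y            ∎

  ≤-by : ∀ {x y z} → 0# ≤ z → y - x ≈ z → x ≤ y
  ≤-by (inj₁ 0<z) y-x≈z = inj₁ (<-by 0<z y-x≈z)
  ≤-by {x} {y} {z} (inj₂ 0≈z) y-x≈z = inj₂ (begin-equality
    x            ≈⟨ +-identityˡ x ⟨
    0# + x       ≈⟨ +-congʳ (trans 0≈z (sym y-x≈z)) ⟩
    y - x + x    ≈⟨ solve 2 (λ x y → y :- x :+ x := y) refl x y ⟩
    y            ∎)

  0<x+y : ∀ {x y} → 0# < x → 0# ≤ y → 0# < x + y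
  0<x+y {x} {y} 0<x 0≤y = <-≤-trans 0<x (≤-by 0≤y (solve 2 (λ x y → x :+ y :- x := y) refl x y))

  0≤x+y : ∀ {x y} → 0# ≤ x → 0# ≤ y → 0# ≤ x + y
  0≤x+y {x} {y} 0≤x 0≤y = ≤-trans 0≤x (≤-by 0≤y (solve 2 (λ x y → x :+ y :- x := y) refl x y))

  0≤x*y : ∀ {x y} → 0# ≤ x → 0# ≤ y → 0# ≤ x * y
  0≤x*y (inj₁ 0<x) (inj₁ 0<y) = inj₁ (*-pos 0<x 0<y)
  0≤x*y (inj₁ 0<x) (inj₂ 0≈y) = inj₂ (sym (trans (*-congˡ (sym 0≈y)) (zeroʳ _)))
  0≤x*y (inj₂ 0≈x) _          = inj₂ (sym (trans (*-congʳ (sym 0≈x)) (zeroˡ _)))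

  -‿anti-≤ : ∀ {x y} → x ≤ y → - y ≤ - x
  -‿anti-≤ {x} {y} x≤y = ≤-by (x≤y⇒0≤y-x x≤y) (solve 2 (λ x y → :- x :- :- y := y :- x) refl x y)

  0≤-x : ∀ {x} → x ≤ 0# → 0# ≤ - x
  0≤-x x≤0 = ≤-respˡ-≈ ε⁻¹≈ε (-‿anti-≤ x≤0)

  0≤x² : ∀ x → 0# ≤ x * x
  0≤x² x with ≤-total 0# x
  ... | inj₁ 0≤x = 0≤x*y 0≤x 0≤x
  ... | inj₂ x≤0 = ≤-respʳ-≈ (solve 1 (λ x → :- x :* :- x := x :* x) refl x) (0≤x*y (0≤-x x≤0) (0≤-x x≤0))

  +-mono-≤ : ∀ {x y u v} → x ≤ y → u ≤ v → x + u ≤ y + v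
  +-mono-≤ {x} {y} {u} {v} x≤y u≤v = ≤-by (0≤x+y (x≤y⇒0≤y-x x≤y) (x≤y⇒0≤y-x u≤v))
    (solve 4 (λ x y u v → y :+ v :- (x :+ u) := (y :- x) :+ (v :- u)) refl x y u v)

  +-monoˡ-≤ : ∀ {x y} z → x ≤ y → x + z ≤ y + z
  +-monoˡ-≤ z x≤y = +-mono-≤ x≤y ≤-refl

  +-monoʳ-≤ : ∀ {x y} z → x ≤ y → z + x ≤ z + y
  +-monoʳ-≤ z x≤y = +-mono-≤ ≤-refl x≤y

  *-monoˡ-≤ : ∀ {x y z} → 0# ≤ z → x ≤ y → z * x ≤ z * y
  *-monoˡ-≤ {x} {y} {z} 0≤z x≤y = ≤-by (0≤x*y 0≤z (x≤y⇒0≤y-x x≤y))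
    (solve 3 (λ x y z → z :* y :- z :* x := z :* (y :- x)) refl x y z)

  *-mono-≤ : ∀ {x y u v} → 0# ≤ x → 0# ≤ u → x ≤ y → u ≤ v → x * u ≤ y * v
  *-mono-≤ {x} {y} {u} {v} 0≤x 0≤u x≤y u≤v =
    ≤-by (0≤x+y (0≤x*y (≤-trans 0≤x x≤y) (x≤y⇒0≤y-x u≤v)) (0≤x*y (x≤y⇒0≤y-x x≤y) 0≤u))
      (solve 4 (λ x y u v → y :* v :- x :* u := y :* (v :- u) :+ (y :- x) :* u) refl x y u v)

  *-monoˡ-< : ∀ {x y z} → 0# < z → x < y → z * x < z * y
  *-monoˡ-< {x} {y} {z} 0<z x<y = <-by (*-pos 0<z (x<y⇒0<y-x x<y))
    (solve 3 (λ x y z → z :* y :- z :* x := z :* (y :- x)) refl x y z)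

  *-cancelˡ-≤ : ∀ {x y z} → 0# < z → z * x ≤ z * y → x ≤ y
  *-cancelˡ-≤ 0<z zx≤zy = ≮⇒≥ λ y<x → ≤⇒≯ zx≤zy (*-monoˡ-< 0<z y<x)

  *-cancelˡ-< : ∀ {x y z} → 0# ≤ z → z * x < z * y → x < y
  *-cancelˡ-< 0≤z zx<zy = ≰⇒> λ y≤x → ≤⇒≯ (*-monoˡ-≤ 0≤z y≤x) zx<zy

  *-cancelˡ-≈ : ∀ {x y z} → 0# < z → z * x ≈ z * y → x ≈ y
  *-cancelˡ-≈ 0<z eq = ≤-antisym (*-cancelˡ-≤ 0<z (inj₂ eq)) (*-cancelˡ-≤ 0<z (inj₂ (sym eq)))

  square-cancel-≤ : ∀ {x y} → 0# ≤ y → x * x ≤ y * y → x ≤ y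
  square-cancel-≤ {x} {y} 0≤y x²≤y² with ≤-<-connex x y
  ... | inj₁ x≤y = x≤y
  ... | inj₂ y<x = contradiction (<-≤-trans (begin-strict
    y * y  ≤⟨ *-monoˡ-≤ 0≤y (<⇒≤ y<x) ⟩
    y * x  ≈⟨ *-comm y x ⟩
    x * y  <⟨ *-monoˡ-< (≤-<-trans 0≤y y<x) y<x ⟩
    x * x  ∎) x²≤y²) (<-irrefl refl)

  square-cancel-< : ∀ {x y} → 0# ≤ y → x * x < y * y → x < y
  square-cancel-< {x} {y} 0≤y x²<y² with ≤-<-connex y x
  ... | inj₁ y≤x = contradiction x²<y² (≤⇒≯ (*-mono-≤ 0≤y 0≤y y≤x y≤x))
  ... | inj₂ x<y = x<y

  0≤1 : 0# ≤ 1#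
  0≤1 = <⇒≤ 0<1

  0≤fromℕ : ∀ n → 0# ≤ fromℕ n
  0≤fromℕ zero    = ≤-refl
  0≤fromℕ (suc n) = 0≤x+y 0≤1 (0≤fromℕ n)

  0<fromℕ : ∀ {n} → 1 ℕ.≤ n → 0# < fromℕ n
  0<fromℕ {suc n} _ = 0<x+y 0<1 (0≤fromℕ n)

  0<2 : 0# < fromℕ 2
  0<2 = 0<fromℕ {2} (ℕ.s≤s ℕ.z≤n)

  fromℕ-mono-≤ : ∀ {m n} → m ℕ.≤ n → fromℕ m ≤ fromℕ n
  fromℕ-mono-≤ {n = n} ℕ.z≤n   = 0≤fromℕ n
  fromℕ-mono-≤ (ℕ.s≤s m≤n) = +-monoʳ-≤ 1# (fromℕ-mono-≤ m≤n)

  1≤fromℕ : ∀ {n} → 1 ℕ.≤ n → 1# ≤ fromℕ n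
  1≤fromℕ 1≤n = ≤-respˡ-≈ (+-identityʳ 1#) (fromℕ-mono-≤ {1} 1≤n)

  fromℕ-∸ : ∀ {m n} → m ℕ.≤ n → fromℕ (n ℕ.∸ m) ≈ fromℕ n - fromℕ m
  fromℕ-∸ {m} {n} m≤n = begin-equality
    fromℕ (n ℕ.∸ m)                          ≈⟨ solve 2 (λ x y → x := x :+ y :- y) refl _ (fromℕ m) ⟩
    fromℕ (n ℕ.∸ m) + fromℕ m - fromℕ m      ≈⟨ +-congʳ (fromℕ-+ (n ℕ.∸ m) m) ⟨
    fromℕ (n ℕ.∸ m ℕ.+ m) - fromℕ m          ≡⟨ ≡.cong (λ k → fromℕ k - fromℕ m) (ℕₚ.m∸n+n≡m m≤n) ⟩
    fromℕ n - fromℕ m                        ∎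

  0<x⇒x≉0 : ∀ {x} → 0# < x → ¬ (x ≈ 0#)
  0<x⇒x≉0 0<x x≈0 = <-irrefl (sym x≈0) 0<x

  ⁻¹-inverse : ∀ {x} → 0# < x → x * x ⁻¹ ≈ 1#
  ⁻¹-inverse 0<x = ⁻¹-inverseʳ (0<x⇒x≉0 0<x)

  0<x⁻¹ : ∀ {x} → 0# < x → 0# < x ⁻¹
  0<x⁻¹ {x} 0<x = *-cancelˡ-< (<⇒≤ 0<x) (begin-strict
    x * 0#    ≈⟨ zeroʳ x ⟩
    0#        <⟨ 0<1 ⟩
    1#        ≈⟨ ⁻¹-inverse 0<x ⟨
    x * x ⁻¹  ∎)

  x*[y/x]≈y : ∀ {x} → 0# < x → ∀ y → x * (y / x) ≈ y
  x*[y/x]≈y {x} 0<x y = begin-equality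
    x * (y * x ⁻¹)  ≈⟨ solve 3 (λ x y z → x :* (y :* z) := (x :* z) :* y) refl x y (x ⁻¹) ⟩
    (x * x ⁻¹) * y  ≈⟨ *-congʳ (⁻¹-inverse 0<x) ⟩
    1# * y          ≈⟨ *-identityˡ y ⟩
    y               ∎

  0<x/y : ∀ {x y} → 0# < x → 0# < y → 0# < x / y
  0<x/y 0<x 0<y = *-pos 0<x (0<x⁻¹ 0<y)

  half : R → R
  half x = x / fromℕ 2

  0<half : ∀ {x} → 0# < x → 0# < half x
  0<half 0<x = 0<x/y 0<x 0<2

  half+half : ∀ x → half x + half x ≈ x
  half+half x = trans
    (solve 1 (λ y → y :+ y := con (pos 2) :* y) refl (half x)) (x*[y/x]≈y 0<2 x)

  ∣x∣≈±x : ∀ x → (0# ≤ x × ∣ x ∣ ≈ x) ⊎ (x ≤ 0# × ∣ x ∣ ≈ - x)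
  ∣x∣≈±x x with compare 0# x
  ... | tri< 0<x _ _ = inj₁ (inj₁ 0<x , refl)
  ... | tri≈ _ 0≈x _ = inj₁ (inj₂ 0≈x , refl)
  ... | tri> _ _ x<0 = inj₂ (inj₁ x<0 , refl)

  0≤x⇒∣x∣≈x : ∀ {x} → 0# ≤ x → ∣ x ∣ ≈ x
  0≤x⇒∣x∣≈x {x} 0≤x with ∣x∣≈±x x
  ... | inj₁ (_ , eq)   = eq
  ... | inj₂ (x≤0 , eq) = trans eq (trans (-‿cong x≈0) (trans ε⁻¹≈ε (sym x≈0)))
    where x≈0 = ≤-antisym x≤0 0≤x

  x≤∣x∣ : ∀ x → x ≤ ∣ x ∣
  x≤∣x∣ x with ∣x∣≈±x x
  ... | inj₁ (_ , eq)   = inj₂ (sym eq)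
  ... | inj₂ (x≤0 , eq) = ≤-respʳ-≈ (sym eq) (≤-trans x≤0 (0≤-x x≤0))

  -x≤∣x∣ : ∀ x → - x ≤ ∣ x ∣
  -x≤∣x∣ x with ∣x∣≈±x x
  ... | inj₁ (0≤x , eq) = ≤-respʳ-≈ (sym eq) (≤-trans (≤-respʳ-≈ ε⁻¹≈ε (-‿anti-≤ 0≤x)) 0≤x)
  ... | inj₂ (_ , eq)   = inj₂ (sym eq)

  0≤∣x∣ : ∀ x → 0# ≤ ∣ x ∣
  0≤∣x∣ x with ∣x∣≈±x x
  ... | inj₁ (0≤x , eq) = ≤-respʳ-≈ (sym eq) 0≤x
  ... | inj₂ (x≤0 , eq) = ≤-respʳ-≈ (sym eq) (0≤-x x≤0)

  ∣x∣≤ : ∀ {x c} → x ≤ c → - x ≤ c → ∣ x ∣ ≤ c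
  ∣x∣≤ {x} x≤c -x≤c with ∣x∣≈±x x
  ... | inj₁ (_ , eq) = ≤-respˡ-≈ (sym eq) x≤c
  ... | inj₂ (_ , eq) = ≤-respˡ-≈ (sym eq) -x≤c

  ∣x∣< : ∀ {x c} → x < c → - x < c → ∣ x ∣ < c
  ∣x∣< {x} x<c -x<c with ∣x∣≈±x x
  ... | inj₁ (_ , eq) = ≤-<-trans (inj₂ eq) x<c
  ... | inj₂ (_ , eq) = ≤-<-trans (inj₂ eq) -x<c

  ∣∣-cong : ∀ {x y} → x ≈ y → ∣ x ∣ ≈ ∣ y ∣
  ∣∣-cong {x} {y} x≈y = ≤-antisym
    (∣x∣≤ (≤-respˡ-≈ (sym x≈y) (x≤∣x∣ y)) (≤-respˡ-≈ (-‿cong (sym x≈y)) (-x≤∣x∣ y)))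
    (∣x∣≤ (≤-respˡ-≈ x≈y (x≤∣x∣ x)) (≤-respˡ-≈ (-‿cong x≈y) (-x≤∣x∣ x)))

  ∣∣-neg : ∀ x → ∣ - x ∣ ≈ ∣ x ∣
  ∣∣-neg x = ≤-antisym
    (∣x∣≤ (-x≤∣x∣ x) (≤-respˡ-≈ (sym (⁻¹-involutive x)) (x≤∣x∣ x)))
    (∣x∣≤ (≤-respˡ-≈ (⁻¹-involutive x) (-x≤∣x∣ (- x))) (x≤∣x∣ (- x)))

  ∣x-y∣≈∣y-x∣ : ∀ x y → ∣ x - y ∣ ≈ ∣ y - x ∣
  ∣x-y∣≈∣y-x∣ x y = trans (∣∣-cong (solve 2 (λ x y → x :- y := :- (y :- x)) refl x y)) (∣∣-neg (y - x))

  ∣x+y∣≤∣x∣+∣y∣ : ∀ x y → ∣ x + y ∣ ≤ ∣ x ∣ + ∣ y ∣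
  ∣x+y∣≤∣x∣+∣y∣ x y = ∣x∣≤ (+-mono-≤ (x≤∣x∣ x) (x≤∣x∣ y))
    (≤-respˡ-≈ (-‿+-comm x y) (+-mono-≤ (-x≤∣x∣ x) (-x≤∣x∣ y)))

  ∣x∣²≈x² : ∀ x → ∣ x ∣ * ∣ x ∣ ≈ x * x
  ∣x∣²≈x² x with ∣x∣≈±x x
  ... | inj₁ (_ , eq) = *-cong eq eq
  ... | inj₂ (_ , eq) = trans (*-cong eq eq) (solve 1 (λ x → :- x :* :- x := x :* x) refl x)

  ∣x*y∣≈∣x∣*∣y∣ : ∀ x y → ∣ x * y ∣ ≈ ∣ x ∣ * ∣ y ∣
  ∣x*y∣≈∣x∣*∣y∣ x y = ≤-antisym
    (square-cancel-≤ (0≤x*y (0≤∣x∣ x) (0≤∣x∣ y)) (≤-reflexive eq))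
    (square-cancel-≤ (0≤∣x∣ (x * y)) (≤-reflexive (sym eq)))
    where
    eq : ∣ x * y ∣ * ∣ x * y ∣ ≈ (∣ x ∣ * ∣ y ∣) * (∣ x ∣ * ∣ y ∣)
    eq = begin-equality
      ∣ x * y ∣ * ∣ x * y ∣              ≈⟨ ∣x∣²≈x² (x * y) ⟩
      (x * y) * (x * y)                  ≈⟨ solve 2 (λ x y → (x :* y) :* (x :* y) := (x :* x) :* (y :* y)) refl x y ⟩
      (x * x) * (y * y)                  ≈⟨ *-cong (∣x∣²≈x² x) (∣x∣²≈x² y) ⟨
      (∣ x ∣ * ∣ x ∣) * (∣ y ∣ * ∣ y ∣)  ≈⟨ solve 2 (λ x y → (x :* x) :* (y :* y) := (x :* y) :* (x :* y)) refl ∣ x ∣ ∣ y ∣ ⟩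
      (∣ x ∣ * ∣ y ∣) * (∣ x ∣ * ∣ y ∣)  ∎

  -- Classical logic and the Archimedean property.

  dne : ∀ {p} {P : Set p} → ¬ ¬ P → P
  dne {P = P} ¬¬P with lem {P = P}
  ... | yes p = p
  ... | no ¬p = contradiction ¬p ¬¬P

  ¬∀⇒∃¬ : ∀ {a p} {A : Set a} {P : A → Set p} → ¬ (∀ x → P x) → ∃ λ x → ¬ P x
  ¬∀⇒∃¬ ¬∀ = dne λ ¬∃¬ → ¬∀ λ x → dne λ ¬Px → ¬∃¬ (x , ¬Px)

  -- For a supremum `s` of the naturals, `n + 1 ≤ s` for every `n` would make `s - 1` an upper bound
  -- as well.
  fromℕ-unbounded : ∀ x → ¬ (∀ n → fromℕ n ≤ x)
  fromℕ-unbounded x bound = no-supremum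
    (complete Range (0# , 0 , ≡.refl) (x , λ { _ (n , ≡.refl) → bound n }))
    where
    Range : Pred R 0ℓ
    Range y = ∃ λ n → y ≡ fromℕ n

    no-supremum : ¬ ∃ (IsSupremum Range)
    no-supremum (s , upper , least) = ≤⇒≯ (least (s - 1#) below) s-1<s
      where
      s-1<s : s - 1# < s
      s-1<s = <-by 0<1 (solve 1 (λ s → s :- (s :- :1) := :1) refl s)
      below : ∀ y → Range y → y ≤ s - 1#
      below _ (n , ≡.refl) = ≤-by (x≤y⇒0≤y-x (upper (fromℕ (suc n)) (suc n , ≡.refl)))
        (solve 2 (λ s k → s :- :1 :- k := s :- (:1 :+ k)) refl s (fromℕ n))

  abstract
    archimedean : ∀ x → ∃ λ n → x < fromℕ n
    archimedean x = map₂ ≰⇒> (¬∀⇒∃¬ (fromℕ-unbounded x))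

  fromℕ-suc-* : ∀ n x → fromℕ (suc n) * x ≈ x + fromℕ n * x
  fromℕ-suc-* n x = solve 2 (λ n x → (:1 :+ n) :* x := x :+ n :* x) refl (fromℕ n) x

  abstract
    archimedean-inv : ∀ {ε} → 0# < ε → ∃ λ n → 1# ≤ fromℕ (suc n) * ε
    archimedean-inv {ε} 0<ε = suc-bound (archimedean (ε ⁻¹))
      where
      suc-bound : (∃ λ n → ε ⁻¹ < fromℕ n) → ∃ λ n → 1# ≤ fromℕ (suc n) * ε
      suc-bound (n , ε⁻¹<n) = n , (begin
        1#                    ≈⟨ ⁻¹-inverse 0<ε ⟨
        ε * ε ⁻¹              ≤⟨ *-monoˡ-≤ (<⇒≤ 0<ε) (<⇒≤ ε⁻¹<n) ⟩
        ε * fromℕ n           ≈⟨ trans (*-comm _ _) (sym (+-identityˡ _)) ⟩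
        0# + fromℕ n * ε      ≤⟨ +-monoˡ-≤ _ (<⇒≤ 0<ε) ⟩
        ε + fromℕ n * ε       ≈⟨ fromℕ-suc-* n ε ⟨
        fromℕ (suc n) * ε     ∎)

  ≤-from-ε : ∀ {x y} → (∀ ε → 0# < ε → x ≤ y + ε) → x ≤ y
  ≤-from-ε {x} {y} x≤y+ε = ≮⇒≥ λ y<x → let 0<x-y = x<y⇒0<y-x y<x in
    ≤⇒≯ (x≤y+ε (half (x - y)) (0<half 0<x-y))
      (<-by (0<half 0<x-y) (begin-equality
        x - (y + half (x - y))  ≈⟨ solve 3 (λ x y h → x :- (y :+ h) := (x :- y) :- h) refl x y (half (x - y)) ⟩
        (x - y) - half (x - y)  ≈⟨ +-congʳ (sym (half+half (x - y))) ⟩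
        half (x - y) + half (x - y) - half (x - y)  ≈⟨ solve 1 (λ h → h :+ h :- h := h) refl (half (x - y)) ⟩
        half (x - y) ∎))

  ≈-from-ε : ∀ {x y} → (∀ ε → 0# < ε → ∣ x - y ∣ ≤ ε) → x ≈ y
  ≈-from-ε {x} {y} close = ≤-antisym
    (≤-from-ε λ ε 0<ε → ≤-by (x≤y⇒0≤y-x (≤-trans (x≤∣x∣ (x - y)) (close ε 0<ε)))
      (solve 3 (λ x y e → y :+ e :- x := e :- (x :- y)) refl x y ε))
    (≤-from-ε λ ε 0<ε → ≤-by (x≤y⇒0≤y-x (≤-trans (-x≤∣x∣ (x - y)) (close ε 0<ε)))
      (solve 3 (λ x y e → x :+ e :- y := e :- :- (x :- y)) refl x y ε))

  -- Powers and the tangent inequality.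

  1^n≈1 : ∀ n → 1# ^ n ≈ 1#
  1^n≈1 zero    = refl
  1^n≈1 (suc n) = trans (*-identityˡ _) (1^n≈1 n)

  0≤x^n : ∀ {x} n → 0# ≤ x → 0# ≤ x ^ n
  0≤x^n zero    0≤x = 0≤1
  0≤x^n (suc n) 0≤x = 0≤x*y 0≤x (0≤x^n n 0≤x)

  0<x^n : ∀ {x} n → 0# < x → 0# < x ^ n
  0<x^n zero    0<x = 0<1
  0<x^n (suc n) 0<x = *-pos 0<x (0<x^n n 0<x)

  ^-monoˡ-≤ : ∀ {x y} n → 0# ≤ x → x ≤ y → x ^ n ≤ y ^ n
  ^-monoˡ-≤ zero    0≤x x≤y = ≤-refl
  ^-monoˡ-≤ (suc n) 0≤x x≤y = *-mono-≤ 0≤x (0≤x^n n 0≤x) x≤y (^-monoˡ-≤ n 0≤x x≤y)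

  1≤x^n : ∀ {x} n → 1# ≤ x → 1# ≤ x ^ n
  1≤x^n zero    1≤x = ≤-refl
  1≤x^n (suc n) 1≤x = ≤-respˡ-≈ (*-identityˡ 1#) (*-mono-≤ 0≤1 0≤1 1≤x (1≤x^n n 1≤x))

  -- Convexity of a power: its graph lies above the tangent at `q`. Multiplying the inequality for
  -- one exponent by `p` exceeds the next one by `(n + 1) q^n (p - q)²`. Exchanging `p` and `q`
  -- gives upper bounds, so this replaces all differentiation below.
  ^-tangent : ∀ n {p q} → 0# ≤ p → 0# ≤ q →
              q ^ suc n + fromℕ (suc n) * q ^ n * (p - q) ≤ p ^ suc n
  ^-tangent zero {p} {q} 0≤p 0≤q = ≤-reflexive
    (solve 2 (λ p q → q :^ 1 :+ (:1 :+ :0) :* :1 :* (p :- q) := p :^ 1) refl p q)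
  ^-tangent (suc n) {p} {q} 0≤p 0≤q = begin
    q ^ suc (suc n) + fromℕ (suc (suc n)) * q ^ suc n * (p - q)
      ≤⟨ ≤-by (0≤x*y (0≤x*y (0≤fromℕ (suc n)) (0≤x^n n 0≤q)) (0≤x² (p - q)))
          (solve 4 (λ p q k r → p :* (q :* r :+ k :* r :* (p :- q))
                             :- (q :* (q :* r) :+ (:1 :+ k) :* (q :* r) :* (p :- q))
                             := k :* r :* ((p :- q) :* (p :- q)))
            refl p q (fromℕ (suc n)) (q ^ n)) ⟩
    p * (q ^ suc n + fromℕ (suc n) * q ^ n * (p - q))
      ≤⟨ *-monoˡ-≤ 0≤p (^-tangent n 0≤p 0≤q) ⟩
    p ^ suc (suc n) ∎

  -- Roots, the logarithm and the growth condition

  -- The premise `Q 0#` covers the default value, so a description can be bounded before anything is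
  -- known about existence.
  the-elim : ∀ {ℓ q} {P : Pred R ℓ} {Q : Pred R q} → (∀ x → P x → Q x) → Q 0# → Q (the P)
  the-elim {P = P} P⇒Q Q0 with lem {P = ∃ P}
  ... | yes (x , Px) = P⇒Q x Px
  ... | no _         = Q0

  the-satisfies : ∀ {ℓ} {P : Pred R ℓ} → ∃ P → P (the P)
  the-satisfies {P = P} ∃P with lem {P = ∃ P}
  ... | yes (_ , Px) = Px
  ... | no ∄P        = contradiction ∃P ∄P

  the-unique : ∀ {ℓ} {P : Pred R ℓ} {x} → (∀ {y} → P y → y ≈ x) → P x → the P ≈ x
  the-unique {P = P} {x} unique Px = unique (the-satisfies {P = P} (x , Px))

  ⟶-unique : ∀ {u a b} → u ⟶ a → u ⟶ b → a ≈ b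
  ⟶-unique {u} {a} {b} u⟶a u⟶b = ≈-from-ε λ ε 0<ε →
    let N , near-a = u⟶a (half ε) (0<half 0<ε)
        M , near-b = u⟶b (half ε) (0<half 0<ε)
        n = N ℕ.+ M
    in begin
      ∣ a - b ∣                    ≈⟨ ∣∣-cong (solve 3 (λ a b u → a :- b := (a :- u) :+ (u :- b)) refl a b (u n)) ⟩
      ∣ (a - u n) + (u n - b) ∣    ≤⟨ ∣x+y∣≤∣x∣+∣y∣ _ _ ⟩
      ∣ a - u n ∣ + ∣ u n - b ∣    ≤⟨ +-mono-≤ (≤-respˡ-≈ (∣x-y∣≈∣y-x∣ (u n) a) (<⇒≤ (near-a n (ℕₚ.m≤m+n N M))))
                                               (<⇒≤ (near-b n (ℕₚ.m≤n+m M N))) ⟩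
      half ε + half ε              ≈⟨ half+half ε ⟩
      ε                            ∎

  ⟶-≤ : ∀ {u l c} → (∃ λ N → ∀ n → N ℕ.≤ n → u n ≤ c) → u ⟶ l → l ≤ c
  ⟶-≤ {u} {l} {c} (N , u≤c) u⟶l = ≤-from-ε λ ε 0<ε →
    let M , near = u⟶l ε 0<ε
        n = N ℕ.+ M
    in begin
      l                ≈⟨ solve 2 (λ l u → l := u :+ :- (u :- l)) refl l (u n) ⟩
      u n + - (u n - l)  ≤⟨ +-mono-≤ (u≤c n (ℕₚ.m≤m+n N M)) (≤-trans (-x≤∣x∣ _) (<⇒≤ (near n (ℕₚ.m≤n+m M N)))) ⟩
      c + ε            ∎

  abstract
    small-factor : ∀ {ε K} → 0# < ε → 0# < K → ∃ λ δ → 0# < δ × δ + δ ≤ 1# × K * δ ≤ ε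
    small-factor {ε} {K} 0<ε 0<K with ≤-total (half 1#) (ε / K)
    ... | inj₁ h≤ε/K = half 1# , 0<half 0<1 , inj₂ (half+half 1#) ,
      ≤-respʳ-≈ (x*[y/x]≈y 0<K ε) (*-monoˡ-≤ (<⇒≤ 0<K) h≤ε/K)
    ... | inj₂ ε/K≤h = ε / K , 0<x/y 0<ε 0<K , ≤-respʳ-≈ (half+half 1#) (+-mono-≤ ε/K≤h ε/K≤h) ,
      inj₂ (x*[y/x]≈y 0<K ε)

  -- An intermediate value theorem for the supremum of a family of functions.
  module Crossing
    (f : ℕ → R → R) (v K b : R) (0<K : 0# < K)
    (mono : ∀ m {x y} → 0# ≤ x → x ≤ y → f m x ≤ f m y)
    (growth : ∀ m {x δ} → 0# ≤ x → 0# < δ → δ + δ ≤ 1# → f m x ≤ v → f m (x + δ) ≤ f m x + K * δ)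
    (start : ∀ m → f m 0# ≤ v)
    (bound : ∀ x → (∀ m → f m x ≤ v) → x ≤ b)
    where

    Below : Pred R 0ℓ
    Below x = 0# ≤ x × (∀ m → f m x ≤ v)

    supremum : ∃ (IsSupremum Below)
    supremum = complete Below (0# , ≤-refl , start) (b , λ x (_ , fx≤v) → bound x fx≤v)

    s = proj₁ supremum

    0≤s : 0# ≤ s
    0≤s = proj₁ (proj₂ supremum) 0# (≤-refl , start)

    below-near-s : ∀ {δ} → 0# < δ → ∃ λ x → Below x × s ≤ x + δ
    below-near-s {δ} 0<δ with lem {P = ∃ λ x → Below x × s ≤ x + δ}
    ... | yes found = found
    ... | no  none  = contradiction
      (<-by 0<δ (solve 2 (λ s d → s :- (s :- d) := d) refl s δ))
      (≤⇒≯ (proj₂ (proj₂ supremum) (s - δ) λ x Bx → ≮⇒≥ λ s-δ<x →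
        none (x , Bx , ≤-by (<⇒≤ (x<y⇒0<y-x s-δ<x)) (solve 3 (λ x s d → x :+ d :- s := x :- (s :- d)) refl x s δ))))

    -- Elements of `Below` come arbitrarily close to `s`, and `growth` limits the increase over the
    -- remaining distance.
    f≤v : ∀ m → f m s ≤ v
    f≤v m = ≤-from-ε λ ε 0<ε →
      let δ , 0<δ , 2δ≤1 , Kδ≤ε = small-factor 0<ε 0<K
          x , (0≤x , fx≤v) , s≤x+δ = below-near-s 0<δ
      in begin
        f m s          ≤⟨ mono m 0≤s s≤x+δ ⟩
        f m (x + δ)    ≤⟨ growth m 0≤x 0<δ 2δ≤1 (fx≤v m) ⟩
        f m x + K * δ  ≤⟨ +-mono-≤ (fx≤v m) Kδ≤ε ⟩
        v + ε          ∎

    -- If every `f m s` stayed at least `ε` below `v`, a step `δ` with `K δ ≤ ε` would lead from `s`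
    -- to a larger element of `Below`.
    v<f+ε : ∀ ε → 0# < ε → ∃ λ m → v < f m s + ε
    v<f+ε ε 0<ε with lem {P = ∃ λ m → v < f m s + ε}
    ... | yes found = found
    ... | no  none  =
      let δ , 0<δ , 2δ≤1 , Kδ≤ε = small-factor 0<ε 0<K
      in contradiction
        (<-by 0<δ (solve 2 (λ s d → s :+ d :- s := d) refl s δ))
        (≤⇒≯ (proj₁ (proj₂ supremum) (s + δ) (0≤x+y 0≤s (<⇒≤ 0<δ) , λ m → begin
          f m (s + δ)    ≤⟨ growth m 0≤s 0<δ 2δ≤1 (f≤v m) ⟩
          f m s + K * δ  ≤⟨ +-monoʳ-≤ (f m s) Kδ≤ε ⟩
          f m s + ε      ≤⟨ ≮⇒≥ (λ v<f+ε → none (m , v<f+ε)) ⟩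
          v              ∎)))

  -- The crossing argument for a constant family, with the slope of the power bounded by its value
  -- at `c`.
  root-exists : ∀ k {v} → 0# ≤ v → ∃ λ y → 0# ≤ y × y ^ suc k ≈ v
  root-exists k {v} 0≤v = s , 0≤s , ≤-antisym (f≤v 0) (≤-from-ε λ ε 0<ε → <⇒≤ (proj₂ (v<f+ε ε 0<ε)))
    where
    1≤1+v : 1# ≤ 1# + v
    1≤1+v = ≤-respˡ-≈ (+-identityʳ 1#) (+-monoʳ-≤ 1# 0≤v)

    bound : ∀ x → x ^ suc k ≤ v → x ≤ 1# + v
    bound x x^n≤v = ≮⇒≥ λ 1+v<x →
      let 1≤x = ≤-trans 1≤1+v (<⇒≤ 1+v<x) in
      <-irrefl refl (begin-strict
        v          ≈⟨ +-identityˡ v ⟨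
        0# + v     ≤⟨ +-monoˡ-≤ v 0≤1 ⟩
        1# + v     <⟨ 1+v<x ⟩
        x          ≈⟨ *-identityʳ x ⟨
        x * 1#     ≤⟨ *-monoˡ-≤ (≤-trans 0≤1 1≤x) (1≤x^n k 1≤x) ⟩
        x ^ suc k  ≤⟨ x^n≤v ⟩
        v          ∎)

    -- Points below the level `v` lie under `1 + v`, and a step `δ` is at most 1, so `c` bounds
    -- every point that `growth` reaches.
    c = 1# + (1# + v)
    1≤c : 1# ≤ c
    1≤c = ≤-respˡ-≈ (+-identityʳ 1#) (+-monoʳ-≤ 1# (≤-trans 0≤1 1≤1+v))

    growth : ∀ (m : ℕ) {x δ} → 0# ≤ x → 0# < δ → δ + δ ≤ 1# → x ^ suc k ≤ v →
             (x + δ) ^ suc k ≤ x ^ suc k + fromℕ (suc k) * c ^ k * δ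
    growth _ {x} {δ} 0≤x 0<δ 2δ≤1 x^n≤v = begin
      (x + δ) ^ suc k
        ≤⟨ ≤-by (x≤y⇒0≤y-x (^-tangent k 0≤x 0≤x+δ))
             (solve 5 (λ x δ q r t → t :+ q :* r :* δ :- (x :+ δ) :* r := t :- ((x :+ δ) :* r :+ q :* r :* (x :- (x :+ δ))))
               refl x δ (fromℕ (suc k)) ((x + δ) ^ k) (x ^ suc k)) ⟩
      x ^ suc k + fromℕ (suc k) * (x + δ) ^ k * δ
        ≤⟨ +-monoʳ-≤ (x ^ suc k) (*-mono-≤ (0≤x*y (0≤fromℕ (suc k)) (0≤x^n k 0≤x+δ)) (<⇒≤ 0<δ)
             (*-monoˡ-≤ (0≤fromℕ (suc k)) (^-monoˡ-≤ k 0≤x+δ x+δ≤c)) ≤-refl) ⟩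
      x ^ suc k + fromℕ (suc k) * c ^ k * δ ∎
      where
      0≤x+δ : 0# ≤ x + δ
      0≤x+δ = 0≤x+y 0≤x (<⇒≤ 0<δ)
      x+δ≤c : x + δ ≤ c
      x+δ≤c = ≤-respˡ-≈ (+-comm δ x) (+-mono-≤ (≤-trans (≤-respˡ-≈ (+-identityʳ δ) (+-monoʳ-≤ δ (<⇒≤ 0<δ))) 2δ≤1) (bound x x^n≤v))

    open Crossing (λ _ y → y ^ suc k) v (fromℕ (suc k) * c ^ k) (1# + v)
      (*-pos (0<fromℕ {suc k} (ℕ.s≤s ℕ.z≤n)) (0<x^n k (<-≤-trans 0<1 1≤c)))
      (λ _ → ^-monoˡ-≤ (suc k))
      growth
      (λ _ → ≤-respˡ-≈ (sym (zeroˡ _)) 0≤v)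
      (λ x below → bound x (below 0))

  root-spec : ∀ k {x} → 0# ≤ x → 0# ≤ root (suc k) x × root (suc k) x ^ suc k ≈ x
  root-spec k 0≤x = the-satisfies (root-exists k 0≤x)

  -- The terms of the sequence defining `exp`, shifted by one so that the unspecified inverse of
  -- `0#` does not occur.
  compound : ℕ → R → R
  compound m x = (1# + x / fromℕ (suc m)) ^ suc m

  0≤x/n : ∀ m {x} → 0# ≤ x → 0# ≤ x / fromℕ (suc m)
  0≤x/n m 0≤x = 0≤x*y 0≤x (<⇒≤ (0<x⁻¹ (0<fromℕ {suc m} (ℕ.s≤s ℕ.z≤n))))

  n*[x/n]≈x : ∀ m x → fromℕ (suc m) * (x / fromℕ (suc m)) ≈ x
  n*[x/n]≈x m = x*[y/x]≈y (0<fromℕ {suc m} (ℕ.s≤s ℕ.z≤n))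

  0≤1+x/n : ∀ m {x} → 0# ≤ x → 0# ≤ 1# + x / fromℕ (suc m)
  0≤1+x/n m 0≤x = 0≤x+y 0≤1 (0≤x/n m 0≤x)

  1≤1+x/n : ∀ m {x} → 0# ≤ x → 1# ≤ 1# + x / fromℕ (suc m)
  1≤1+x/n m 0≤x = ≤-respˡ-≈ (+-identityʳ 1#) (+-monoʳ-≤ 1# (0≤x/n m 0≤x))

  base-mono : ∀ m {x y} → x ≤ y → 1# + x / fromℕ (suc m) ≤ 1# + y / fromℕ (suc m)
  base-mono m {x} {y} x≤y = ≤-by (0≤x/n m (x≤y⇒0≤y-x x≤y))
    (solve 3 (λ x y i → :1 :+ y :* i :- (:1 :+ x :* i) := (y :- x) :* i) refl x y (fromℕ (suc m) ⁻¹))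

  compound-mono : ∀ m {x y} → 0# ≤ x → x ≤ y → compound m x ≤ compound m y
  compound-mono m 0≤x x≤y = ^-monoˡ-≤ (suc m) (0≤1+x/n m 0≤x) (base-mono m x≤y)

  compound-0 : ∀ m → compound m 0# ≈ 1#
  compound-0 m = trans (^-congˡ (suc m) (trans (+-congˡ (zeroˡ _)) (+-identityʳ 1#))) (1^n≈1 (suc m))

  -- A discrete form of `exp′ = exp`. In the tangent inequality at the right end point the factor
  -- `m + 1` turns the difference of the bases into `δ`, and one more factor `q ≥ 1` completes the
  -- power.
  compound-growth : ∀ m {x δ} → 0# ≤ x → 0# ≤ δ → compound m (x + δ) ≤ compound m x + compound m (x + δ) * δ
  compound-growth m {x} {δ} 0≤x 0≤δ = begin
    q ^ suc m
      ≤⟨ ≤-by (x≤y⇒0≤y-x (^-tangent m (0≤1+x/n m 0≤x) (0≤1+x/n m 0≤x+δ)))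
           (trans (+-congʳ (+-congˡ (*-congˡ (sym (n*[x/n]≈x m δ)))))
             (solve 6 (λ x δ i k r t →
                  t :+ r :* (k :* (δ :* i)) :- (:1 :+ (x :+ δ) :* i) :* r
                  := t :- ((:1 :+ (x :+ δ) :* i) :* r :+ k :* r :* (:1 :+ x :* i :- (:1 :+ (x :+ δ) :* i))))
               refl x δ (fromℕ (suc m) ⁻¹) (fromℕ (suc m)) (q ^ m) (p ^ suc m))) ⟩
    p ^ suc m + q ^ m * δ
      ≤⟨ +-monoʳ-≤ (p ^ suc m) (*-mono-≤ (0≤x^n m 0≤q) 0≤δ
           (≤-respˡ-≈ (*-identityˡ (q ^ m)) (*-mono-≤ 0≤1 (0≤x^n m 0≤q) (1≤1+x/n m 0≤x+δ) ≤-refl)) ≤-refl) ⟩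
    p ^ suc m + q ^ suc m * δ ∎
    where
    p = 1# + x / fromℕ (suc m)
    q = 1# + (x + δ) / fromℕ (suc m)
    0≤x+δ : 0# ≤ x + δ
    0≤x+δ = 0≤x+y 0≤x 0≤δ
    0≤q : 0# ≤ q
    0≤q = 0≤1+x/n m 0≤x+δ

  -- As `δ` is at most one half, the last term of `compound-growth` can be absorbed into the left
  -- side.
  compound-doubling : ∀ m {x δ} → 0# ≤ x → 0# ≤ δ → δ + δ ≤ 1# → compound m (x + δ) ≤ fromℕ 2 * compound m x
  compound-doubling m {x} {δ} 0≤x 0≤δ 2δ≤1 =
    ≤-by (0≤x+y (0≤x+y z z) (0≤x*y (0≤x^n (suc m) (0≤1+x/n m (0≤x+y 0≤x 0≤δ))) (x≤y⇒0≤y-x 2δ≤1)))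
      (solve 3 (λ a b δ → con (pos 2) :* a :- b := (a :+ b :* δ :- b) :+ (a :+ b :* δ :- b) :+ b :* (:1 :- (δ :+ δ)))
        refl (compound m x) (compound m (x + δ)) δ)
    where z = x≤y⇒0≤y-x (compound-growth m 0≤x 0≤δ)

  -- The tangent to the power `m + 2` at `q`, evaluated at `p`, equals `q^(m+1)` times
  -- `q + (m + 2) (p - q)`, and this last factor is exactly 1.
  compound-suc : ∀ m {x} → 0# ≤ x → compound m x ≤ compound (suc m) x
  compound-suc m {x} 0≤x = begin
    q ^ suc m
      ≈⟨ *-identityˡ _ ⟨
    1# * q ^ suc m
      ≈⟨ *-congʳ one ⟨
    (q + fromℕ (suc (suc m)) * (p - q)) * q ^ suc m
      ≈⟨ solve 4 (λ p q r k → (q :+ k :* (p :- q)) :* r := q :* r :+ k :* r :* (p :- q)) refl p q (q ^ suc m) (fromℕ (suc (suc m))) ⟩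
    q ^ suc (suc m) + fromℕ (suc (suc m)) * q ^ suc m * (p - q)
      ≤⟨ ^-tangent (suc m) (0≤1+x/n (suc m) 0≤x) (0≤1+x/n m 0≤x) ⟩
    p ^ suc (suc m) ∎
    where
    p = 1# + x / fromℕ (suc (suc m))
    q = 1# + x / fromℕ (suc m)
    one : q + fromℕ (suc (suc m)) * (p - q) ≈ 1#
    one = begin-equality
      q + fromℕ (suc (suc m)) * (p - q)
        ≈⟨ solve 3 (λ k a b → :1 :+ b :+ (:1 :+ k) :* (:1 :+ a :- (:1 :+ b)) := :1 :+ (:1 :+ k) :* a :- k :* b)
             refl (fromℕ (suc m)) (x / fromℕ (suc (suc m))) (x / fromℕ (suc m)) ⟩
      1# + fromℕ (suc (suc m)) * (x / fromℕ (suc (suc m))) - fromℕ (suc m) * (x / fromℕ (suc m))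
        ≈⟨ +-cong (+-congˡ (n*[x/n]≈x (suc m) x)) (-‿cong (n*[x/n]≈x m x)) ⟩
      1# + x - x
        ≈⟨ solve 1 (λ x → :1 :+ x :- x := :1) refl x ⟩
      1# ∎

  compound-mono-m : ∀ {m n x} → 0# ≤ x → m ℕ.≤ n → compound m x ≤ compound n x
  compound-mono-m {x = x} 0≤x m≤n = go (ℕₚ.≤⇒≤′ m≤n)
    where
    go : ∀ {m n} → m ℕ.≤′ n → compound m x ≤ compound n x
    go ℕ.≤′-refl        = ≤-refl
    go (ℕ.≤′-step {n} m≤′n) = ≤-trans (go m≤′n) (compound-suc n 0≤x)


  compound-0ˡ : ∀ x → compound 0 x ≈ 1# + x
  compound-0ˡ x = begin-equality
    compound 0 x                  ≈⟨ solve 1 (λ y → (:1 :+ y) :^ 1 := :1 :+ (:1 :+ :0) :* y) refl (x / fromℕ 1) ⟩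
    1# + fromℕ 1 * (x / fromℕ 1)  ≈⟨ +-congˡ (n*[x/n]≈x 0 x) ⟩
    1# + x                        ∎

  exp-unique : ∀ {x l} → (λ m → (1# + x / fromℕ m) ^ m) ⟶ l → exp x ≈ l
  exp-unique lim = the-unique (λ lim′ → ⟶-unique lim′ lim) lim

  -- The sequence increases with `m`, so at the crossing point its supremum `v` is also its limit.
  -- Doubling gives the slope bound `2 v`, the term `compound 0 x ≈ 1 + x` bounds the admissible
  -- `x`, and `1 ≤ v` is the starting value at `0#`.
  exp-surjective : ∀ {v} → 1# ≤ v → ∃ λ x → exp x ≈ v
  exp-surjective {v} 1≤v = s , exp-unique converges
    where
    0≤v : 0# ≤ v
    0≤v = ≤-trans 0≤1 1≤v

    growth : ∀ m {x δ} → 0# ≤ x → 0# < δ → δ + δ ≤ 1# → compound m x ≤ v →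
             compound m (x + δ) ≤ compound m x + fromℕ 2 * v * δ
    growth m {x} {δ} 0≤x 0<δ 2δ≤1 below = begin
      compound m (x + δ)
        ≤⟨ compound-growth m 0≤x 0≤δ ⟩
      compound m x + compound m (x + δ) * δ
        ≤⟨ +-monoʳ-≤ _ (*-mono-≤ (0≤x^n (suc m) (0≤1+x/n m (0≤x+y 0≤x 0≤δ))) 0≤δ
             (≤-trans (compound-doubling m 0≤x 0≤δ 2δ≤1) (*-monoˡ-≤ (0≤fromℕ 2) below)) ≤-refl) ⟩
      compound m x + fromℕ 2 * v * δ ∎
      where
      0≤δ : 0# ≤ δ
      0≤δ = <⇒≤ 0<δ

    open Crossing compound v (fromℕ 2 * v) v
      (*-pos 0<2 (<-≤-trans 0<1 1≤v)) compound-mono growth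
      (λ m → ≤-respˡ-≈ (sym (compound-0 m)) 1≤v)
      (λ x below → begin
        x             ≈⟨ +-identityˡ x ⟨
        0# + x        ≤⟨ +-monoˡ-≤ x 0≤1 ⟩
        1# + x        ≈⟨ compound-0ˡ x ⟨
        compound 0 x  ≤⟨ below 0 ⟩
        v             ∎)

    converges : (λ m → (1# + s / fromℕ m) ^ m) ⟶ v
    converges ε 0<ε = suc m , close
      where
      m = proj₁ (v<f+ε ε 0<ε)
      v<f = proj₂ (v<f+ε ε 0<ε)
      close : ∀ n → suc m ℕ.≤ n → ∣ (1# + s / fromℕ n) ^ n - v ∣ < ε
      close (suc n) (ℕ.s≤s m≤n) = ∣x∣<
        (≤-<-trans (≤-by (x≤y⇒0≤y-x (f≤v n)) (solve 2 (λ v c → :0 :- (c :- v) := v :- c) refl v (compound n s))) 0<ε)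
        (<-by (x<y⇒0<y-x (<-≤-trans v<f (+-monoˡ-≤ ε (compound-mono-m 0≤s m≤n))))
          (solve 3 (λ e c v → e :- :- (c :- v) := c :+ e :- v) refl ε (compound n s) v))

  exp-log : ∀ {y} → 1# ≤ y → exp (log y) ≈ y
  exp-log 1≤y = the-satisfies (exp-surjective 1≤y)

  -- Two steps of length one half from `compound m 0# ≈ 1#`, each of which at most doubles the
  -- value.
  compound-1≤4 : ∀ m → compound m 1# ≤ fromℕ 4
  compound-1≤4 m = begin
    compound m 1#                          ≈⟨ ^-congˡ (suc m) (+-congˡ (*-congʳ (sym (half+half 1#)))) ⟩
    compound m (h + h)                     ≤⟨ compound-doubling m 0≤h 0≤h 2h≤1 ⟩
    fromℕ 2 * compound m h                 ≈⟨ *-congˡ (^-congˡ (suc m) (+-congˡ (*-congʳ (+-identityˡ h)))) ⟨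
    fromℕ 2 * compound m (0# + h)          ≤⟨ *-monoˡ-≤ (0≤fromℕ 2) (compound-doubling m ≤-refl 0≤h 2h≤1) ⟩
    fromℕ 2 * (fromℕ 2 * compound m 0#)    ≈⟨ *-congˡ (*-congˡ (compound-0 m)) ⟩
    fromℕ 2 * (fromℕ 2 * 1#)               ≈⟨ solve 0 (con (pos 2) :* (con (pos 2) :* :1) := con (pos 4)) refl ⟩
    fromℕ 4                                ∎
    where
    h = half 1#
    0≤h = <⇒≤ (0<half 0<1)
    2h≤1 = ≤-reflexive (half+half 1#)

  -- Here `x` may be negative and the sequence is not known to converge; if it does not, the default
  -- value also obeys the bound. Once `n` exceeds `- x` the base is nonnegative and comparable with
  -- the base at 1.
  exp≤4 : ∀ {x} → x ≤ 1# → exp x ≤ fromℕ 4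
  exp≤4 {x} x≤1 = the-elim {P = (λ m → (1# + x / fromℕ m) ^ m) ⟶_} {Q = _≤ fromℕ 4}
    (λ _ → ⟶-≤ (suc N , bounded)) (0≤fromℕ 4)
    where
    N = proj₁ (archimedean (- x))
    bounded : ∀ n → suc N ℕ.≤ n → (1# + x / fromℕ n) ^ n ≤ fromℕ 4
    bounded (suc n) (ℕ.s≤s N≤n) = ≤-trans (^-monoˡ-≤ (suc n) 0≤base (base-mono n x≤1)) (compound-1≤4 n)
      where
      0≤base : 0# ≤ 1# + x / fromℕ (suc n)
      0≤base = *-cancelˡ-≤ (0<fromℕ {suc n} (ℕ.s≤s ℕ.z≤n)) (begin
        fromℕ (suc n) * 0#                        ≈⟨ zeroʳ _ ⟩
        0#                                        ≤⟨ x≤y⇒0≤y-x (<⇒≤ (proj₂ (archimedean (- x)))) ⟩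
        fromℕ N - - x                             ≈⟨ +-congˡ (⁻¹-involutive x) ⟩
        fromℕ N + x                               ≤⟨ +-monoˡ-≤ x (fromℕ-mono-≤ (ℕₚ.m≤n⇒m≤1+n N≤n)) ⟩
        fromℕ (suc n) + x                         ≈⟨ +-cong (sym (*-identityʳ _)) (sym (n*[x/n]≈x n x)) ⟩
        fromℕ (suc n) * 1# + fromℕ (suc n) * (x / fromℕ (suc n))  ≈⟨ distribˡ _ _ _ ⟨
        fromℕ (suc n) * (1# + x / fromℕ (suc n))  ∎)

  -- A logarithm below 1 would force `y ≈ exp (log y) ≤ 4`. This applies to whichever solution of
  -- `exp x ≈ y` the description selects.
  1≤log : ∀ {y} → fromℕ 4 < y → 1# ≤ log y
  1≤log {y} 4<y = ≮⇒≥ λ log<1 → ≤⇒≯ (exp≤4 (<⇒≤ log<1)) (<-≤-trans 4<y (≤-reflexive (sym (exp-log 1≤y))))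
    where
    1≤y : 1# ≤ y
    1≤y = ≤-trans (1≤fromℕ {4} (ℕ.s≤s ℕ.z≤n)) (<⇒≤ 4<y)

  ^-cancel-≤ : ∀ k {x y} → 0# < x → x ^ suc k ≤ y ^ suc k → 0# ≤ y → x ≤ y
  ^-cancel-≤ k {x} {y} 0<x x^n≤y^n 0≤y = ≮⇒≥ λ y<x → ≤⇒≯ x^n≤y^n (begin-strict
    y * y ^ k  ≤⟨ *-monoˡ-≤ 0≤y (^-monoˡ-≤ k 0≤y (<⇒≤ y<x)) ⟩
    y * x ^ k  ≈⟨ *-comm y _ ⟩
    x ^ k * y  <⟨ *-monoˡ-< (0<x^n k 0<x) y<x ⟩
    x ^ k * x  ≈⟨ *-comm _ x ⟩
    x * x ^ k  ∎)

  -- With `c` the cube root of `n`, the logarithmic factor `w` is at most 1, so `g² ≤ c² ≤ c³ ≈ n`.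
  growthBound-bounds : ∀ {n} → 8 ℕ.≤ n → 0# ≤ growthBound n × growthBound n * growthBound n ≤ fromℕ n
  growthBound-bounds {n} 8≤n = 0≤g , (begin
    g * g          ≤⟨ *-mono-≤ 0≤g 0≤g g≤c g≤c ⟩
    c * c          ≈⟨ *-identityʳ _ ⟨
    c * c * 1#     ≤⟨ *-monoˡ-≤ (0≤x*y 0≤c 0≤c) (≤-trans (1≤fromℕ {2} (ℕ.s≤s ℕ.z≤n)) 2≤c) ⟩
    c * c * c      ≈⟨ solve 1 (λ c → c :* c :* c := c :^ 3) refl c ⟩
    c ^ 3          ≈⟨ c³≈n ⟩
    fromℕ n        ∎)
    where
    g = growthBound n
    c = root 3 (fromℕ n)
    0≤c : 0# ≤ c
    0≤c = proj₁ (root-spec 2 (0≤fromℕ n))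
    c³≈n : c ^ 3 ≈ fromℕ n
    c³≈n = proj₂ (root-spec 2 (0≤fromℕ n))
    -- The bound 8 is chosen for this: then `c⁴ ≥ 16` passes the threshold 4 of `1≤log`.
    2≤c : fromℕ 2 ≤ c
    2≤c = ^-cancel-≤ 2 0<2 (begin
      fromℕ 2 ^ 3  ≈⟨ solve 0 (con (pos 2) :^ 3 := con (pos 8)) refl ⟩
      fromℕ 8      ≤⟨ fromℕ-mono-≤ 8≤n ⟩
      fromℕ n      ≈⟨ c³≈n ⟨
      c ^ 3        ∎) 0≤c
    4<c⁴ : fromℕ 4 < c ^ 4
    4<c⁴ = begin-strict
      fromℕ 4      <⟨ <-by (0<fromℕ {12} (ℕ.s≤s ℕ.z≤n)) (solve 0 (con (pos 2) :^ 4 :- con (pos 4) := con (pos 12)) refl) ⟩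
      fromℕ 2 ^ 4  ≤⟨ ^-monoˡ-≤ 4 (0≤fromℕ 2) 2≤c ⟩
      c ^ 4        ∎
    t = root 3 (log (c ^ 4))
    0≤log : 0# ≤ log (c ^ 4)
    0≤log = ≤-trans 0≤1 (1≤log 4<c⁴)
    1≤t : 1# ≤ t
    1≤t = ^-cancel-≤ 2 0<1 (begin
      1# ^ 3         ≈⟨ solve 0 (:1 :^ 3 := :1) refl ⟩
      1#             ≤⟨ 1≤log 4<c⁴ ⟩
      log (c ^ 4)    ≈⟨ proj₂ (root-spec 2 0≤log) ⟨
      t ^ 3          ∎) (proj₁ (root-spec 2 0≤log))
    0<t⁷ : 0# < t ^ 7
    0<t⁷ = <-≤-trans 0<1 (1≤x^n 7 1≤t)
    w = (t ^ 7) ⁻¹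
    0≤w : 0# ≤ w
    0≤w = <⇒≤ (0<x⁻¹ 0<t⁷)
    w≤1 : w ≤ 1#
    w≤1 = begin
      w              ≈⟨ *-identityˡ w ⟨
      1# * w         ≤⟨ *-mono-≤ 0≤1 0≤w (1≤x^n 7 1≤t) ≤-refl ⟩
      t ^ 7 * w      ≈⟨ ⁻¹-inverse 0<t⁷ ⟩
      1#             ∎
    0≤g : 0# ≤ g
    0≤g = 0≤x*y (0≤x^n 1 0≤c) 0≤w
    g≤c : g ≤ c
    g≤c = begin
      c ^ 1 * w     ≤⟨ *-monoˡ-≤ (0≤x^n 1 0≤c) w≤1 ⟩
      c ^ 1 * 1#    ≈⟨ solve 1 (λ c → c :^ 1 :* :1 := c) refl c ⟩
      c             ∎

  o-growthBound⇒square-small : ∀ {d : ℕ → ℕ} → (λ n → fromℕ (d n)) =o growthBound →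
    ∀ ε → 0# < ε → ∃ λ N → ∀ n → N ℕ.≤ n → fromℕ (d n) * fromℕ (d n) ≤ ε * fromℕ n
  o-growthBound⇒square-small {d} d=o ε 0<ε = N ℕ.+ 8 , λ n N+8≤n →
    let 0≤g , g²≤n = growthBound-bounds (ℕₚ.≤-trans (ℕₚ.m≤n+m 8 N) N+8≤n)
        D = fromℕ (d n)
        g = growthBound n
        0≤D = 0≤fromℕ (d n)
        D≤δg = begin
          D          ≈⟨ 0≤x⇒∣x∣≈x 0≤D ⟨
          ∣ D ∣      ≤⟨ small n (ℕₚ.≤-trans (ℕₚ.m≤m+n N 8) N+8≤n) ⟩
          δ * ∣ g ∣  ≈⟨ *-congˡ (0≤x⇒∣x∣≈x 0≤g) ⟩
          δ * g      ∎
    in begin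
      D * D              ≤⟨ *-mono-≤ 0≤D 0≤D D≤δg D≤δg ⟩
      δ * g * (δ * g)    ≈⟨ solve 2 (λ δ g → δ :* g :* (δ :* g) := δ :* δ :* (g :* g)) refl δ g ⟩
      δ * δ * (g * g)    ≤⟨ *-monoˡ-≤ (0≤x² δ) g²≤n ⟩
      δ * δ * fromℕ n    ≤⟨ *-mono-≤ (0≤x² δ) (0≤fromℕ n) δ²≤ε ≤-refl ⟩
      ε * fromℕ n        ∎
    where
    -- This yields `δ ≤ ε` and `δ ≤ 1` together, so that `δ² ≤ ε`.
    factor = small-factor 0<ε 0<1
    δ = proj₁ factor
    0<δ = proj₁ (proj₂ factor)
    N = proj₁ (d=o δ 0<δ)
    small = proj₂ (d=o δ 0<δ)
    δ≤1 : δ ≤ 1#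
    δ≤1 = ≤-trans (≤-respˡ-≈ (+-identityʳ δ) (+-monoʳ-≤ δ (<⇒≤ 0<δ))) (proj₁ (proj₂ (proj₂ factor)))
    δ²≤ε : δ * δ ≤ ε
    δ²≤ε = ≤-trans (*-mono-≤ (<⇒≤ 0<δ) (<⇒≤ 0<δ) δ≤1 ≤-refl) (proj₂ (proj₂ (proj₂ factor)))

  -- Finite additivity and the expectation of simple functions

  ⟶-eventually : ∀ {u l} → (∃ λ N → ∀ n → N ℕ.≤ n → u n ≈ l) → u ⟶ l
  ⟶-eventually {u} {l} (N , u≈l) ε 0<ε = N , λ n N≤n →
    ≤-<-trans (≤-reflexive (trans (∣∣-cong (trans (+-congʳ (u≈l n N≤n)) (-‿inverseʳ l))) (0≤x⇒∣x∣≈x ≤-refl))) 0<ε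

  module Measure (𝒫 : ProbabilitySpace) where
    open ProbabilitySpace 𝒫

    Event-∅ : Event (λ _ → ⊥)
    Event-∅ = Event-resp ((λ ¬⊤ → ¬⊤ tt) , λ ()) (Event-∁ Event-U)

    private
      pair : ∀ {a} {X : Set a} → X → X → ℕ → X
      pair x y zero    = x
      pair x y (suc _) = y

    Event-∪ : ∀ {A B} → Event A → Event B → Event (A ∪ B)
    Event-∪ {A} {B} A-event B-event = Event-resp
      ((λ { (zero , a) → inj₁ a ; (suc _ , b) → inj₂ b }) , λ { (inj₁ a) → 0 , a ; (inj₂ b) → 1 , b })
      (Event-⋃ {pair A B} λ { zero → A-event ; (suc _) → B-event })

    Event-∩ : ∀ {A B} → Event A → Event B → Event (A ∩ B)
    Event-∩ {A} {B} A-event B-event = Event-resp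
      ( (λ ¬[¬A∪¬B] → dne (λ ¬A → ¬[¬A∪¬B] (inj₁ ¬A)) , dne (λ ¬B → ¬[¬A∪¬B] (inj₂ ¬B)))
      , λ { (a , b) (inj₁ ¬a) → ¬a a ; (a , b) (inj₂ ¬b) → ¬b b })
      (Event-∁ (Event-∪ (Event-∁ A-event) (Event-∁ B-event)))

    -- Countable additivity for the constant sequence of empty events makes the multiples of `p`
    -- converge to `p`; the multiple with `N + 2` terms exceeds `p` by at least `p`, hence `p ≤ ε`.
    ℙ-∅ : ℙ (λ _ → ⊥) ≈ 0#
    ℙ-∅ = ≤-antisym (≤-from-ε below) (ℙ-nonneg Event-∅)
      where
      p = ℙ (λ _ → ⊥)
      sums⟶p : (λ N → sum {N} (λ _ → p)) ⟶ ℙ (⋃ ℕ (λ _ _ → ⊥))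
      sums⟶p = ℙ-⋃ (λ _ → Event-∅) (λ _ _ _ _ → proj₁)
      p≈ : ℙ (⋃ ℕ (λ _ _ → ⊥)) ≈ p
      p≈ = ℙ-cong (Event-⋃ λ _ → Event-∅) (proj₂ , λ ())
      0≤sum : ∀ N → 0# ≤ sum {N} (λ _ → p)
      0≤sum zero    = ≤-refl
      0≤sum (suc N) = 0≤x+y (ℙ-nonneg Event-∅) (0≤sum N)
      below : ∀ ε → 0# < ε → p ≤ 0# + ε
      below ε 0<ε = begin
        p                                  ≈⟨ +-identityʳ p ⟨
        p + 0#                             ≤⟨ +-monoʳ-≤ p (0≤sum N) ⟩
        p + sum {N} (λ _ → p)              ≈⟨ solve 2 (λ p s → p :+ s := p :+ (p :+ s) :- p) refl p (sum {N} (λ _ → p)) ⟩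
        p + (p + sum {N} (λ _ → p)) - p    ≈⟨ +-congˡ (-‿cong p≈) ⟨
        sum {suc (suc N)} (λ _ → p) - ℙ (⋃ ℕ (λ _ _ → ⊥))  ≤⟨ x≤∣x∣ _ ⟩
        ∣ sum {suc (suc N)} (λ _ → p) - ℙ (⋃ ℕ (λ _ _ → ⊥)) ∣  <⟨ proj₂ (sums⟶p ε 0<ε) (suc (suc N)) (ℕₚ.m≤n+m N 2) ⟩
        ε                                  ≈⟨ +-identityˡ ε ⟨
        0# + ε                             ∎
        where N = proj₁ (sums⟶p ε 0<ε)

    ℙ-∪ : ∀ {A B} → Event A → Event B → (∀ ω → A ω → ¬ B ω) → ℙ (A ∪ B) ≈ ℙ A + ℙ B
    ℙ-∪ {A} {B} A-event B-event disjoint = trans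
      (ℙ-cong (Event-∪ A-event B-event)
        ( (λ { (inj₁ a) → 0 , a ; (inj₂ b) → 1 , b })
        , λ { (0 , a) → inj₁ a ; (1 , b) → inj₂ b ; (suc (suc _) , ()) }))
      (⟶-unique (ℙ-⋃ C-event C-disjoint) (⟶-eventually (2 , sums)))
      where
      C : ℕ → Pred Ω 0ℓ
      C 0             = A
      C 1             = B
      C (suc (suc _)) = λ _ → ⊥
      C-event : ∀ k → Event (C k)
      C-event 0             = A-event
      C-event 1             = B-event
      C-event (suc (suc _)) = Event-∅
      C-disjoint : ∀ i j → i ≢ j → ∀ ω → ¬ (C i ∩ C j) ω
      C-disjoint 0 0 i≢j _ _ = i≢j ≡.refl
      C-disjoint 0 1 _ ω (a , b) = disjoint ω a b
      C-disjoint 1 0 _ ω (b , a) = disjoint ω a b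
      C-disjoint 1 1 i≢j _ _ = i≢j ≡.refl
      sums : ∀ n → 2 ℕ.≤ n → sum {n} (λ k → ℙ (C (toℕ k))) ≈ ℙ A + ℙ B
      sums (suc zero) (ℕ.s≤s ())
      sums (suc (suc n)) _ = +-congˡ (trans
        (+-congˡ (trans (sum-cong-≋ {n} (λ _ → ℙ-∅)) (sum-replicate-zero n)))
        (+-identityʳ (ℙ B)))

    ℙ-split : ∀ {A E} → Event A → Event E → ℙ A ≈ ℙ (A ∩ E) + ℙ (A ∩ ∁ E)
    ℙ-split {A} {E} A-event E-event = trans
      (ℙ-cong A-event (split , λ { (inj₁ (a , _)) → a ; (inj₂ (a , _)) → a }))
      (ℙ-∪ (Event-∩ A-event E-event) (Event-∩ A-event (Event-∁ E-event)) (λ _ (_ , e) (_ , ¬e) → ¬e e))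
      where
      split : ∀ {ω} → A ω → ((A ∩ E) ∪ (A ∩ ∁ E)) ω
      split {ω} a with lem {P = E ω}
      ... | yes e = inj₁ (a , e)
      ... | no ¬e = inj₂ (a , ¬e)

    ℙ-mono : ∀ {A B} → Event A → Event B → (∀ ω → A ω → B ω) → ℙ A ≤ ℙ B
    ℙ-mono {A} {B} A-event B-event A⊆B = begin
      ℙ A                          ≈⟨ +-identityʳ (ℙ A) ⟨
      ℙ A + 0#                     ≤⟨ +-monoʳ-≤ (ℙ A) (ℙ-nonneg (Event-∩ B-event (Event-∁ A-event))) ⟩
      ℙ A + ℙ (B ∩ ∁ A)            ≈⟨ +-congʳ (ℙ-cong A-event ((λ a → A⊆B _ a , a) , proj₂)) ⟩
      ℙ (B ∩ A) + ℙ (B ∩ ∁ A)      ≈⟨ ℙ-split B-event A-event ⟨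
      ℙ B                          ∎

    ℙ-∁ : ∀ {A} → Event A → ℙ (∁ A) ≈ 1# - ℙ A
    ℙ-∁ {A} A-event = begin-equality
      ℙ (∁ A)                          ≈⟨ solve 2 (λ a b → b := a :+ b :- a) refl (ℙ A) (ℙ (∁ A)) ⟩
      ℙ A + ℙ (∁ A) - ℙ A              ≈⟨ +-congʳ (+-cong (ℙ-cong A-event ((λ a → tt , a) , proj₂))
                                                          (ℙ-cong (Event-∁ A-event) ((λ a → tt , a) , proj₂))) ⟩
      ℙ (U ∩ A) + ℙ (U ∩ ∁ A) - ℙ A    ≈⟨ +-congʳ (ℙ-split Event-U A-event) ⟨
      ℙ U - ℙ A                        ≈⟨ +-congʳ ℙ-U ⟩
      1# - ℙ A                         ∎

    𝟙-yes : ∀ {A : Pred Ω 0ℓ} {ω} → A ω → 𝟙 A ω ≈ 1#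
    𝟙-yes {A} {ω} a with lem {P = A ω}
    ... | yes _ = refl
    ... | no ¬a = contradiction a ¬a

    𝟙-no : ∀ {A : Pred Ω 0ℓ} {ω} → ¬ A ω → 𝟙 A ω ≈ 0#
    𝟙-no {A} {ω} ¬a with lem {P = A ω}
    ... | yes a = contradiction a ¬a
    ... | no _  = refl

    𝟙-∩ : ∀ (A B : Pred Ω 0ℓ) ω → 𝟙 A ω * 𝟙 B ω ≈ 𝟙 (A ∩ B) ω
    𝟙-∩ A B ω with lem {P = A ω} | lem {P = B ω}
    ... | yes a | yes b = trans (*-identityˡ 1#) (sym (𝟙-yes {A ∩ B} (a , b)))
    ... | yes _ | no ¬b = trans (zeroʳ 1#) (sym (𝟙-no {A ∩ B} (λ (_ , b) → ¬b b)))
    ... | no ¬a | _     = trans (zeroˡ _) (sym (𝟙-no {A ∩ B} (λ (a , _) → ¬a a)))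

    IsExpectation-cong : ∀ {X Y e f} → (∀ ω → X ω ≈ Y ω) → e ≈ f → IsExpectation X e → IsExpectation Y f
    IsExpectation-cong X≈Y e≈f (m , a , A , events , X≈ , e≈) =
      m , a , A , events , (λ ω → trans (sym (X≈Y ω)) (X≈ ω)) , trans (sym e≈f) e≈

    IsExpectation-0 : IsExpectation (λ _ → 0#) 0#
    IsExpectation-0 = 0 , (λ ()) , (λ ()) , (λ ()) , (λ _ → refl) , refl

    IsExpectation-∷ : ∀ {X e A} a → Event A → IsExpectation X e →
                      IsExpectation (λ ω → a * 𝟙 A ω + X ω) (a * ℙ A + e)
    IsExpectation-∷ {A = A₀} a₀ A₀-event (m , a , A , events , X≈ , e≈) =
      suc m , (a₀ Vector.∷ a) , (A₀ Vector.∷ A) , (λ { zero → A₀-event ; (suc k) → events k }) ,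
      (λ ω → +-congˡ (X≈ ω)) , +-congˡ e≈

    IsExpectation-+ : ∀ {X Y e f} → IsExpectation X e → IsExpectation Y f →
                      IsExpectation (λ ω → X ω + Y ω) (e + f)
    IsExpectation-+ {Y = Y} {f = f} (m , a , A , events , X≈ , e≈) Y-f = IsExpectation-cong
      (λ ω → +-congʳ (sym (X≈ ω))) (+-congʳ (sym e≈)) (prepend m a A events)
      where
      prepend : ∀ m (a : Fin m → R) (A : Fin m → Pred Ω 0ℓ) → (∀ k → Event (A k)) →
                IsExpectation (λ ω → sum (λ k → a k * 𝟙 (A k) ω) + Y ω) (sum (λ k → a k * ℙ (A k)) + f)
      prepend zero a A events = IsExpectation-cong (λ _ → sym (+-identityˡ _)) (sym (+-identityˡ _)) Y-f
      prepend (suc m) a A events = IsExpectation-cong (λ _ → sym (+-assoc _ _ _)) (sym (+-assoc _ _ _))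
        (IsExpectation-∷ (a zero) (events zero)
          (prepend m (λ k → a (suc k)) (λ k → A (suc k)) (λ k → events (suc k))))

    IsExpectation-scale : ∀ {X e} c → IsExpectation X e → IsExpectation (λ ω → c * X ω) (c * e)
    IsExpectation-scale c (m , a , A , events , X≈ , e≈) =
      m , (λ k → c * a k) , A , events ,
      (λ ω → trans (*-congˡ (X≈ ω)) (scale (λ k → 𝟙 (A k) ω))) , trans (*-congˡ e≈) (scale (λ k → ℙ (A k)))
      where
      scale : ∀ x → c * sum (λ k → a k * x k) ≈ sum (λ k → c * a k * x k)
      scale x = trans (*-distribˡ-sum c (λ k → a k * x k)) (sum-cong-≋ λ k → sym (*-assoc c (a k) (x k)))

    IsExpectation-𝟙 : ∀ {A} → Event A → IsExpectation (𝟙 A) (ℙ A)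
    IsExpectation-𝟙 A-event = IsExpectation-cong
      (λ _ → trans (+-identityʳ _) (*-identityˡ _)) (trans (+-identityʳ _) (*-identityˡ _))
      (IsExpectation-∷ 1# A-event IsExpectation-0)

    IsExpectation-const : ∀ c → IsExpectation (λ _ → c) c
    IsExpectation-const c = IsExpectation-cong
      (λ ω → trans (*-congˡ (𝟙-yes {U} {ω} tt)) (*-identityʳ c)) (trans (*-congˡ ℙ-U) (*-identityʳ c))
      (IsExpectation-scale c (IsExpectation-𝟙 Event-U))

    IsExpectation-sum : ∀ {n} {X : Fin n → Ω → R} {e} → (∀ k → IsExpectation (X k) (e k)) →
                        IsExpectation (λ ω → sum (λ k → X k ω)) (sum e)
    IsExpectation-sum {zero}  _   = IsExpectation-0
    IsExpectation-sum {suc n} X-e = IsExpectation-+ (X-e zero) (IsExpectation-sum (λ k → X-e (suc k)))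

    -- Splitting E along the first event turns a zero combination of m + 1 indicators
    -- on E into two zero combinations of m indicators.
    vanishing-on : ∀ {m} (a : Fin m → R) {A : Fin m → Pred Ω 0ℓ} (events : ∀ k → Event (A k))
                   c {E} → Event E →
                   (∀ ω → E ω → sum (λ k → a k * 𝟙 (A k) ω) + c ≈ 0#) →
                   sum (λ k → a k * ℙ (A k ∩ E)) + c * ℙ E ≈ 0#
    vanishing-on {zero} a events c {E} E-event zero-on-E with lem {P = ∃ E}
    ... | yes (ω , e) = trans (+-congˡ (*-congʳ (trans (sym (+-identityˡ c)) (zero-on-E ω e))))
                              (trans (+-identityˡ _) (zeroˡ _))
    ... | no empty = trans (+-congˡ (*-congˡ (trans (ℙ-cong E-event ((λ e → empty (_ , e)) , λ ())) ℙ-∅)))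
                           (trans (+-identityˡ _) (zeroʳ c))
    vanishing-on {suc m} a {A} events c {E} E-event zero-on-E = begin-equality
      a₀ * ℙ (A₀ ∩ E) + sum (λ k → a′ k * ℙ (A′ k ∩ E)) + c * ℙ E
        ≈⟨ +-cong (+-cong (*-congˡ (ℙ-cong (Event-∩ (events zero) E-event) ((λ (x , y) → y , x) , λ (x , y) → y , x)))
                          (trans (sum-cong-≋ λ k → trans (*-congˡ (split k)) (distribˡ _ _ _))
                                 (∑-distrib-+ (λ k → a′ k * ℙ (A′ k ∩ E₁)) (λ k → a′ k * ℙ (A′ k ∩ E₂)))))
                  (*-congˡ (ℙ-split E-event (events zero))) ⟩
      a₀ * ℙ E₁ + (sum (λ k → a′ k * ℙ (A′ k ∩ E₁)) + sum (λ k → a′ k * ℙ (A′ k ∩ E₂))) + c * (ℙ E₁ + ℙ E₂)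
        ≈⟨ solve 6 (λ a p s t c q → a :* p :+ (s :+ t) :+ c :* (p :+ q)
                                  := (s :+ (c :+ a) :* p) :+ (t :+ c :* q))
             refl a₀ (ℙ E₁) (sum (λ k → a′ k * ℙ (A′ k ∩ E₁))) (sum (λ k → a′ k * ℙ (A′ k ∩ E₂))) c (ℙ E₂) ⟩
      (sum (λ k → a′ k * ℙ (A′ k ∩ E₁)) + (c + a₀) * ℙ E₁) + (sum (λ k → a′ k * ℙ (A′ k ∩ E₂)) + c * ℙ E₂)
        ≈⟨ +-cong (vanishing-on a′ (λ k → events (suc k)) (c + a₀) E₁-event zero-on-E₁)
                  (vanishing-on a′ (λ k → events (suc k)) c E₂-event zero-on-E₂) ⟩
      0# + 0#
        ≈⟨ +-identityˡ 0# ⟩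
      0# ∎
      where
      a₀ = a zero
      a′ = λ k → a (suc k)
      A₀ = A zero
      A′ = λ k → A (suc k)
      E₁ = E ∩ A₀
      E₂ = E ∩ ∁ A₀
      E₁-event = Event-∩ E-event (events zero)
      E₂-event = Event-∩ E-event (Event-∁ (events zero))
      split : ∀ k → ℙ (A′ k ∩ E) ≈ ℙ (A′ k ∩ E₁) + ℙ (A′ k ∩ E₂)
      split k = trans (ℙ-split (Event-∩ (events (suc k)) E-event) (events zero))
        (+-cong (ℙ-cong (Event-∩ (Event-∩ (events (suc k)) E-event) (events zero))
                  ((λ ((x , y) , z) → x , y , z) , λ (x , y , z) → (x , y) , z))
                (ℙ-cong (Event-∩ (Event-∩ (events (suc k)) E-event) (Event-∁ (events zero)))
                  ((λ ((x , y) , z) → x , y , z) , λ (x , y , z) → (x , y) , z)))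
      zero-on-E₁ : ∀ ω → E₁ ω → sum (λ k → a′ k * 𝟙 (A′ k) ω) + (c + a₀) ≈ 0#
      zero-on-E₁ ω (e , a∈) = trans
        (trans (solve 3 (λ s c a → s :+ (c :+ a) := a :* :1 :+ s :+ c) refl (sum (λ k → a′ k * 𝟙 (A′ k) ω)) c a₀)
               (+-congʳ (+-congʳ (*-congˡ (sym (𝟙-yes {A₀} a∈))))))
        (zero-on-E ω e)
      zero-on-E₂ : ∀ ω → E₂ ω → sum (λ k → a′ k * 𝟙 (A′ k) ω) + c ≈ 0#
      zero-on-E₂ ω (e , a∉) = trans
        (trans (solve 3 (λ s c a → s :+ c := a :* :0 :+ s :+ c) refl (sum (λ k → a′ k * 𝟙 (A′ k) ω)) c a₀)
               (+-congʳ (+-congʳ (*-congˡ (sym (𝟙-no {A₀} a∉))))))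
        (zero-on-E ω e)

    -- Makes `𝔼` well defined: the difference of two representations is a combination of indicators
    -- that vanishes everywhere, to which `vanishing-on` applies with `E = U` and `c = 0#`.
    IsExpectation-unique : ∀ {X e f} → IsExpectation X e → IsExpectation X f → e ≈ f
    IsExpectation-unique {X} {e} {f} X-e X-f = begin-equality
      e                    ≈⟨ solve 2 (λ e f → e := f :+ (e :+ :- :1 :* f)) refl e f ⟩
      f + (e + - 1# * f)   ≈⟨ +-congˡ (zero-expectation (IsExpectation-+ X-e (IsExpectation-scale (- 1#) X-f))) ⟩
      f + 0#               ≈⟨ +-identityʳ f ⟩
      f                    ∎
      where
      zero-expectation : ∀ {d} → IsExpectation (λ ω → X ω + - 1# * X ω) d → d ≈ 0#
      zero-expectation {d} (m , a , A , events , X≈ , d≈) = begin-equality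
        d                                             ≈⟨ d≈ ⟩
        sum (λ k → a k * ℙ (A k))                     ≈⟨ sum-cong-≋ (λ k → *-congˡ (ℙ-cong (events k) ((λ x → x , tt) , proj₁))) ⟩
        sum (λ k → a k * ℙ (A k ∩ U))                 ≈⟨ solve 2 (λ s u → s := s :+ :0 :* u) refl _ (ℙ U) ⟩
        sum (λ k → a k * ℙ (A k ∩ U)) + 0# * ℙ U      ≈⟨ vanishing-on a events 0# Event-U (λ ω _ → trans (+-identityʳ _)
                                                          (trans (sym (X≈ ω)) (solve 1 (λ x → x :+ :- :1 :* x := :0) refl (X ω)))) ⟩
        0#                                            ∎

    𝔼≈ : ∀ {X e} → IsExpectation X e → 𝔼 X ≈ e
    𝔼≈ X-e = the-unique (λ X-f → IsExpectation-unique X-f X-e) X-e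

  -- Joint probabilities of inversions

  0^suc≈0 : ∀ k → 0# ^ suc k ≈ 0#
  0^suc≈0 k = zeroˡ (0# ^ k)

  -- What a primitive `F` of an increasing `φ` satisfies on the unit interval, expressed without
  -- derivatives or integrals.
  SlopeBetween : (φ F : R → R) → Set
  SlopeBetween φ F = ∀ {s t} → 0# ≤ s → s ≤ t → t ≤ 1# →
                     φ s * (t - s) ≤ F t - F s × F t - F s ≤ φ t * (t - s)

  -- On a grid of mesh δ, two functions with slopes squeezed by the same φ drift apart by at
  -- most δ (φ 1 - φ 0).
  slope-determines : ∀ {φ F G : R → R} →
                     (∀ {s t} → s ≈ t → φ s ≈ φ t) →
                     (∀ {s t} → s ≈ t → F s ≈ F t) →
                     (∀ {s t} → s ≈ t → G s ≈ G t) →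
                     SlopeBetween φ F → SlopeBetween φ G → F 1# - F 0# ≈ G 1# - G 0#
  slope-determines {φ} {F} {G} φ-cong F-cong G-cong F-slope G-slope = ≈-from-ε close
    where
    module Grid (N : ℕ) where
      δ = fromℕ (suc N) ⁻¹
      0<δ : 0# < δ
      0<δ = 0<x⁻¹ (0<fromℕ {suc N} (ℕ.s≤s ℕ.z≤n))
      t : ℕ → R
      t a = fromℕ a * δ
      tN≈1 : t (suc N) ≈ 1#
      tN≈1 = ⁻¹-inverse (0<fromℕ {suc N} (ℕ.s≤s ℕ.z≤n))
      t≤1 : ∀ {a} → a ℕ.≤ suc N → t a ≤ 1#
      t≤1 {a} a≤N = ≤-respʳ-≈ tN≈1 (*-mono-≤ (0≤fromℕ a) (<⇒≤ 0<δ) (fromℕ-mono-≤ a≤N) ≤-refl)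
      0≤t : ∀ a → 0# ≤ t a
      0≤t a = 0≤x*y (0≤fromℕ a) (<⇒≤ 0<δ)
      step : ∀ a → t (suc a) - t a ≈ δ
      step a = trans (+-congʳ (fromℕ-suc-* a δ)) (solve 2 (λ d x → d :+ x :- x := d) refl δ (t a))
      t-mono : ∀ a → t a ≤ t (suc a)
      t-mono a = ≤-by (<⇒≤ 0<δ) (step a)

      drift : ∀ a → a ℕ.≤ suc N →
              ∣ (F (t a) - F (t 0)) - (G (t a) - G (t 0)) ∣ ≤ (φ (t a) - φ (t 0)) * δ
      drift zero _ = ≤-reflexive (trans
        (trans (∣∣-cong (solve 2 (λ f g → (f :- f) :- (g :- g) := :0) refl (F (t 0)) (G (t 0)))) (0≤x⇒∣x∣≈x ≤-refl))
        (solve 2 (λ p d → :0 := (p :- p) :* d) refl (φ (t 0)) δ))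
      drift (suc a) a<N = begin
        ∣ (F t′ - F t₀) - (G t′ - G t₀) ∣
          ≈⟨ ∣∣-cong (solve 6 (λ f′ f f₀ g′ g g₀ →
               (f′ :- f₀) :- (g′ :- g₀) := ((f :- f₀) :- (g :- g₀)) :+ ((f′ :- f) :- (g′ :- g)))
               refl (F t′) (F tₐ) (F t₀) (G t′) (G tₐ) (G t₀)) ⟩
        ∣ ((F tₐ - F t₀) - (G tₐ - G t₀)) + ((F t′ - F tₐ) - (G t′ - G tₐ)) ∣
          ≤⟨ ∣x+y∣≤∣x∣+∣y∣ _ _ ⟩
        ∣ (F tₐ - F t₀) - (G tₐ - G t₀) ∣ + ∣ (F t′ - F tₐ) - (G t′ - G tₐ) ∣
          ≤⟨ +-mono-≤ (drift a (ℕₚ.≤-trans (ℕₚ.n≤1+n a) a<N))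
               (∣x∣≤ (difference (proj₂ f-slope) (proj₁ g-slope))
                     (≤-respˡ-≈ (solve 2 (λ f g → g :- f := :- (f :- g)) refl (F t′ - F tₐ) (G t′ - G tₐ))
                       (difference (proj₂ g-slope) (proj₁ f-slope)))) ⟩
        (φ tₐ - φ t₀) * δ + (φ t′ * (t′ - tₐ) - φ tₐ * (t′ - tₐ))
          ≈⟨ +-congˡ (+-cong (*-congˡ (step a)) (-‿cong (*-congˡ (step a)))) ⟩
        (φ tₐ - φ t₀) * δ + (φ t′ * δ - φ tₐ * δ)
          ≈⟨ solve 4 (λ p q r d → (p :- q) :* d :+ (r :* d :- p :* d) := (r :- q) :* d) refl (φ tₐ) (φ t₀) (φ t′) δ ⟩
        (φ t′ - φ t₀) * δ ∎
        where
        t′ = t (suc a)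
        tₐ = t a
        t₀ = t 0
        f-slope = F-slope (0≤t a) (t-mono a) (t≤1 a<N)
        g-slope = G-slope (0≤t a) (t-mono a) (t≤1 a<N)
        difference : ∀ {x y u v} → x ≤ u → v ≤ y → x - y ≤ u - v
        difference x≤u v≤y = +-mono-≤ x≤u (-‿anti-≤ v≤y)

    C = φ 1# - φ 0#
    0≤C : 0# ≤ C
    0≤C = x≤y⇒0≤y-x (*-cancelˡ-≤ 0<1 (begin
      1# * φ 0#             ≈⟨ solve 1 (λ p → :1 :* p := p :* (:1 :- :0)) refl (φ 0#) ⟩
      φ 0# * (1# - 0#)      ≤⟨ ≤-trans (proj₁ ends) (proj₂ ends) ⟩
      φ 1# * (1# - 0#)      ≈⟨ solve 1 (λ p → p :* (:1 :- :0) := :1 :* p) refl (φ 1#) ⟩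
      1# * φ 1#             ∎))
      where ends = F-slope ≤-refl 0≤1 ≤-refl

    close : ∀ ε → 0# < ε → ∣ (F 1# - F 0#) - (G 1# - G 0#) ∣ ≤ ε
    close ε 0<ε = begin
      ∣ (F 1# - F 0#) - (G 1# - G 0#) ∣
        ≈⟨ ∣∣-cong (+-cong (+-cong (F-cong tN≈1) (-‿cong (F-cong (zeroˡ _))))
                           (-‿cong (+-cong (G-cong tN≈1) (-‿cong (G-cong (zeroˡ _)))))) ⟨
      ∣ (F (t (suc N)) - F (t 0)) - (G (t (suc N)) - G (t 0)) ∣
        ≤⟨ drift (suc N) ℕₚ.≤-refl ⟩
      (φ (t (suc N)) - φ (t 0)) * δ
        ≈⟨ *-congʳ (+-cong (φ-cong tN≈1) (-‿cong (φ-cong (zeroˡ _)))) ⟩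
      C * δ
        ≤⟨ *-mono-≤ 0≤C (<⇒≤ 0<δ) (≤-by 0≤1 (solve 1 (λ c → :1 :+ c :- c := :1) refl C)) δ≤η ⟩
      (1# + C) * η
        ≤⟨ proj₂ (proj₂ (proj₂ factor)) ⟩
      ε ∎
      where
      -- `1# + C` replaces `C`, which may vanish while `small-factor` asks for a positive factor.
      factor = small-factor 0<ε (0<x+y 0<1 0≤C)
      η = proj₁ factor
      arch = archimedean-inv (proj₁ (proj₂ factor))
      N = proj₁ arch
      open Grid N
      δ≤η : δ ≤ η
      δ≤η = *-cancelˡ-≤ (0<fromℕ {suc N} (ℕ.s≤s ℕ.z≤n)) (≤-trans (≤-reflexive tN≈1) (proj₂ arch))

  -- The two halves are the tangent inequalities at `s` and at `t`.
  power-slope : ∀ k {g} → 0# ≤ g → SlopeBetween (λ t → fromℕ (suc k) * (g * t ^ k)) (λ t → g * t ^ suc k)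
  power-slope k {g} 0≤g {s} {t} 0≤s s≤t _ =
    ≤-by (0≤x*y 0≤g (x≤y⇒0≤y-x (^-tangent k 0≤t 0≤s)))
      (solve 6 (λ g s t k p q → g :* (t :* q) :- g :* (s :* p) :- k :* (g :* p) :* (t :- s)
                             := g :* (t :* q :- (s :* p :+ k :* p :* (t :- s))))
        refl g s t (fromℕ (suc k)) (s ^ k) (t ^ k)) ,
    ≤-by (0≤x*y 0≤g (x≤y⇒0≤y-x (^-tangent k 0≤s 0≤t)))
      (solve 6 (λ g s t k p q → k :* (g :* q) :* (t :- s) :- (g :* (t :* q) :- g :* (s :* p))
                             := g :* (s :* p :- (t :* q :+ k :* q :* (s :- t))))
        refl g s t (fromℕ (suc k)) (s ^ k) (t ^ k))
    where
    0≤t : 0# ≤ t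
    0≤t = ≤-trans 0≤s s≤t

  ceiling : ∀ {z} → 0# ≤ z → ∃ λ p → z ≤ fromℕ p × fromℕ p < z + 1#
  ceiling {z} 0≤z = search (proj₁ (archimedean z)) (<⇒≤ (proj₂ (archimedean z)))
    where
    search : ∀ N → z ≤ fromℕ N → ∃ λ p → z ≤ fromℕ p × fromℕ p < z + 1#
    search zero    z≤0 = 0 , z≤0 , <-respʳ-≈ (+-comm 1# z) (0<x+y 0<1 0≤z)
    search (suc N) z≤N with ≤-<-connex z (fromℕ N)
    ... | inj₁ z≤N′ = search N z≤N′
    ... | inj₂ N<z  = suc N , z≤N , <-respʳ-≈ (+-comm 1# z) (+-monoʳ-< 1# N<z)

  -- Every rational number is a value of this function.
  rational : ℕ → ℕ → R
  rational m p = fromℕ p / fromℕ (suc m) - fromℕ m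

  -- A single `m` serves as shift and as denominator: it is large enough that `x + m` is nonnegative
  -- and that `M (y - x) ≥ 1`. Then `p` is the ceiling of `M (x + m)`, less than one unit above it.
  rational-between : ∀ {x y} → x < y → ∃₂ λ m p → x ≤ rational m p × rational m p < y
  rational-between {x} {y} x<y = m , p ,
    *-cancelˡ-≤ 0<M (begin
      M * x                      ≈⟨ solve 3 (λ M x m → M :* x := M :* (x :+ m) :- M :* m) refl M x (fromℕ m) ⟩
      z - M * fromℕ m            ≤⟨ +-monoˡ-≤ _ (proj₁ (proj₂ ceil)) ⟩
      fromℕ p - M * fromℕ m      ≈⟨ scaled ⟨
      M * rational m p           ∎) ,
    *-cancelˡ-< (<⇒≤ 0<M) (begin-strict
      M * rational m p           ≈⟨ scaled ⟩
      fromℕ p - M * fromℕ m      ≈⟨ +-comm _ _ ⟩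
      - (M * fromℕ m) + fromℕ p  <⟨ +-monoʳ-< _ (proj₂ (proj₂ ceil)) ⟩
      - (M * fromℕ m) + (z + 1#) ≤⟨ +-monoʳ-≤ _ (+-monoʳ-≤ z 1≤M[y-x]) ⟩
      - (M * fromℕ m) + (z + M * (y - x))  ≈⟨ solve 4 (λ M x y m → :- (M :* m) :+ (M :* (x :+ m) :+ M :* (y :- x)) := M :* y) refl M x y (fromℕ m) ⟩
      M * y                      ∎)
    where
    a = archimedean (- x)
    b = archimedean-inv (x<y⇒0<y-x x<y)
    m = proj₁ a ℕ.+ proj₁ b
    M = fromℕ (suc m)
    0<M : 0# < M
    0<M = 0<fromℕ {suc m} (ℕ.s≤s ℕ.z≤n)
    z = M * (x + fromℕ m)
    0≤x+m : 0# ≤ x + fromℕ m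
    0≤x+m = ≤-respʳ-≈ (solve 2 (λ x m → m :- :- x := x :+ m) refl x (fromℕ m))
      (x≤y⇒0≤y-x (≤-trans (<⇒≤ (proj₂ a)) (fromℕ-mono-≤ (ℕₚ.m≤m+n (proj₁ a) (proj₁ b)))))
    ceil = ceiling (0≤x*y (<⇒≤ 0<M) 0≤x+m)
    p = proj₁ ceil
    1≤M[y-x] : 1# ≤ M * (y - x)
    1≤M[y-x] = ≤-trans (proj₂ b) (*-mono-≤ (0≤fromℕ (suc (proj₁ b))) (x≤y⇒0≤y-x (<⇒≤ x<y))
      (fromℕ-mono-≤ (ℕ.s≤s (ℕₚ.m≤n+m (proj₁ b) (proj₁ a)))) ≤-refl)
    scaled : M * rational m p ≈ fromℕ p - M * fromℕ m
    scaled = trans (solve 3 (λ M q m → M :* (q :- m) := M :* q :- M :* m) refl M (fromℕ p / M) (fromℕ m))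
      (+-congʳ (x*[y/x]≈y 0<M (fromℕ p)))

  product-cong : ∀ {n} {f g : Fin n → R} → (∀ k → g k ≈ f k) → product g ≈ product f
  product-cong {zero}  _   = refl
  product-cong {suc n} g≈f = *-cong (g≈f zero) (product-cong λ k → g≈f (suc k))

  product-update : ∀ {n} {f g : Fin n → R} (i : Fin n) c → g i ≈ c * f i → (∀ k → k ≢ i → g k ≈ f k) →
                   product g ≈ c * product f
  product-update zero c gᵢ g≈f =
    trans (*-cong gᵢ (product-cong λ k → g≈f (suc k) λ ())) (*-assoc c _ _)
  product-update {f = f} (suc i) c gᵢ g≈f =
    trans (*-cong (g≈f zero λ ()) (product-update i c gᵢ λ k k≢i → g≈f (suc k) λ { ≡.refl → k≢i ≡.refl }))
      (solve 3 (λ x c p → x :* (c :* p) := c :* (x :* p)) refl (f zero) c _)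

  product-1 : ∀ n → product {n} (λ _ → 1#) ≈ 1#
  product-1 zero    = refl
  product-1 (suc n) = trans (*-identityˡ _) (product-1 n)

  Borel-U : Borel U
  Borel-U = resp ((λ _ → tt) , λ {x} _ → proj₁ (archimedean x) , <⇒≤ (proj₂ (archimedean x)))
    (⋃-closed λ k → half-line (fromℕ k))

  module Sample {n} (S : UniformSample n) where
    open UniformSample S
    open Measure space

    In01 : R → Set
    In01 t = 0# ≤ t × t ≤ 1#

    Event-Z≤ : ∀ i t → Event (λ ω → Z i ω ≤ t)
    Event-Z≤ i t = Z-randomVariable i (half-line t)

    -- Measurability is given for each variable separately, so the comparison is written as a
    -- countable union over rational thresholds `q` with `Z j ≤ q < Z i`.
    Event-Z<Z : ∀ j i → Event (λ ω → Z j ω < Z i ω)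
    Event-Z<Z j i = Event-resp (separated⇒< , <⇒separated)
      (Event-⋃ {A = λ m ω → ∃ λ p → Separated m p ω} λ m → Event-⋃ {A = Separated m} λ p →
        Event-∩ (Event-Z≤ j (rational m p)) (Event-∁ (Event-Z≤ i (rational m p))))
      where
      Separated : ℕ → ℕ → Pred Ω 0ℓ
      Separated m p = (λ ω → Z j ω ≤ rational m p) ∩ ∁ (λ ω → Z i ω ≤ rational m p)
      separated⇒< : ∀ {ω} → (∃₂ λ m p → Separated m p ω) → Z j ω < Z i ω
      separated⇒< (m , p , Zj≤q , Zi≰q) = ≤-<-trans Zj≤q (≰⇒> Zi≰q)
      <⇒separated : ∀ {ω} → Z j ω < Z i ω → ∃₂ λ m p → Separated m p ω
      <⇒separated Zj<Zi = map₂ (map₂ (map₂ λ q<Zi Zi≤q → ≤⇒≯ Zi≤q q<Zi)) (rational-between Zj<Zi)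

    Event-Z≤Z : ∀ j i → Event (λ ω → Z j ω ≤ Z i ω)
    Event-Z≤Z j i = Event-resp (≮⇒≥ , ≤⇒≯) (Event-∁ (Event-Z<Z i j))

    -- A substitute for integrating over the value of `Z i`. `H s` is `A` with `Z i` frozen at `s`;
    -- in the applications `k` is the number of variables required to lie below `Z i`, and `g` is
    -- the probability of the remaining conditions. The conclusion is the integral of `g t^k` over
    -- the unit interval, multiplied by `k + 1` to avoid a division.
    slice : ∀ k i {A} {H : R → Pred Ω 0ℓ} {g} → 0# ≤ g → Event A → (∀ s → Event (H s)) →
            (∀ {s} → In01 s → ℙ (H s) ≈ g * s ^ k) →
            (∀ {s t} → In01 s → In01 t → ℙ (λ ω → Z i ω ≤ t × H s ω) ≈ t * ℙ (H s)) →
            (∀ {s ω} → H s ω → s < Z i ω → A ω) →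
            (∀ {t ω} → A ω → Z i ω ≤ t → H t ω) →
            fromℕ (suc k) * ℙ A ≈ g
    slice k i {A} {H} {g} 0≤g A-event H-event ℙH independent below above = begin-equality
      K * ℙ A                                      ≈⟨ *-congˡ (ℙ-split A-event (Event-Z≤ i 1#)) ⟩
      K * (ℙ (A ∩ Z≤ 1#) + ℙ (A ∩ ∁ (Z≤ 1#)))      ≈⟨ *-congˡ (+-congˡ above-1) ⟩
      K * (ℙ (A ∩ Z≤ 1#) + 0#)                     ≈⟨ solve 2 (λ K a → K :* (a :+ :0) := K :* a :- K :* :0) refl K (ℙ (A ∩ Z≤ 1#)) ⟩
      F 1# - K * 0#                                ≈⟨ +-congˡ (-‿cong (*-congˡ below-0)) ⟨
      F 1# - F 0#                                  ≈⟨ slope-determines φ-cong F-cong G-cong F-slope (power-slope k 0≤g) ⟩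
      g * 1# ^ suc k - g * 0# ^ suc k              ≈⟨ +-cong (*-congˡ (1^n≈1 (suc k))) (-‿cong (*-congˡ (0^suc≈0 k))) ⟩
      g * 1# - g * 0#                              ≈⟨ solve 1 (λ g → g :* :1 :- g :* :0 := g) refl g ⟩
      g                                            ∎
      where
      K = fromℕ (suc k)
      Z≤ : R → Pred Ω 0ℓ
      Z≤ t ω = Z i ω ≤ t
      F : R → R
      F t = K * ℙ (A ∩ Z≤ t)
      φ : R → R
      φ t = K * (g * t ^ k)
      φ-cong : ∀ {s t} → s ≈ t → φ s ≈ φ t
      φ-cong s≈t = *-congˡ (*-congˡ (^-congˡ k s≈t))
      G-cong : ∀ {s t} → s ≈ t → g * s ^ suc k ≈ g * t ^ suc k
      G-cong s≈t = *-congˡ (^-congˡ (suc k) s≈t)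
      F-cong : ∀ {s t} → s ≈ t → F s ≈ F t
      F-cong {s} s≈t = *-congˡ (ℙ-cong (Event-∩ A-event (Event-Z≤ i s))
        ((λ (a , Z≤s) → a , ≤-respʳ-≈ s≈t Z≤s) , λ (a , Z≤t) → a , ≤-respʳ-≈ (sym s≈t) Z≤t))

      -- Uniformity speaks only of thresholds in the unit interval; this and `below-0` show that the
      -- slices outside it carry no mass.
      above-1 : ℙ (A ∩ ∁ (Z≤ 1#)) ≈ 0#
      above-1 = ≤-antisym
        (begin
          ℙ (A ∩ ∁ (Z≤ 1#))  ≤⟨ ℙ-mono (Event-∩ A-event (Event-∁ (Event-Z≤ i 1#))) (Event-∁ (Event-Z≤ i 1#)) (λ _ → proj₂) ⟩
          ℙ (∁ (Z≤ 1#))      ≈⟨ ℙ-∁ (Event-Z≤ i 1#) ⟩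
          1# - ℙ (Z≤ 1#)     ≈⟨ +-congˡ (-‿cong (Z-uniform i 1# 0≤1 ≤-refl)) ⟩
          1# - 1#            ≈⟨ -‿inverseʳ 1# ⟩
          0#                 ∎)
        (ℙ-nonneg (Event-∩ A-event (Event-∁ (Event-Z≤ i 1#))))

      below-0 : ℙ (A ∩ Z≤ 0#) ≈ 0#
      below-0 = ≤-antisym
        (≤-respʳ-≈ (Z-uniform i 0# ≤-refl 0≤1) (ℙ-mono (Event-∩ A-event (Event-Z≤ i 0#)) (Event-Z≤ i 0#) (λ _ → proj₂)))
        (ℙ-nonneg (Event-∩ A-event (Event-Z≤ i 0#)))

      strip : Pred Ω 0ℓ → R → R → Pred Ω 0ℓ
      strip B s t = (B ∩ Z≤ t) ∩ ∁ (Z≤ s)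

      Event-strip : ∀ {B} → Event B → ∀ s t → Event (strip B s t)
      Event-strip B-event s t = Event-∩ (Event-∩ B-event (Event-Z≤ i t)) (Event-∁ (Event-Z≤ i s))

      ℙ-strip : ∀ {B} → Event B → ∀ {s t} → s ≤ t → ℙ (B ∩ Z≤ t) - ℙ (B ∩ Z≤ s) ≈ ℙ (strip B s t)
      ℙ-strip {B} B-event {s} {t} s≤t = begin-equality
        ℙ (B ∩ Z≤ t) - ℙ (B ∩ Z≤ s)
          ≈⟨ +-congʳ (ℙ-split (Event-∩ B-event (Event-Z≤ i t)) (Event-Z≤ i s)) ⟩
        ℙ ((B ∩ Z≤ t) ∩ Z≤ s) + ℙ (strip B s t) - ℙ (B ∩ Z≤ s)
          ≈⟨ +-congʳ (+-congʳ (ℙ-cong (Event-∩ (Event-∩ B-event (Event-Z≤ i t)) (Event-Z≤ i s))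
               ((λ ((b , _) , Z≤s) → b , Z≤s) , λ (b , Z≤s) → (b , ≤-trans Z≤s s≤t) , Z≤s))) ⟩
        ℙ (B ∩ Z≤ s) + ℙ (strip B s t) - ℙ (B ∩ Z≤ s)
          ≈⟨ solve 2 (λ a b → a :+ b :- a := b) refl (ℙ (B ∩ Z≤ s)) (ℙ (strip B s t)) ⟩
        ℙ (strip B s t) ∎

      ℙ-strip-H : ∀ {r s t} → In01 r → In01 s → In01 t → s ≤ t → K * ℙ (strip (H r) s t) ≈ φ r * (t - s)
      ℙ-strip-H {r} {s} {t} r∈ s∈ t∈ s≤t = begin-equality
        K * ℙ (strip (H r) s t)                      ≈⟨ *-congˡ (ℙ-strip (H-event r) s≤t) ⟨
        K * (ℙ (H r ∩ Z≤ t) - ℙ (H r ∩ Z≤ s))        ≈⟨ *-congˡ (+-cong (factor t∈) (-‿cong (factor s∈))) ⟩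
        K * (t * (g * r ^ k) - s * (g * r ^ k))      ≈⟨ solve 4 (λ K s t p → K :* (t :* p :- s :* p) := K :* p :* (t :- s)) refl K s t (g * r ^ k) ⟩
        φ r * (t - s)                                ∎
        where
        factor : ∀ {u} → In01 u → ℙ (H r ∩ Z≤ u) ≈ u * (g * r ^ k)
        factor {u} u∈ = trans
          (ℙ-cong (Event-∩ (H-event r) (Event-Z≤ i u)) ((λ (h , Z≤u) → Z≤u , h) , λ (Z≤u , h) → h , Z≤u))
          (trans (independent r∈ u∈) (*-congˡ (ℙH r∈)))

      F-slope : SlopeBetween φ F
      F-slope {s} {t} 0≤s s≤t t≤1 =
        (begin
          φ s * (t - s)           ≈⟨ ℙ-strip-H s∈ s∈ t∈ s≤t ⟨
          K * ℙ (strip (H s) s t) ≤⟨ *-monoˡ-≤ 0≤K (ℙ-mono (Event-strip (H-event s) s t) (Event-strip A-event s t)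
                                       λ _ ((h , Z≤t) , Z≰s) → (below h (≰⇒> Z≰s) , Z≤t) , Z≰s) ⟩
          K * ℙ (strip A s t)     ≈⟨ F-strip ⟨
          F t - F s               ∎) ,
        (begin
          F t - F s               ≈⟨ F-strip ⟩
          K * ℙ (strip A s t)     ≤⟨ *-monoˡ-≤ 0≤K (ℙ-mono (Event-strip A-event s t) (Event-strip (H-event t) s t)
                                       λ _ ((a , Z≤t) , Z≰s) → (above a Z≤t , Z≤t) , Z≰s) ⟩
          K * ℙ (strip (H t) s t) ≈⟨ ℙ-strip-H t∈ s∈ t∈ s≤t ⟩
          φ t * (t - s)           ∎)
        where
        s∈ : In01 s
        s∈ = 0≤s , ≤-trans s≤t t≤1
        t∈ : In01 t
        t∈ = ≤-trans 0≤s s≤t , t≤1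
        0≤K : 0# ≤ K
        0≤K = 0≤fromℕ (suc k)
        F-strip : F t - F s ≈ K * ℙ (strip A s t)
        F-strip = trans (solve 3 (λ K a b → K :* a :- K :* b := K :* (a :- b)) refl K (ℙ (A ∩ Z≤ t)) (ℙ (A ∩ Z≤ s)))
          (*-congˡ (ℙ-strip A-event s≤t))

    -- Upper bounds on a few coordinates. Independence is stated with a Borel set at every index, so
    -- `sides` turns such a list into a full family, with `U` at the indices that are not listed.
    Constraints : Set
    Constraints = List (Fin n × R)

    Satisfies : Constraints → Pred Ω 0ℓ
    Satisfies []            ω = ⊤
    Satisfies ((i , t) ∷ L) ω = Z i ω ≤ t × Satisfies L ω

    Fresh : Fin n → Constraints → Set
    Fresh i []            = ⊤
    Fresh i ((j , _) ∷ L) = i ≢ j × Fresh i L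

    Valid : Constraints → Set
    Valid []            = ⊤
    Valid ((i , t) ∷ L) = Fresh i L × In01 t × Valid L

    volume : Constraints → R
    volume []            = 1#
    volume ((_ , t) ∷ L) = t * volume L

    0≤volume : ∀ L → Valid L → 0# ≤ volume L
    0≤volume []      _                          = 0≤1
    0≤volume (_ ∷ L) (_ , (0≤t , _) , L-valid) = 0≤x*y 0≤t (0≤volume L L-valid)

    Event-Satisfies : ∀ L → Event (Satisfies L)
    Event-Satisfies []            = Event-U
    Event-Satisfies ((i , t) ∷ L) = Event-∩ (Event-Z≤ i t) (Event-Satisfies L)

    sides : Constraints → Fin n → Pred R 0ℓ
    sides []            k = U
    sides ((i , t) ∷ L) k with k Finₚ.≟ i
    ... | yes _ = _≤ t
    ... | no _  = sides L k

    Borel-sides : ∀ L k → Borel (sides L k)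
    Borel-sides []            k = Borel-U
    Borel-sides ((i , t) ∷ L) k with k Finₚ.≟ i
    ... | yes _ = half-line t
    ... | no _  = Borel-sides L k

    fresh-side : ∀ L k → Fresh k L → ∀ x → sides L k x
    fresh-side []            k _             x = tt
    fresh-side ((i , t) ∷ L) k (k≢i , fresh) x with k Finₚ.≟ i
    ... | yes k≡i = contradiction k≡i k≢i
    ... | no _    = fresh-side L k fresh x

    box⇒satisfies : ∀ L → Valid L → ∀ {ω} → (∀ k → sides L k (Z k ω)) → Satisfies L ω
    box⇒satisfies []            _                      box = tt
    box⇒satisfies ((i , t) ∷ L) (fresh , _ , L-valid) {ω} box = head , box⇒satisfies L L-valid tail
      where
      head : Z i ω ≤ t
      head with i Finₚ.≟ i | box i
      ... | yes _  | Z≤t = Z≤t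
      ... | no i≢i | _   = contradiction ≡.refl i≢i
      tail : ∀ k → sides L k (Z k ω)
      tail k with k Finₚ.≟ i | box k
      ... | yes ≡.refl | _    = fresh-side L i fresh (Z i ω)
      ... | no _       | side = side

    satisfies⇒box : ∀ L {ω} → Satisfies L ω → ∀ k → sides L k (Z k ω)
    satisfies⇒box []            _           k = tt
    satisfies⇒box ((i , t) ∷ L) (Z≤t , sat) k with k Finₚ.≟ i
    ... | yes ≡.refl = Z≤t
    ... | no _       = satisfies⇒box L sat k

    -- Since `i` is fresh for the tail, its factor there is `ℙ U ≈ 1#`; adding the constraint
    -- replaces it by `t` and leaves the other factors alone.
    product-sides : ∀ L → Valid L → product (λ k → ℙ (λ ω → sides L k (Z k ω))) ≈ volume L
    product-sides [] _ = trans (product-cong {n} (λ _ → ℙ-U)) (product-1 n)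
    product-sides ((i , t) ∷ L) (fresh , (0≤t , t≤1) , L-valid) = trans
      (product-update i t at-i elsewhere) (*-congˡ (product-sides L L-valid))
      where
      at-i : ℙ (λ ω → sides ((i , t) ∷ L) i (Z i ω)) ≈ t * ℙ (λ ω → sides L i (Z i ω))
      at-i with i Finₚ.≟ i
      ... | no i≢i = contradiction ≡.refl i≢i
      ... | yes _  = begin-equality
        ℙ (λ ω → Z i ω ≤ t)                ≈⟨ Z-uniform i t 0≤t t≤1 ⟩
        t                                  ≈⟨ *-identityʳ t ⟨
        t * 1#                             ≈⟨ *-congˡ (trans (sym ℙ-U) (ℙ-cong Event-U ((λ {ω} _ → fresh-side L i fresh (Z i ω)) , λ _ → tt))) ⟩
        t * ℙ (λ ω → sides L i (Z i ω))    ∎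
      elsewhere : ∀ k → k ≢ i → ℙ (λ ω → sides ((i , t) ∷ L) k (Z k ω)) ≈ ℙ (λ ω → sides L k (Z k ω))
      elsewhere k k≢i with k Finₚ.≟ i
      ... | yes k≡i = contradiction k≡i k≢i
      ... | no _    = refl

    ℙ-Satisfies : ∀ L → Valid L → ℙ (Satisfies L) ≈ volume L
    ℙ-Satisfies L L-valid = begin-equality
      ℙ (Satisfies L)                                  ≈⟨ ℙ-cong (Event-Satisfies L) (satisfies⇒box L , box⇒satisfies L L-valid) ⟩
      ℙ (λ ω → ∀ k → sides L k (Z k ω))                ≈⟨ Z-independent (sides L) (Borel-sides L) ⟩
      product (λ k → ℙ (λ ω → sides L k (Z k ω)))      ≈⟨ product-sides L L-valid ⟩
      volume L                                         ∎

    -- Shared by < and ≤, whose difference is a null event.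
    record Comparison (T : R → R → Set) : Set₁ where
      field
        below : ∀ {y s x} → y ≤ s → s < x → T y x
        above : ∀ {y t x} → T y x → x ≤ t → y ≤ t
        event : ∀ j i → Event (λ ω → T (Z j ω) (Z i ω))

    <-comparison : Comparison _<_
    <-comparison = record { below = ≤-<-trans ; above = λ y<x x≤t → <⇒≤ (<-≤-trans y<x x≤t) ; event = Event-Z<Z }

    ≤-comparison : Comparison _≤_
    ≤-comparison = record { below = λ y≤s s<x → <⇒≤ (≤-<-trans y≤s s<x) ; above = ≤-trans ; event = Event-Z≤Z }

    module _ {T : R → R → Set} (T-comparison : Comparison T) where
      open Comparison T-comparison

      -- The constraints on further coordinates are carried along for `ℙ-disjoint-pairs`, where one
      -- pair is compared while the other is being sliced.
      ℙ-pair-given : ∀ {i j} → i ≢ j → ∀ L → Valid L → Fresh i L → Fresh j L →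
                     fromℕ 2 * ℙ (λ ω → T (Z j ω) (Z i ω) × Satisfies L ω) ≈ volume L
      ℙ-pair-given {i} {j} i≢j L L-valid i-fresh j-fresh = slice 1 i (0≤volume L L-valid)
        (Event-∩ (event j i) (Event-Satisfies L))
        (λ s → Event-Satisfies ((j , s) ∷ L))
        (λ {s} s∈ → trans (ℙ-Satisfies ((j , s) ∷ L) (j-fresh , s∈ , L-valid))
                          (solve 2 (λ s v → s :* v := v :* s :^ 1) refl s (volume L)))
        (λ {s} {t} s∈ t∈ → trans (ℙ-Satisfies ((i , t) ∷ (j , s) ∷ L) ((i≢j , i-fresh) , t∈ , j-fresh , s∈ , L-valid))
                                 (*-congˡ (sym (ℙ-Satisfies ((j , s) ∷ L) (j-fresh , s∈ , L-valid)))))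
        (λ (Zj≤s , sat) s<Zi → below Zj≤s s<Zi , sat)
        (λ (T-ji , sat) Zi≤t → above T-ji Zi≤t , sat)

      ℙ-pair : ∀ {i j} → i ≢ j → fromℕ 2 * ℙ (λ ω → T (Z j ω) (Z i ω)) ≈ 1#
      ℙ-pair {i} {j} i≢j = trans
        (*-congˡ (ℙ-cong (event j i) ((λ T-ji → T-ji , tt) , proj₁))) (ℙ-pair-given i≢j [] tt tt tt)

      module _ {T′ : R → R → Set} (T′-comparison : Comparison T′) where
        private module T′ = Comparison T′-comparison

        -- Slicing at the largest variable leaves a square of side `s`, whence the exponent 2. The
        -- two comparisons may differ because `ℙ-chain` combines one with a complement.
        ℙ-common-upper : ∀ {i j k} → i ≢ j → i ≢ k → j ≢ k →
                         fromℕ 3 * ℙ (λ ω → T (Z j ω) (Z i ω) × T′ (Z k ω) (Z i ω)) ≈ 1#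
        ℙ-common-upper {i} {j} {k} i≢j i≢k j≢k = slice 2 i 0≤1
          (Event-∩ (event j i) (T′.event k i))
          (λ s → Event-Satisfies ((j , s) ∷ (k , s) ∷ []))
          (λ {s} s∈ → trans (ℙ-Satisfies ((j , s) ∷ (k , s) ∷ []) ((j≢k , tt) , s∈ , tt , s∈ , tt))
                            (solve 1 (λ s → s :* (s :* :1) := :1 :* s :^ 2) refl s))
          (λ {s} {t} s∈ t∈ → trans
            (ℙ-Satisfies ((i , t) ∷ (j , s) ∷ (k , s) ∷ []) ((i≢j , i≢k , tt) , t∈ , (j≢k , tt) , s∈ , tt , s∈ , tt))
            (*-congˡ (sym (ℙ-Satisfies ((j , s) ∷ (k , s) ∷ []) ((j≢k , tt) , s∈ , tt , s∈ , tt)))))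
          (λ (Zj≤s , Zk≤s , _) s<Zi → below Zj≤s s<Zi , T′.below Zk≤s s<Zi)
          (λ (T-ji , T-ki) Zi≤t → above T-ji Zi≤t , T′.above T-ki Zi≤t , tt)

    -- Independence is applied to boxes only, so the second comparison is kept inside `H`: slicing
    -- at `Z i` leaves the comparison of `Z l` with `Z k` together with `Z j ≤ s`, of probability
    -- `s / 2` by `ℙ-pair-given`.
    ℙ-disjoint-pairs : ∀ {i j k l} → i ≢ j → i ≢ k → i ≢ l → j ≢ k → j ≢ l → k ≢ l →
                       fromℕ 4 * ℙ (λ ω → Z j ω < Z i ω × Z l ω < Z k ω) ≈ 1#
    ℙ-disjoint-pairs {i} {j} {k} {l} i≢j i≢k i≢l j≢k j≢l k≢l = begin-equality
      fromℕ 4 * p              ≈⟨ solve 1 (λ p → con (pos 4) :* p := con (pos 2) :* (con (pos 2) :* p)) refl p ⟩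
      fromℕ 2 * (fromℕ 2 * p)  ≈⟨ *-congˡ (slice 1 i (<⇒≤ (0<half 0<1))
                                    (Event-∩ (Event-Z<Z j i) (Event-Z<Z l k)) Event-H ℙH independent
                                    (λ (Zl<Zk , Zj≤s , _) s<Zi → ≤-<-trans Zj≤s s<Zi , Zl<Zk)
                                    (λ (Zj<Zi , Zl<Zk) Zi≤t → Zl<Zk , <⇒≤ (<-≤-trans Zj<Zi Zi≤t) , tt)) ⟩
      fromℕ 2 * half 1#        ≈⟨ 2*half-1≈1 ⟩
      1#                       ∎
      where
      p = ℙ (λ ω → Z j ω < Z i ω × Z l ω < Z k ω)
      2*half-1≈1 : fromℕ 2 * half 1# ≈ 1#
      2*half-1≈1 = x*[y/x]≈y 0<2 1#
      H : R → Pred Ω 0ℓ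
      H s ω = Z l ω < Z k ω × Satisfies ((j , s) ∷ []) ω
      Event-H : ∀ s → Event (H s)
      Event-H s = Event-∩ (Event-Z<Z l k) (Event-Satisfies ((j , s) ∷ []))
      2ℙH : ∀ {s} → In01 s → fromℕ 2 * ℙ (H s) ≈ s * 1#
      2ℙH {s} s∈ = ℙ-pair-given <-comparison k≢l ((j , s) ∷ []) (tt , s∈ , tt)
        ((λ k≡j → j≢k (≡.sym k≡j)) , tt) ((λ l≡j → j≢l (≡.sym l≡j)) , tt)
      ℙH : ∀ {s} → In01 s → ℙ (H s) ≈ half 1# * s ^ 1
      ℙH {s} s∈ = *-cancelˡ-≈ 0<2 (begin-equality
        fromℕ 2 * ℙ (H s)            ≈⟨ 2ℙH s∈ ⟩
        s * 1#                       ≈⟨ *-identityˡ _ ⟨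
        1# * (s * 1#)                ≈⟨ *-congʳ 2*half-1≈1 ⟨
        fromℕ 2 * half 1# * (s * 1#) ≈⟨ *-assoc _ _ _ ⟩
        fromℕ 2 * (half 1# * s ^ 1)  ∎)
      independent : ∀ {s t} → In01 s → In01 t → ℙ (λ ω → Z i ω ≤ t × H s ω) ≈ t * ℙ (H s)
      independent {s} {t} s∈ t∈ = *-cancelˡ-≈ 0<2 (begin-equality
        fromℕ 2 * ℙ (λ ω → Z i ω ≤ t × H s ω)
          ≈⟨ *-congˡ (ℙ-cong (Event-∩ (Event-Z≤ i t) (Event-H s))
               ((λ (x , y , z) → y , x , z) , λ (y , x , z) → x , y , z)) ⟩
        fromℕ 2 * ℙ (λ ω → Z l ω < Z k ω × Satisfies ((i , t) ∷ (j , s) ∷ []) ω)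
          ≈⟨ ℙ-pair-given <-comparison k≢l ((i , t) ∷ (j , s) ∷ []) ((i≢j , tt) , t∈ , tt , s∈ , tt)
               ((λ k≡i → i≢k (≡.sym k≡i)) , (λ k≡j → j≢k (≡.sym k≡j)) , tt)
               ((λ l≡i → i≢l (≡.sym l≡i)) , (λ l≡j → j≢l (≡.sym l≡j)) , tt) ⟩
        t * (s * 1#)
          ≈⟨ *-congˡ (2ℙH s∈) ⟨
        t * (fromℕ 2 * ℙ (H s))
          ≈⟨ solve 2 (λ t h → t :* (con (pos 2) :* h) := con (pos 2) :* (t :* h)) refl t (ℙ (H s)) ⟩
        fromℕ 2 * (t * ℙ (H s)) ∎)

    -- The comparison of `Z k` with `Z j` has probability 1/2. On the part where `Z j < Z i` fails,
    -- `Z j` is a common upper bound, which takes away 1/3 and leaves 1/6. The complement of `<` is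
    -- `≤`, so ties need no separate treatment.
    ℙ-chain : ∀ {T} → Comparison T → ∀ {i j k} → i ≢ j → i ≢ k → j ≢ k →
              fromℕ 6 * ℙ (λ ω → T (Z k ω) (Z j ω) × Z j ω < Z i ω) ≈ 1#
    ℙ-chain {T} T-comparison {i} {j} {k} i≢j i≢k j≢k = begin-equality
      fromℕ 6 * b
        ≈⟨ solve 2 (λ b c → con (pos 6) :* b := con (pos 3) :* (con (pos 2) :* (b :+ c)) :- con (pos 2) :* (con (pos 3) :* c)) refl b c ⟩
      fromℕ 3 * (fromℕ 2 * (b + c)) - fromℕ 2 * (fromℕ 3 * c)
        ≈⟨ +-cong (*-congˡ (trans (*-congˡ (sym split)) (ℙ-pair T-comparison j≢k)))
                  (-‿cong (*-congˡ (ℙ-common-upper T-comparison ≤-comparison j≢k (λ j≡i → i≢j (≡.sym j≡i)) (λ k≡i → i≢k (≡.sym k≡i))))) ⟩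
      fromℕ 3 * 1# - fromℕ 2 * 1#
        ≈⟨ solve 0 (con (pos 3) :* :1 :- con (pos 2) :* :1 := :1) refl ⟩
      1# ∎
      where
      T-event = Comparison.event T-comparison k j
      b = ℙ (λ ω → T (Z k ω) (Z j ω) × Z j ω < Z i ω)
      c = ℙ (λ ω → T (Z k ω) (Z j ω) × Z i ω ≤ Z j ω)
      split : ℙ (λ ω → T (Z k ω) (Z j ω)) ≈ b + c
      split = trans (ℙ-split T-event (Event-Z<Z j i))
        (+-congˡ (ℙ-cong (Event-∩ T-event (Event-∁ (Event-Z<Z j i)))
          ((λ (t , Zj≮Zi) → t , ≮⇒≥ Zj≮Zi) , λ (t , Zi≤Zj) → t , ≤⇒≯ Zi≤Zj)))

    -- `slice` works with variables below the sliced one, so this case is obtained by subtraction: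
    -- 1/2 for `Z j < Z i`, less 1/6 for the chain in which also `Z k ≤ Z j`.
    ℙ-common-lower : ∀ {i j k} → i ≢ j → i ≢ k → j ≢ k →
                     fromℕ 3 * ℙ (λ ω → Z j ω < Z i ω × Z j ω < Z k ω) ≈ 1#
    ℙ-common-lower {i} {j} {k} i≢j i≢k j≢k = *-cancelˡ-≈ 0<2 (begin-equality
      fromℕ 2 * (fromℕ 3 * b)
        ≈⟨ solve 2 (λ b c → con (pos 2) :* (con (pos 3) :* b) := con (pos 3) :* (con (pos 2) :* (b :+ c)) :- con (pos 6) :* c) refl b c ⟩
      fromℕ 3 * (fromℕ 2 * (b + c)) - fromℕ 6 * c
        ≈⟨ +-cong (*-congˡ (trans (*-congˡ (sym split)) (ℙ-pair <-comparison i≢j)))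
                  (-‿cong (ℙ-chain ≤-comparison i≢j i≢k j≢k)) ⟩
      fromℕ 3 * 1# - 1#
        ≈⟨ solve 0 (con (pos 3) :* :1 :- :1 := con (pos 2) :* :1) refl ⟩
      fromℕ 2 * 1# ∎)
      where
      b = ℙ (λ ω → Z j ω < Z i ω × Z j ω < Z k ω)
      c = ℙ (λ ω → Z k ω ≤ Z j ω × Z j ω < Z i ω)
      split : ℙ (λ ω → Z j ω < Z i ω) ≈ b + c
      split = trans (ℙ-split (Event-Z<Z j i) (Event-Z<Z j k))
        (+-congˡ (ℙ-cong (Event-∩ (Event-Z<Z j i) (Event-∁ (Event-Z<Z j k)))
          ((λ (Zj<Zi , Zj≮Zk) → ≮⇒≥ Zj≮Zk , Zj<Zi) , λ (Zk≤Zj , Zj<Zi) → Zj<Zi , ≤⇒≯ Zk≤Zj)))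

    -- The joint probability of two inversions in terms of their shared indices.

    Inversion : Fin n → Fin n → Pred Ω 0ℓ
    Inversion i j ω = Z j ω < Z i ω

    Event-Inversion : ∀ i j → Event (Inversion i j)
    Event-Inversion i j = Event-Z<Z j i

    δ : Fin n → Fin n → R
    δ i j with i Finₚ.≟ j
    ... | yes _ = 1#
    ... | no _  = 0#

    δ-≡ : ∀ {i j} → i ≡ j → δ i j ≈ 1#
    δ-≡ {i} {j} i≡j with i Finₚ.≟ j
    ... | yes _  = refl
    ... | no i≢j = contradiction i≡j i≢j

    δ-≢ : ∀ {i j} → i ≢ j → δ i j ≈ 0#
    δ-≢ {i} {j} i≢j with i Finₚ.≟ j
    ... | yes i≡j = contradiction i≡j i≢j
    ... | no _    = refl

    -- Twelve times the covariance of two inversion indicators: the inner product expanded into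
    -- Kronecker deltas, with `δ i k * δ j l` as the correction for equal pairs.
    shared : (i j k l : Fin n) → R
    shared i j k l = δ i k - δ i l - δ j k + δ j l + δ i k * δ j l

    -- The 3 is twelve times the product 1/4 of the means. Opposite pairs are excluded because the
    -- formula fails for them: their inversions never occur together, while the right side would be
    -- 1.
    ℙ-two-inversions : ∀ {i j k l} → i ≢ j → k ≢ l → ¬ (i ≡ l × j ≡ k) →
                       fromℕ 12 * ℙ (Inversion i j ∩ Inversion k l) ≈ fromℕ 3 + shared i j k l
    ℙ-two-inversions {i} {j} {k} {l} i≢j k≢l not-reversed = cases (i Finₚ.≟ k) (j Finₚ.≟ l) (i Finₚ.≟ l) (j Finₚ.≟ k)
      where
      p = ℙ (Inversion i j ∩ Inversion k l)

      shared≈ : ∀ {a b c d} → δ i k ≈ a → δ i l ≈ b → δ j k ≈ c → δ j l ≈ d →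
                 fromℕ 12 * p ≈ fromℕ 3 + (a - b - c + d + a * d) →
                 fromℕ 12 * p ≈ fromℕ 3 + shared i j k l
      shared≈ ik il jk jl eq = trans eq (sym (+-congˡ
        (+-cong (+-cong (+-cong (+-cong ik (-‿cong il)) (-‿cong jk)) jl) (*-cong ik jl))))

      cases : Dec (i ≡ k) → Dec (j ≡ l) → Dec (i ≡ l) → Dec (j ≡ k) → fromℕ 12 * p ≈ fromℕ 3 + shared i j k l
      cases (yes ≡.refl) (yes ≡.refl) _ _ =
        shared≈ (δ-≡ {i} ≡.refl) (δ-≢ i≢j) (δ-≢ λ j≡i → i≢j (≡.sym j≡i)) (δ-≡ {j} ≡.refl) (begin-equality
          fromℕ 12 * p                                   ≈⟨ *-congˡ (ℙ-cong (Event-∩ (Event-Inversion i j) (Event-Inversion i j)) (proj₁ , λ x → x , x)) ⟩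
          fromℕ 12 * ℙ (Inversion i j)                   ≈⟨ solve 1 (λ p → con (pos 12) :* p := con (pos 6) :* (con (pos 2) :* p)) refl _ ⟩
          fromℕ 6 * (fromℕ 2 * ℙ (Inversion i j))        ≈⟨ *-congˡ (ℙ-pair <-comparison i≢j) ⟩
          fromℕ 6 * 1#                                   ≈⟨ solve 0 (con (pos 6) :* :1 := con (pos 3) :+ (:1 :- :0 :- :0 :+ :1 :+ :1 :* :1)) refl ⟩
          fromℕ 3 + (1# - 0# - 0# + 1# + 1# * 1#)        ∎)
      cases (yes ≡.refl) (no j≢l) _ _ =
        shared≈ (δ-≡ {i} ≡.refl) (δ-≢ k≢l) (δ-≢ λ j≡i → i≢j (≡.sym j≡i)) (δ-≢ j≢l) (begin-equality
          fromℕ 12 * p               ≈⟨ solve 1 (λ p → con (pos 12) :* p := con (pos 4) :* (con (pos 3) :* p)) refl p ⟩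
          fromℕ 4 * (fromℕ 3 * p)    ≈⟨ *-congˡ (ℙ-common-upper <-comparison <-comparison i≢j k≢l j≢l) ⟩
          fromℕ 4 * 1#               ≈⟨ solve 0 (con (pos 4) :* :1 := con (pos 3) :+ (:1 :- :0 :- :0 :+ :0 :+ :1 :* :0)) refl ⟩
          fromℕ 3 + (1# - 0# - 0# + 0# + 1# * 0#)        ∎)
      cases (no i≢k) (yes ≡.refl) _ _ =
        shared≈ (δ-≢ i≢k) (δ-≢ i≢j) (δ-≢ λ j≡k → k≢l (≡.sym j≡k)) (δ-≡ {j} ≡.refl) (begin-equality
          fromℕ 12 * p               ≈⟨ solve 1 (λ p → con (pos 12) :* p := con (pos 4) :* (con (pos 3) :* p)) refl p ⟩
          fromℕ 4 * (fromℕ 3 * p)    ≈⟨ *-congˡ (ℙ-common-lower i≢j i≢k λ j≡k → k≢l (≡.sym j≡k)) ⟩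
          fromℕ 4 * 1#               ≈⟨ solve 0 (con (pos 4) :* :1 := con (pos 3) :+ (:0 :- :0 :- :0 :+ :1 :+ :0 :* :1)) refl ⟩
          fromℕ 3 + (0# - 0# - 0# + 1# + 0# * 1#)        ∎)
      cases (no i≢k) (no j≢l) (yes ≡.refl) _ =
        shared≈ (δ-≢ i≢k) (δ-≡ {i} ≡.refl) (δ-≢ λ j≡k → not-reversed (≡.refl , j≡k)) (δ-≢ j≢l) (begin-equality
          fromℕ 12 * p               ≈⟨ solve 1 (λ p → con (pos 12) :* p := con (pos 2) :* (con (pos 6) :* p)) refl p ⟩
          fromℕ 2 * (fromℕ 6 * p)    ≈⟨ *-congˡ (ℙ-chain <-comparison k≢l (λ k≡j → not-reversed (≡.refl , ≡.sym k≡j)) i≢j) ⟩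
          fromℕ 2 * 1#               ≈⟨ solve 0 (con (pos 2) :* :1 := con (pos 3) :+ (:0 :- :1 :- :0 :+ :0 :+ :0 :* :0)) refl ⟩
          fromℕ 3 + (0# - 1# - 0# + 0# + 0# * 0#)        ∎)
      cases (no i≢k) (no j≢l) (no i≢l) (yes ≡.refl) =
        shared≈ (δ-≢ i≢k) (δ-≢ i≢l) (δ-≡ {j} ≡.refl) (δ-≢ j≢l) (begin-equality
          fromℕ 12 * p               ≈⟨ *-congˡ (ℙ-cong (Event-∩ (Event-Inversion i j) (Event-Inversion j l)) ((λ (x , y) → y , x) , λ (y , x) → x , y)) ⟩
          fromℕ 12 * ℙ (Inversion j l ∩ Inversion i j)
                                     ≈⟨ solve 1 (λ p → con (pos 12) :* p := con (pos 2) :* (con (pos 6) :* p)) refl _ ⟩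
          fromℕ 2 * (fromℕ 6 * ℙ (Inversion j l ∩ Inversion i j))
                                     ≈⟨ *-congˡ (ℙ-chain <-comparison i≢j i≢l k≢l) ⟩
          fromℕ 2 * 1#               ≈⟨ solve 0 (con (pos 2) :* :1 := con (pos 3) :+ (:0 :- :0 :- :1 :+ :0 :+ :0 :* :0)) refl ⟩
          fromℕ 3 + (0# - 0# - 1# + 0# + 0# * 0#)        ∎)
      cases (no i≢k) (no j≢l) (no i≢l) (no j≢k) =
        shared≈ (δ-≢ i≢k) (δ-≢ i≢l) (δ-≢ j≢k) (δ-≢ j≢l) (begin-equality
          fromℕ 12 * p               ≈⟨ solve 1 (λ p → con (pos 12) :* p := con (pos 3) :* (con (pos 4) :* p)) refl p ⟩
          fromℕ 3 * (fromℕ 4 * p)    ≈⟨ *-congˡ (ℙ-disjoint-pairs i≢j i≢k i≢l j≢k j≢l k≢l) ⟩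
          fromℕ 3 * 1#               ≈⟨ solve 0 (con (pos 3) :* :1 := con (pos 3) :+ (:0 :- :0 :- :0 :+ :0 :+ :0 :* :0)) refl ⟩
          fromℕ 3 + (0# - 0# - 0# + 0# + 0# * 0#)        ∎)

  -- Sums of weights

  ∑∑ : ∀ {m n} → (Fin m → Fin n → R) → R
  ∑∑ f = sum λ i → sum λ j → f i j

  ∑∑-cong : ∀ {m n} {f g : Fin m → Fin n → R} → (∀ i j → f i j ≈ g i j) → ∑∑ f ≈ ∑∑ g
  ∑∑-cong f≈g = sum-cong-≋ λ i → sum-cong-≋ λ j → f≈g i j

  ∑∑-+ : ∀ {m n} {f g : Fin m → Fin n → R} {x y} → ∑∑ f ≈ x → ∑∑ g ≈ y → ∑∑ (λ i j → f i j + g i j) ≈ x + y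
  ∑∑-+ {f = f} {g} f≈x g≈y = trans
    (trans (sum-cong-≋ λ i → ∑-distrib-+ (f i) (g i)) (∑-distrib-+ (λ i → sum (f i)) (λ i → sum (g i))))
    (+-cong f≈x g≈y)

  sum-neg : ∀ {n} (f : Fin n → R) → sum (λ i → - f i) ≈ - sum f
  sum-neg {zero}  f = sym ε⁻¹≈ε
  sum-neg {suc n} f = trans (+-congˡ (sum-neg λ i → f (suc i))) (-‿+-comm _ _)

  ∑∑-neg : ∀ {m n} {f : Fin m → Fin n → R} {x} → ∑∑ f ≈ x → ∑∑ (λ i j → - f i j) ≈ - x
  ∑∑-neg {f = f} f≈x = trans
    (trans (sum-cong-≋ λ i → sum-neg (f i)) (sum-neg λ i → sum (f i))) (-‿cong f≈x)

  ∑∑-scale : ∀ {m n} c (f : Fin m → Fin n → R) → ∑∑ (λ i j → c * f i j) ≈ c * ∑∑ f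
  ∑∑-scale c f = trans (sum-cong-≋ λ i → sym (*-distribˡ-sum c (f i))) (sym (*-distribˡ-sum c λ i → sum (f i)))

  sum-mono : ∀ {n} {f g : Fin n → R} → (∀ i → f i ≤ g i) → sum f ≤ sum g
  sum-mono {zero}  f≤g = ≤-refl
  sum-mono {suc n} f≤g = +-mono-≤ (f≤g zero) (sum-mono λ i → f≤g (suc i))

  0≤sum : ∀ {n} {f : Fin n → R} → (∀ i → 0# ≤ f i) → 0# ≤ sum f
  0≤sum {zero}  0≤f = ≤-refl
  0≤sum {suc n} 0≤f = 0≤x+y (0≤f zero) (0≤sum λ i → 0≤f (suc i))

  sum-const : ∀ n c → sum {n} (λ _ → c) ≈ fromℕ n * c
  sum-const zero    c = sym (zeroˡ c)
  sum-const (suc n) c = trans (+-congˡ (sum-const n c)) (sym (fromℕ-suc-* n c))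

  -- Induction on the number of terms. The cross term is handled by the inequality of arithmetic and
  -- geometric means for `A b²` and `B a²`, in squared form, which avoids roots and divisions.
  cauchy-schwarz : ∀ {n} (f g : Fin n → R) →
    sum (λ i → f i * g i) * sum (λ i → f i * g i) ≤ sum (λ i → f i * f i) * sum (λ i → g i * g i)
  cauchy-schwarz {zero}  f g = ≤-refl
  cauchy-schwarz {suc n} f g = begin
    (a * b + C) * (a * b + C)
      ≈⟨ solve 3 (λ a b C → (a :* b :+ C) :* (a :* b :+ C) := a :* b :* (a :* b) :+ con (pos 2) :* (C :* (a :* b)) :+ C :* C) refl a b C ⟩
    a * b * (a * b) + fromℕ 2 * (C * (a * b)) + C * C
      ≤⟨ +-mono-≤ (+-monoʳ-≤ _ 2Cab≤) C²≤AB ⟩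
    a * b * (a * b) + (A * (b * b) + B * (a * a)) + A * B
      ≈⟨ solve 4 (λ a b A B → a :* b :* (a :* b) :+ (A :* (b :* b) :+ B :* (a :* a)) :+ A :* B
                           := (a :* a :+ A) :* (b :* b :+ B)) refl a b A B ⟩
    (a * a + A) * (b * b + B) ∎
    where
    a = f zero
    b = g zero
    A = sum λ i → f (suc i) * f (suc i)
    B = sum λ i → g (suc i) * g (suc i)
    C = sum λ i → f (suc i) * g (suc i)
    C²≤AB : C * C ≤ A * B
    C²≤AB = cauchy-schwarz (λ i → f (suc i)) (λ i → g (suc i))
    0≤A : 0# ≤ A
    0≤A = 0≤sum λ i → 0≤x² (f (suc i))
    0≤B : 0# ≤ B
    0≤B = 0≤sum λ i → 0≤x² (g (suc i))
    x = A * (b * b)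
    y = B * (a * a)
    2Cab≤ : fromℕ 2 * (C * (a * b)) ≤ x + y
    2Cab≤ = square-cancel-≤ (0≤x+y (0≤x*y 0≤A (0≤x² b)) (0≤x*y 0≤B (0≤x² a))) (begin
      fromℕ 2 * (C * (a * b)) * (fromℕ 2 * (C * (a * b)))
        ≈⟨ solve 3 (λ a b C → con (pos 2) :* (C :* (a :* b)) :* (con (pos 2) :* (C :* (a :* b)))
                           := con (pos 4) :* (a :* b :* (a :* b)) :* (C :* C)) refl a b C ⟩
      fromℕ 4 * (a * b * (a * b)) * (C * C)
        ≤⟨ *-monoˡ-≤ (0≤x*y (0≤fromℕ 4) (0≤x² (a * b))) C²≤AB ⟩
      fromℕ 4 * (a * b * (a * b)) * (A * B)
        ≤⟨ ≤-by (0≤x² (x - y)) (solve 4 (λ a b A B →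
             (A :* (b :* b) :+ B :* (a :* a)) :* (A :* (b :* b) :+ B :* (a :* a)) :- con (pos 4) :* (a :* b :* (a :* b)) :* (A :* B)
             := (A :* (b :* b) :- B :* (a :* a)) :* (A :* (b :* b) :- B :* (a :* a))) refl a b A B) ⟩
      (x + y) * (x + y) ∎)

  ⟦_⟧ : Set → R
  ⟦ P ⟧ with lem {P = P}
  ... | yes _ = 1#
  ... | no _  = 0#

  ⟦⟧-yes : ∀ {P} → P → ⟦ P ⟧ ≈ 1#
  ⟦⟧-yes {P} p with lem {P = P}
  ... | yes _ = refl
  ... | no ¬p = contradiction p ¬p

  ⟦⟧-no : ∀ {P} → ¬ P → ⟦ P ⟧ ≈ 0#
  ⟦⟧-no {P} ¬p with lem {P = P}
  ... | yes p = contradiction p ¬p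
  ... | no _  = refl

  0≤⟦⟧ : ∀ P → 0# ≤ ⟦ P ⟧
  0≤⟦⟧ P with lem {P = P}
  ... | yes _ = 0≤1
  ... | no _  = ≤-refl

  ⟦⟧-idem : ∀ P → ⟦ P ⟧ * ⟦ P ⟧ ≈ ⟦ P ⟧
  ⟦⟧-idem P with lem {P = P}
  ... | yes _ = *-identityˡ 1#
  ... | no _  = zeroˡ 0#

  ⟦⟧-mono : ∀ {P Q} → (P → Q) → ⟦ P ⟧ ≤ ⟦ Q ⟧
  ⟦⟧-mono {P} {Q} P⇒Q with lem {P = P}
  ... | yes p = ≤-reflexive (sym (⟦⟧-yes (P⇒Q p)))
  ... | no _  = 0≤⟦⟧ Q

  ⟦⟧-cong : ∀ {P Q} → (P → Q) → (Q → P) → ⟦ P ⟧ ≈ ⟦ Q ⟧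
  ⟦⟧-cong P⇒Q Q⇒P = ≤-antisym (⟦⟧-mono P⇒Q) (⟦⟧-mono Q⇒P)

  -- Counting the indices in an interval.

  Window : ℕ → ℕ → ℕ → Set
  Window lo h j = lo ℕ.≤ j × j ℕ.< lo ℕ.+ h

  count : ∀ n → ℕ → ℕ → R
  count n lo h = sum {n} λ j → ⟦ Window lo h (toℕ j) ⟧

  count-step : ∀ n {lo h lo′ h′ x} → ⟦ Window lo h 0 ⟧ ≈ x →
               (∀ j → Window lo h (suc j) → Window lo′ h′ j) → (∀ j → Window lo′ h′ j → Window lo h (suc j)) →
               count (suc n) lo h ≈ x + count n lo′ h′
  count-step n head to from = +-cong head (sum-cong-≋ {n} λ j → ⟦⟧-cong (to (toℕ j)) (from (toℕ j)))

  count-shift : ∀ n lo h → count (suc n) (suc lo) h ≈ 0# + count n lo h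
  count-shift n lo h = count-step n (⟦⟧-no λ ())
    (λ { j (ℕ.s≤s lo≤j , ℕ.s≤s j<) → lo≤j , j< }) (λ j (lo≤j , j<) → ℕ.s≤s lo≤j , ℕ.s≤s j<)

  count-first : ∀ n h → count (suc n) 0 (suc h) ≈ 1# + count n 0 h
  count-first n h = count-step n (⟦⟧-yes (ℕ.z≤n , ℕ.s≤s ℕ.z≤n))
    (λ { j (_ , ℕ.s≤s j<) → ℕ.z≤n , j< }) (λ j (_ , j<) → ℕ.z≤n , ℕ.s≤s j<)

  count-none : ∀ n → count (suc n) 0 0 ≈ 0# + count n 0 0
  count-none n = count-step n (⟦⟧-no λ ()) (λ { _ (_ , ()) }) (λ { _ (_ , ()) })

  count-≤ : ∀ n lo h → count n lo h ≤ fromℕ h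
  count-≤ zero    lo       h       = 0≤fromℕ h
  count-≤ (suc n) (suc lo) h       = ≤-respˡ-≈ (sym (trans (count-shift n lo h) (+-identityˡ _))) (count-≤ n lo h)
  count-≤ (suc n) zero     zero    = ≤-respˡ-≈ (sym (trans (count-none n) (+-identityˡ _))) (count-≤ n 0 0)
  count-≤ (suc n) zero     (suc h) = ≤-respˡ-≈ (sym (count-first n h)) (+-monoʳ-≤ 1# (count-≤ n 0 h))

  count-≈ : ∀ n lo h → lo ℕ.+ h ℕ.≤ n → count n lo h ≈ fromℕ h
  count-≈ zero    zero     zero    _           = refl
  count-≈ (suc n) (suc lo) h       (ℕ.s≤s fit) = trans (count-shift n lo h) (trans (+-identityˡ _) (count-≈ n lo h fit))
  count-≈ (suc n) zero     zero    _           = trans (count-none n) (trans (+-identityˡ _) (count-≈ n 0 0 ℕ.z≤n))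
  count-≈ (suc n) zero     (suc h) (ℕ.s≤s fit) = trans (count-first n h) (+-congˡ (count-≈ n 0 h fit))

  m∸n≤o⇒m≤n+o : ∀ m n {o} → m ℕ.∸ n ℕ.≤ o → m ℕ.≤ n ℕ.+ o
  m∸n≤o⇒m≤n+o m n m∸n≤o = ℕₚ.≤-trans (ℕₚ.m≤n+m∸n m n) (ℕₚ.+-monoʳ-≤ n m∸n≤o)

  m<n∸o⇒m+o<n : ∀ {m n o} → m ℕ.< n ℕ.∸ o → m ℕ.+ o ℕ.< n
  m<n∸o⇒m+o<n {m} {n} {o} m<n∸o = ℕₚ.m≤o∸n⇒m+n≤o (suc m) (ℕₚ.<⇒≤ o<n) m<n∸o
    where
    o<n : o ℕ.< n
    o<n = ℕₚ.m∸n≢0⇒n<m λ n∸o≡0 → contradiction (≡.subst (m ℕ.<_) n∸o≡0 m<n∸o) λ ()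

  module Weights (n : ℕ) where

    row col imbalance : (Fin n → Fin n → R) → Fin n → R
    row w m = sum λ j → w m j
    col w m = sum λ i → w i m
    imbalance w m = row w m - col w m

    Supported : (Fin n → Fin n → R) → Set
    Supported w = ∀ i j → w i j ≈ 0# ⊎ toℕ i ℕ.< toℕ j

    form : (w v : Fin n → Fin n → R) → R
    form w v = sum (λ m → imbalance w m * imbalance v m) + ∑∑ (λ i j → w i j * v i j)

    -- What the two weight matrices have in common: 0/1 entries above the diagonal, within reach
    -- `d`, with `h` ones in each complete row or column. Rows are cut off only near the upper end
    -- of the index range and columns only near the lower end.
    record Band (w : Fin n → Fin n → R) (d h : ℕ) : Set where
      field
        supported  : Supported w
        idempotent : ∀ i j → w i j * w i j ≈ w i j
        nonneg     : ∀ i j → 0# ≤ w i j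
        row-≤      : ∀ m → row w m ≤ fromℕ h
        col-≤      : ∀ m → col w m ≤ fromℕ h
        row-≈      : ∀ m → toℕ m ℕ.+ d ℕ.< n → row w m ≈ fromℕ h
        col-≈      : ∀ m → d ℕ.≤ toℕ m → col w m ≈ fromℕ h

      imbalance² : R
      imbalance² = sum λ m → imbalance w m * imbalance w m

      total : R
      total = ∑∑ w

      form≈ : form w w ≈ imbalance² + total
      form≈ = +-congˡ (∑∑-cong idempotent)

      0≤imbalance² : 0# ≤ imbalance²
      0≤imbalance² = 0≤sum λ m → 0≤x² (imbalance w m)

      total-≤ : total ≤ fromℕ n * fromℕ h
      total-≤ = ≤-respʳ-≈ (sum-const n (fromℕ h)) (sum-mono row-≤)

      -- The rows with index below `n - d` are complete, and the others contribute nonnegatively.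
      total-≥ : fromℕ (n ℕ.∸ d) * fromℕ h ≤ total
      total-≥ = begin
        fromℕ (n ℕ.∸ d) * fromℕ h                                 ≈⟨ *-congʳ (count-≈ n 0 (n ℕ.∸ d) (ℕₚ.m∸n≤m n d)) ⟨
        count n 0 (n ℕ.∸ d) * fromℕ h                             ≈⟨ *-distribʳ-sum {n} (fromℕ h) (λ m → ⟦ Window 0 (n ℕ.∸ d) (toℕ m) ⟧) ⟩
        sum {n} (λ m → ⟦ Window 0 (n ℕ.∸ d) (toℕ m) ⟧ * fromℕ h)      ≤⟨ sum-mono {n} (λ m → below-row m (lem {P = Window 0 (n ℕ.∸ d) (toℕ m)})) ⟩
        total                                                     ∎
        where
        below-row : ∀ m → Dec (Window 0 (n ℕ.∸ d) (toℕ m)) → ⟦ Window 0 (n ℕ.∸ d) (toℕ m) ⟧ * fromℕ h ≤ row w m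
        below-row m (yes m∈) = ≤-reflexive (trans (trans (*-congʳ (⟦⟧-yes m∈)) (*-identityˡ _))
          (sym (row-≈ m (m<n∸o⇒m+o<n (proj₂ m∈)))))
        below-row m (no m∉) = ≤-respˡ-≈ (sym (trans (*-congʳ (⟦⟧-no m∉)) (zeroˡ _))) (0≤sum λ j → nonneg m j)

      -- Where row and column are both complete they cancel. This leaves the `d` indices at each
      -- end; an overlap of the two end windows only enlarges the bound.
      imbalance²-≤ : imbalance² ≤ fromℕ 2 * fromℕ d * (fromℕ h * fromℕ h)
      imbalance²-≤ = begin
        imbalance²
          ≤⟨ sum-mono near-edge ⟩
        sum (λ m → (first m + last m) * H²)
          ≈⟨ *-distribʳ-sum H² (λ m → first m + last m) ⟨
        sum (λ m → first m + last m) * H²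
          ≈⟨ *-congʳ (∑-distrib-+ first last) ⟩
        (count n 0 d + count n (n ℕ.∸ d) d) * H²
          ≤⟨ *-mono-≤ (0≤x+y (0≤sum {n} λ m → 0≤⟦⟧ (Window 0 d (toℕ m))) (0≤sum {n} λ m → 0≤⟦⟧ (Window (n ℕ.∸ d) d (toℕ m)))) (0≤x² (fromℕ h))
               (+-mono-≤ (count-≤ n 0 d) (count-≤ n (n ℕ.∸ d) d)) ≤-refl ⟩
        (fromℕ d + fromℕ d) * H²
          ≈⟨ solve 2 (λ d H → (d :+ d) :* H := con (pos 2) :* d :* H) refl (fromℕ d) H² ⟩
        fromℕ 2 * fromℕ d * H² ∎
        where
        H² = fromℕ h * fromℕ h
        first last : Fin n → R
        first m = ⟦ Window 0 d (toℕ m) ⟧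
        last m = ⟦ Window (n ℕ.∸ d) d (toℕ m) ⟧

        -- Row and column sum both lie between 0 and `h`, so both factors of the difference of
        -- squares `h² - (r - c)²` are nonnegative.
        bounded : ∀ m → imbalance w m * imbalance w m ≤ H²
        bounded m = ≤-by (0≤x*y (0≤x+y (x≤y⇒0≤y-x (row-≤ m)) 0≤col) (0≤x+y (x≤y⇒0≤y-x (col-≤ m)) 0≤row))
          (solve 3 (λ r c h → h :* h :- (r :- c) :* (r :- c) := (h :- r :+ c) :* (h :- c :+ r)) refl (row w m) (col w m) (fromℕ h))
          where
          0≤row : 0# ≤ row w m
          0≤row = 0≤sum λ j → nonneg m j
          0≤col : 0# ≤ col w m
          0≤col = 0≤sum λ i → nonneg i m

        at-edge : ∀ m → 1# ≤ first m + last m → imbalance w m * imbalance w m ≤ (first m + last m) * H²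
        at-edge m 1≤ = ≤-trans (bounded m)
          (≤-respˡ-≈ (*-identityˡ H²) (*-mono-≤ 0≤1 (0≤x² (fromℕ h)) 1≤ ≤-refl))

        near-edge : ∀ m → imbalance w m * imbalance w m ≤ (first m + last m) * H²
        near-edge m with d ℕₚ.≤? toℕ m | toℕ m ℕ.+ d ℕₚ.<? n
        ... | no d≰m  | _ = at-edge m (≤-trans (≤-reflexive (sym (⟦⟧-yes (ℕ.z≤n , ℕₚ.≰⇒> d≰m))))
                (≤-respˡ-≈ (+-identityʳ _) (+-monoʳ-≤ (first m) (0≤⟦⟧ _))))
        ... | yes _   | no m+d≮n = at-edge m (≤-trans (≤-reflexive (sym (⟦⟧-yes (in-last (ℕₚ.≮⇒≥ m+d≮n)))))
                (≤-respˡ-≈ (+-identityˡ _) (+-monoˡ-≤ (last m) (0≤⟦⟧ _))))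
          where
          in-last : n ℕ.≤ toℕ m ℕ.+ d → Window (n ℕ.∸ d) d (toℕ m)
          in-last n≤m+d = ℕₚ.m≤n+o⇒m∸n≤o n d (≡.subst (n ℕ.≤_) (ℕₚ.+-comm (toℕ m) d) n≤m+d) ,
            ℕₚ.<-≤-trans (Finₚ.toℕ<n m) (ℕₚ.≤-trans (ℕₚ.m≤n+m∸n n d) (ℕₚ.≤-reflexive (ℕₚ.+-comm d (n ℕ.∸ d))))
        ... | yes d≤m | yes m+d<n = ≤-respˡ-≈ (sym vanishes) (0≤x*y (0≤x+y (0≤⟦⟧ _) (0≤⟦⟧ _)) (0≤x² (fromℕ h)))
          where
          vanishes : imbalance w m * imbalance w m ≈ 0#
          vanishes = trans (*-congʳ (trans (+-cong (row-≈ m m+d<n) (-‿cong (col-≈ m d≤m))) (-‿inverseʳ _))) (zeroˡ _)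

    inv-weight des-weight : ℕ → Fin n → Fin n → R
    inv-weight d i j = ⟦ (toℕ i ℕ.< toℕ j × toℕ j ℕ.∸ toℕ i ℕ.≤ d) ⟧
    des-weight d i j = ⟦ toℕ j ≡ toℕ i ℕ.+ d ⟧

    ⟦⟧-supported : ∀ {P : Fin n → Fin n → Set} → (∀ {i j} → P i j → toℕ i ℕ.< toℕ j) → Supported (λ i j → ⟦ P i j ⟧)
    ⟦⟧-supported {P} above i j with toℕ i ℕₚ.<? toℕ j
    ... | yes i<j = inj₂ i<j
    ... | no i≮j  = inj₁ (⟦⟧-no λ p → i≮j (above p))

    -- Row `m` is the window of length `d` starting at `m + 1`, column `m` the window of length `d`
    -- ending before `m`. For `m < d` truncated subtraction starts the latter at 0 and makes it too
    -- long, so there the column is only contained in it.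
    inv-band : ∀ d → Band (inv-weight d) d d
    inv-band d = record
      { supported  = ⟦⟧-supported proj₁
      ; idempotent = λ i j → ⟦⟧-idem _
      ; nonneg     = λ i j → 0≤⟦⟧ _
      ; row-≤      = λ m → ≤-trans (≤-reflexive (row≈ m)) (count-≤ n (suc (toℕ m)) d)
      ; col-≤      = λ m → ≤-trans (sum-mono {n} λ i → ⟦⟧-mono (col⇒ m i)) (count-≤ n (toℕ m ℕ.∸ d) d)
      ; row-≈      = λ m fit → trans (row≈ m) (count-≈ n (suc (toℕ m)) d fit)
      ; col-≈      = λ m d≤m → trans (sum-cong-≋ {n} λ i → ⟦⟧-cong (col⇒ m i) (col⇐ m i d≤m))
                       (count-≈ n (toℕ m ℕ.∸ d) d (≡.subst (ℕ._≤ n) (≡.sym (ℕₚ.m∸n+n≡m d≤m)) (ℕₚ.<⇒≤ (Finₚ.toℕ<n m))))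
      }
      where
      row≈ : ∀ m → row (inv-weight d) m ≈ count n (suc (toℕ m)) d
      row≈ m = sum-cong-≋ {n} λ j → ⟦⟧-cong
        (λ (m<j , j∸m≤d) → m<j , ℕ.s≤s (m∸n≤o⇒m≤n+o (toℕ j) (toℕ m) j∸m≤d))
        (λ { (m<j , ℕ.s≤s j≤m+d) → m<j , ℕₚ.m≤n+o⇒m∸n≤o (toℕ j) (toℕ m) j≤m+d })
      col⇒ : ∀ (m i : Fin n) → toℕ i ℕ.< toℕ m × toℕ m ℕ.∸ toℕ i ℕ.≤ d → Window (toℕ m ℕ.∸ d) d (toℕ i)
      col⇒ m i (i<m , m∸i≤d) =
        ℕₚ.m≤n+o⇒m∸n≤o (toℕ m) d (≡.subst (toℕ m ℕ.≤_) (ℕₚ.+-comm (toℕ i) d) (m∸n≤o⇒m≤n+o (toℕ m) (toℕ i) m∸i≤d)) ,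
        ℕₚ.<-≤-trans i<m (≡.subst (toℕ m ℕ.≤_) (ℕₚ.+-comm d (toℕ m ℕ.∸ d)) (ℕₚ.m≤n+m∸n (toℕ m) d))
      col⇐ : ∀ (m i : Fin n) → d ℕ.≤ toℕ m → Window (toℕ m ℕ.∸ d) d (toℕ i) → toℕ i ℕ.< toℕ m × toℕ m ℕ.∸ toℕ i ℕ.≤ d
      col⇐ m i d≤m (m∸d≤i , i<) =
        ≡.subst (toℕ i ℕ.<_) (ℕₚ.m∸n+n≡m d≤m) i< ,
        ℕₚ.m≤n+o⇒m∸n≤o (toℕ m) (toℕ i) (≡.subst (toℕ m ℕ.≤_) (ℕₚ.+-comm d (toℕ i)) (m∸n≤o⇒m≤n+o (toℕ m) d m∸d≤i))

    des-band : ∀ d → 1 ℕ.≤ d → Band (des-weight d) d 1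
    des-band d 1≤d = record
      { supported  = ⟦⟧-supported λ { {i} j≡i+d → ℕₚ.<-≤-trans (ℕₚ.m<m+n (toℕ i) 1≤d) (ℕₚ.≤-reflexive (≡.sym j≡i+d)) }
      ; idempotent = λ i j → ⟦⟧-idem _
      ; nonneg     = λ i j → 0≤⟦⟧ _
      ; row-≤      = λ m → ≤-trans (≤-reflexive (row≈ m)) (count-≤ n (toℕ m ℕ.+ d) 1)
      ; col-≤      = λ m → ≤-trans (sum-mono {n} λ i → ⟦⟧-mono (col⇒ m i)) (count-≤ n (toℕ m ℕ.∸ d) 1)
      ; row-≈      = λ m fit → trans (row≈ m) (count-≈ n (toℕ m ℕ.+ d) 1 (≡.subst (ℕ._≤ n) (ℕₚ.+-comm 1 _) fit))
      ; col-≈      = λ m d≤m → trans (sum-cong-≋ {n} λ i → ⟦⟧-cong (col⇒ m i) (col⇐ m i d≤m))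
                       (count-≈ n (toℕ m ℕ.∸ d) 1 (ℕₚ.≤-trans (ℕₚ.+-monoʳ-≤ (toℕ m ℕ.∸ d) 1≤d)
                         (≡.subst (ℕ._≤ n) (≡.sym (ℕₚ.m∸n+n≡m d≤m)) (ℕₚ.<⇒≤ (Finₚ.toℕ<n m)))))
      }
      where
      singleton : ∀ {a b} → a ≡ b → Window b 1 a
      singleton {a} ≡.refl = ℕₚ.≤-refl , ℕₚ.m<m+n a (ℕ.s≤s ℕ.z≤n)
      singleton⁻¹ : ∀ {a b} → Window b 1 a → a ≡ b
      singleton⁻¹ {a} {b} (b≤a , a<b+1) = ℕₚ.≤-antisym (ℕ.s≤s⁻¹ (≡.subst (a ℕ.<_) (ℕₚ.+-comm b 1) a<b+1)) b≤a
      row≈ : ∀ m → row (des-weight d) m ≈ count n (toℕ m ℕ.+ d) 1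
      row≈ m = sum-cong-≋ {n} λ j → ⟦⟧-cong singleton singleton⁻¹
      col⇒ : ∀ (m i : Fin n) → toℕ m ≡ toℕ i ℕ.+ d → Window (toℕ m ℕ.∸ d) 1 (toℕ i)
      col⇒ m i m≡i+d = singleton (≡.trans (≡.sym (ℕₚ.m+n∸n≡m (toℕ i) d)) (≡.cong (ℕ._∸ d) (≡.sym m≡i+d)))
      col⇐ : ∀ (m i : Fin n) → d ℕ.≤ toℕ m → Window (toℕ m ℕ.∸ d) 1 (toℕ i) → toℕ m ≡ toℕ i ℕ.+ d
      col⇐ m i d≤m i∈ = ≡.trans (≡.sym (ℕₚ.m∸n+n≡m d≤m)) (≡.cong (ℕ._+ d) (≡.sym (singleton⁻¹ i∈)))

  -- The covariance formula

  sum-single : ∀ {n} (f : Fin n → R) i → (∀ k → k ≢ i → f k ≈ 0#) → sum f ≈ f i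
  sum-single {suc n} f zero vanishes = trans
    (+-congˡ (trans (sum-cong-≋ {n} λ k → vanishes (suc k) λ ()) (sum-replicate-zero n))) (+-identityʳ _)
  sum-single {suc n} f (suc i) vanishes = trans
    (+-cong (vanishes zero λ ()) (sum-single (λ k → f (suc k)) i λ k k≢i → vanishes (suc k) λ { ≡.refl → k≢i ≡.refl }))
    (+-identityˡ _)

  module Covariance {n} (S : UniformSample n) where
    open UniformSample S
    open Measure space
    open Sample S
    open Weights n

    twelfth : R
    twelfth = fromℕ 12 ⁻¹

    12*[twelfth*x]≈x : ∀ x → fromℕ 12 * (twelfth * x) ≈ x
    12*[twelfth*x]≈x x = trans (*-congˡ (*-comm twelfth x)) (x*[y/x]≈y (0<fromℕ {12} (ℕ.s≤s ℕ.z≤n)) x)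

    2*half≈1 : fromℕ 2 * half 1# ≈ 1#
    2*half≈1 = x*[y/x]≈y 0<2 1#

    ℙ-Inversion : ∀ {i j} → i ≢ j → ℙ (Inversion i j) ≈ half 1#
    ℙ-Inversion i≢j = *-cancelˡ-≈ 0<2 (trans (ℙ-pair <-comparison i≢j) (sym 2*half≈1))

    centred : Fin n → Fin n → Ω → R
    centred i j ω = 𝟙 (Inversion i j) ω - half 1#

    toℕ-<⇒≢ : ∀ {i j : Fin n} → toℕ i ℕ.< toℕ j → i ≢ j
    toℕ-<⇒≢ i<j ≡.refl = ℕₚ.<-irrefl ≡.refl i<j

    -- Expanding the product gives `p - 1/4`, to which `ℙ-two-inversions` applies; increasing pairs
    -- cannot be opposite to each other.
    IsExpectation-centred² : ∀ {i j k l} → toℕ i ℕ.< toℕ j → toℕ k ℕ.< toℕ l →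
      IsExpectation (λ ω → centred i j ω * centred k l ω) (twelfth * shared i j k l)
    IsExpectation-centred² {i} {j} {k} {l} i<j k<l = IsExpectation-cong pointwise value
      (IsExpectation-+ (IsExpectation-𝟙 (Event-∩ (Event-Inversion i j) (Event-Inversion k l)))
        (IsExpectation-+ (IsExpectation-scale (- h) (IsExpectation-𝟙 (Event-Inversion i j)))
          (IsExpectation-+ (IsExpectation-scale (- h) (IsExpectation-𝟙 (Event-Inversion k l)))
            (IsExpectation-const (h * h)))))
      where
      h = half 1#
      pointwise : ∀ ω → 𝟙 (Inversion i j ∩ Inversion k l) ω + (- h * 𝟙 (Inversion i j) ω + (- h * 𝟙 (Inversion k l) ω + h * h))
                      ≈ centred i j ω * centred k l ω
      pointwise ω = trans (+-congʳ (sym (𝟙-∩ (Inversion i j) (Inversion k l) ω)))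
        (solve 3 (λ a b h → a :* b :+ (:- h :* a :+ (:- h :* b :+ h :* h)) := (a :- h) :* (b :- h))
          refl (𝟙 (Inversion i j) ω) (𝟙 (Inversion k l) ω) h)
      p = ℙ (Inversion i j ∩ Inversion k l)
      value : p + (- h * ℙ (Inversion i j) + (- h * ℙ (Inversion k l) + h * h)) ≈ twelfth * shared i j k l
      value = *-cancelˡ-≈ (0<fromℕ {12} (ℕ.s≤s ℕ.z≤n)) (begin-equality
        fromℕ 12 * (p + (- h * ℙ (Inversion i j) + (- h * ℙ (Inversion k l) + h * h)))
          ≈⟨ *-congˡ (+-congˡ (+-cong (*-congˡ (ℙ-Inversion (toℕ-<⇒≢ i<j))) (+-congʳ (*-congˡ (ℙ-Inversion (toℕ-<⇒≢ k<l)))))) ⟩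
        fromℕ 12 * (p + (- h * h + (- h * h + h * h)))
          ≈⟨ solve 2 (λ p h → con (pos 12) :* (p :+ (:- h :* h :+ (:- h :* h :+ h :* h)))
                            := con (pos 12) :* p :- con (pos 3) :* ((con (pos 2) :* h) :* (con (pos 2) :* h))) refl p h ⟩
        fromℕ 12 * p - fromℕ 3 * ((fromℕ 2 * h) * (fromℕ 2 * h))
          ≈⟨ +-cong (ℙ-two-inversions (toℕ-<⇒≢ i<j) (toℕ-<⇒≢ k<l) not-reversed) (-‿cong (*-congˡ (*-cong 2*half≈1 2*half≈1))) ⟩
        fromℕ 3 + shared i j k l - fromℕ 3 * (1# * 1#)
          ≈⟨ solve 1 (λ s → con (pos 3) :+ s :- con (pos 3) :* (:1 :* :1) := s) refl (shared i j k l) ⟩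
        shared i j k l
          ≈⟨ 12*[twelfth*x]≈x (shared i j k l) ⟨
        fromℕ 12 * (twelfth * shared i j k l) ∎)
        where
        not-reversed : ¬ (i ≡ l × j ≡ k)
        not-reversed (≡.refl , ≡.refl) = ℕₚ.<-asym i<j k<l

    -- With weight zero `e` is arbitrary, so formulas valid only for `i < j` may be summed over all
    -- index pairs.
    IsExpectation-weighted : ∀ {X e} w → w ≈ 0# ⊎ IsExpectation X e → IsExpectation (λ ω → w * X ω) (w * e)
    IsExpectation-weighted w (inj₁ w≈0) = IsExpectation-cong
      (λ _ → sym (trans (*-congʳ w≈0) (zeroˡ _))) (sym (trans (*-congʳ w≈0) (zeroˡ _))) IsExpectation-0
    IsExpectation-weighted w (inj₂ X-e) = IsExpectation-scale w X-e

    IsExpectation-∑∑ : ∀ (w : Fin n → Fin n → R) {X : Fin n → Fin n → Ω → R} {e : Fin n → Fin n → R} → Supported w →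
      (∀ {i j} → toℕ i ℕ.< toℕ j → IsExpectation (X i j) (e i j)) →
      IsExpectation (λ ω → ∑∑ (λ i j → w i j * X i j ω)) (∑∑ (λ i j → w i j * e i j))
    IsExpectation-∑∑ w supported X-e = IsExpectation-sum {n} λ i → IsExpectation-sum {n} λ j →
      IsExpectation-weighted (w i j) ([ inj₁ , (λ i<j → inj₂ (X-e i<j)) ]′ (supported i j))

    statistic : (Fin n → Fin n → R) → Ω → R
    statistic w ω = ∑∑ λ i j → w i j * 𝟙 (Inversion i j) ω

    mean : (Fin n → Fin n → R) → R
    mean w = ∑∑ λ i j → w i j * half 1#

    IsExpectation-statistic : ∀ w → Supported w → IsExpectation (statistic w) (mean w)
    IsExpectation-statistic w supported = IsExpectation-∑∑ w supported λ {i} {j} i<j →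
      IsExpectation-cong (λ _ → refl) (ℙ-Inversion (toℕ-<⇒≢ i<j)) (IsExpectation-𝟙 (Event-Inversion i j))

    statistic-mean : ∀ w ω → statistic w ω - mean w ≈ ∑∑ (λ i j → w i j * centred i j ω)
    statistic-mean w ω = trans
      (sym (∑∑-+ {n} {n} {λ i j → w i j * 𝟙 (Inversion i j) ω} {λ i j → - (w i j * half 1#)} refl
        (∑∑-neg {n} {n} {λ i j → w i j * half 1#} refl)))
      (∑∑-cong {n} {n} λ i j → solve 3 (λ w a h → w :* a :+ :- (w :* h) := w :* (a :- h)) refl (w i j) (𝟙 (Inversion i j) ω) (half 1#))

    -- A delta in the first index leaves a row sum, one in the second a column sum, and the product
    -- of two a single entry.
    ∑∑-shared : ∀ v i j → ∑∑ (λ k l → v k l * shared i j k l) ≈ imbalance v i - imbalance v j + v i j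
    ∑∑-shared v i j = begin-equality
      ∑∑ (λ k l → v k l * shared i j k l)
        ≈⟨ ∑∑-cong {n} {n} (λ k l → solve 5 (λ v a b c d → v :* (a :- b :- c :+ d :+ a :* d)
                                    := v :* a :+ :- (v :* b) :+ :- (v :* c) :+ v :* d :+ v :* a :* d)
             refl (v k l) (δ i k) (δ i l) (δ j k) (δ j l)) ⟩
      ∑∑ (λ k l → v k l * δ i k + - (v k l * δ i l) + - (v k l * δ j k) + v k l * δ j l + v k l * δ i k * δ j l)
        ≈⟨ ∑∑-+ {n} {n} (∑∑-+ {n} {n} (∑∑-+ {n} {n} (∑∑-+ {n} {n} (rows i) (∑∑-neg {n} {n} (cols i))) (∑∑-neg {n} {n} (rows j))) (cols j)) entry ⟩
      row v i + - col v i + - row v j + col v j + v i j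
        ≈⟨ solve 5 (λ r c r′ c′ v → r :+ :- c :+ :- r′ :+ c′ :+ v := (r :- c) :- (r′ :- c′) :+ v)
             refl (row v i) (col v i) (row v j) (col v j) (v i j) ⟩
      imbalance v i - imbalance v j + v i j ∎
      where
      pick : ∀ (f : Fin n → R) i → sum (λ k → f k * δ i k) ≈ f i
      pick f i = trans
        (sum-single (λ k → f k * δ i k) i λ k k≢i → trans (*-congˡ (δ-≢ λ i≡k → k≢i (≡.sym i≡k))) (zeroʳ _))
        (trans (*-congˡ (δ-≡ {i} ≡.refl)) (*-identityʳ _))
      rows : ∀ i → ∑∑ (λ k l → v k l * δ i k) ≈ row v i
      rows i = trans (sum-cong-≋ {n} λ k → sym (*-distribʳ-sum (δ i k) (v k))) (pick (row v) i)
      cols : ∀ i → ∑∑ (λ k l → v k l * δ i l) ≈ col v i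
      cols i = sum-cong-≋ {n} λ k → pick (v k) i
      entry : ∑∑ (λ k l → v k l * δ i k * δ j l) ≈ v i j
      entry = trans (sum-cong-≋ {n} λ k → pick (λ l → v k l * δ i k) j) (pick (λ k → v k j) i)

    -- A summation by parts: collecting the `A i` by rows and the `A j` by columns moves the
    -- difference onto `w`, as its imbalance.
    ∑∑-form : ∀ w v → ∑∑ (λ i j → w i j * (imbalance v i - imbalance v j + v i j)) ≈ form w v
    ∑∑-form w v = begin-equality
      ∑∑ (λ i j → w i j * (A i - A j + v i j))
        ≈⟨ ∑∑-cong {n} {n} (λ i j → solve 4 (λ w a b v → w :* (a :- b :+ v) := w :* a :+ :- (w :* b) :+ w :* v) refl (w i j) (A i) (A j) (v i j)) ⟩
      ∑∑ (λ i j → w i j * A i + - (w i j * A j) + w i j * v i j)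
        ≈⟨ ∑∑-+ {n} {n} (∑∑-+ {n} {n} rows (∑∑-neg {n} {n} cols)) refl ⟩
      sum (λ i → row w i * A i) + - sum (λ j → col w j * A j) + ∑∑ (λ i j → w i j * v i j)
        ≈⟨ +-congʳ (trans (+-congˡ (sym (sum-neg (λ j → col w j * A j))))
                          (sym (∑-distrib-+ (λ i → row w i * A i) (λ j → - (col w j * A j))))) ⟩
      sum (λ m → row w m * A m + - (col w m * A m)) + ∑∑ (λ i j → w i j * v i j)
        ≈⟨ +-congʳ (sum-cong-≋ {n} λ m → solve 3 (λ r c a → r :* a :+ :- (c :* a) := (r :- c) :* a) refl (row w m) (col w m) (A m)) ⟩
      form w v ∎
      where
      A = imbalance v
      rows : ∑∑ (λ i j → w i j * A i) ≈ sum (λ i → row w i * A i)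
      rows = sum-cong-≋ {n} λ i → sym (*-distribʳ-sum (A i) (w i))
      cols : ∑∑ (λ i j → w i j * A j) ≈ sum (λ j → col w j * A j)
      cols = trans (∑-comm {n} {n} λ i j → w i j * A j) (sum-cong-≋ {n} λ j → sym (*-distribʳ-sum (A j) λ i → w i j))

    IsExpectation-covariance : ∀ {w v} → Supported w → Supported v →
      IsExpectation (λ ω → (statistic w ω - mean w) * (statistic v ω - mean v)) (twelfth * form w v)
    IsExpectation-covariance {w} {v} w-supported v-supported = IsExpectation-cong pointwise value
      (IsExpectation-∑∑ w w-supported λ i<j → IsExpectation-∑∑ v v-supported λ k<l → IsExpectation-centred² i<j k<l)
      where
      pointwise : ∀ ω → ∑∑ (λ i j → w i j * ∑∑ (λ k l → v k l * (centred i j ω * centred k l ω)))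
                      ≈ (statistic w ω - mean w) * (statistic v ω - mean v)
      pointwise ω = begin-equality
        ∑∑ (λ i j → w i j * ∑∑ (λ k l → v k l * (centred i j ω * centred k l ω)))
          ≈⟨ ∑∑-cong {n} {n} (λ i j → trans
               (*-congˡ (trans (∑∑-cong {n} {n} λ k l → solve 3 (λ v a b → v :* (a :* b) := a :* (v :* b)) refl (v k l) (centred i j ω) (centred k l ω))
                               (∑∑-scale (centred i j ω) (λ k l → v k l * centred k l ω))))
               (solve 3 (λ w c V → w :* (c :* V) := V :* (w :* c)) refl (w i j) (centred i j ω) V)) ⟩
        ∑∑ (λ i j → V * (w i j * centred i j ω))
          ≈⟨ ∑∑-scale V (λ i j → w i j * centred i j ω) ⟩
        V * ∑∑ (λ i j → w i j * centred i j ω)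
          ≈⟨ *-comm _ _ ⟩
        ∑∑ (λ i j → w i j * centred i j ω) * V
          ≈⟨ *-cong (statistic-mean w ω) (statistic-mean v ω) ⟨
        (statistic w ω - mean w) * (statistic v ω - mean v) ∎
        where V = ∑∑ λ k l → v k l * centred k l ω
      value : ∑∑ (λ i j → w i j * ∑∑ (λ k l → v k l * (twelfth * shared i j k l))) ≈ twelfth * form w v
      value = begin-equality
        ∑∑ (λ i j → w i j * ∑∑ (λ k l → v k l * (twelfth * shared i j k l)))
          ≈⟨ ∑∑-cong {n} {n} (λ i j → trans
               (*-congˡ (trans (∑∑-cong {n} {n} λ k l → solve 3 (λ v t s → v :* (t :* s) := t :* (v :* s)) refl (v k l) twelfth (shared i j k l))
                               (trans (∑∑-scale twelfth (λ k l → v k l * shared i j k l)) (*-congˡ (∑∑-shared v i j)))))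
               (solve 3 (λ w t s → w :* (t :* s) := t :* (w :* s)) refl (w i j) twelfth (imbalance v i - imbalance v j + v i j))) ⟩
        ∑∑ (λ i j → twelfth * (w i j * (imbalance v i - imbalance v j + v i j)))
          ≈⟨ ∑∑-scale twelfth (λ i j → w i j * (imbalance v i - imbalance v j + v i j)) ⟩
        twelfth * ∑∑ (λ i j → w i j * (imbalance v i - imbalance v j + v i j))
          ≈⟨ *-congˡ (∑∑-form w v) ⟩
        twelfth * form w v ∎

    12*Cov≈form : ∀ {X Y w v} → Supported w → Supported v →
                  (∀ ω → X ω ≈ statistic w ω) → (∀ ω → Y ω ≈ statistic v ω) →
                  fromℕ 12 * Cov X Y ≈ form w v
    12*Cov≈form {X} {Y} {w} {v} w-supported v-supported X≈ Y≈ = trans (*-congˡ (𝔼≈ covariance)) (12*[twelfth*x]≈x (form w v))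
      where
      𝔼X : 𝔼 X ≈ mean w
      𝔼X = 𝔼≈ (IsExpectation-cong (λ ω → sym (X≈ ω)) refl (IsExpectation-statistic w w-supported))
      𝔼Y : 𝔼 Y ≈ mean v
      𝔼Y = 𝔼≈ (IsExpectation-cong (λ ω → sym (Y≈ ω)) refl (IsExpectation-statistic v v-supported))
      covariance : IsExpectation (λ ω → (X ω - 𝔼 X) * (Y ω - 𝔼 Y)) (twelfth * form w v)
      covariance = IsExpectation-cong
        (λ ω → *-cong (+-cong (sym (X≈ ω)) (-‿cong (sym 𝔼X))) (+-cong (sym (Y≈ ω)) (-‿cong (sym 𝔼Y))))
        refl (IsExpectation-covariance w-supported v-supported)

    𝟙-× : ∀ {P : Set} {A B : Pred Ω 0ℓ} {ω} → (A ω → P × B ω) → (P × B ω → A ω) → 𝟙 A ω ≈ ⟦ P ⟧ * 𝟙 B ω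
    𝟙-× {P} {A} {B} {ω} to from = cases (lem {P = P}) (lem {P = B ω})
      where
      cases : Dec P → Dec (B ω) → 𝟙 A ω ≈ ⟦ P ⟧ * 𝟙 B ω
      cases (yes p) (yes b) = trans (𝟙-yes {A} (from (p , b)))
        (sym (trans (*-cong (⟦⟧-yes p) (𝟙-yes {B} b)) (*-identityˡ 1#)))
      cases (no ¬p) _       = trans (𝟙-no {A} λ a → ¬p (proj₁ (to a))) (sym (trans (*-congʳ (⟦⟧-no ¬p)) (zeroˡ _)))
      cases (yes _) (no ¬b) = trans (𝟙-no {A} λ a → ¬b (proj₂ (to a))) (sym (trans (*-congˡ (𝟙-no {B} ¬b)) (zeroʳ _)))

    Xinv≈statistic : ∀ d ω → Xinv d ω ≈ statistic (inv-weight d) ω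
    Xinv≈statistic d ω = ∑∑-cong {n} {n} λ i j → 𝟙-× {B = Inversion i j}
      (λ (i<j , j∸i≤d , Zj<Zi) → (i<j , j∸i≤d) , Zj<Zi) (λ ((i<j , j∸i≤d) , Zj<Zi) → i<j , j∸i≤d , Zj<Zi)

    Xdes≈statistic : ∀ d ω → Xdes d ω ≈ statistic (des-weight d) ω
    Xdes≈statistic d ω = ∑∑-cong {n} {n} λ i j → 𝟙-× {B = Inversion i j} (λ x → x) (λ x → x)

  -- Bounds on the correlation coefficient

  -- The factors 12 cancel in the correlation. Squaring removes the root from the estimates, and the
  -- second component retains the sign that squaring loses.
  corr-square : ∀ {C A B P V W} → fromℕ 12 * C ≈ P → fromℕ 12 * A ≈ V → fromℕ 12 * B ≈ W → 0# < V * W →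
                (C / √ (A * B)) * (C / √ (A * B)) * (V * W) ≈ P * P × (0# ≤ P → 0# ≤ C / √ (A * B))
  corr-square {C} {A} {B} {P} {V} {W} 12C≈P 12A≈V 12B≈W 0<VW =
    (begin-equality
      c * c * (V * W)
        ≈⟨ *-congˡ 144AB ⟨
      c * c * (fromℕ 144 * (A * B))
        ≈⟨ *-congˡ (*-congˡ r²≈) ⟨
      c * c * (fromℕ 144 * (r * r))
        ≈⟨ solve 2 (λ c r → c :* c :* (con (pos 144) :* (r :* r)) := con (pos 12) :* (r :* c) :* (con (pos 12) :* (r :* c))) refl c r ⟩
      fromℕ 12 * (r * c) * (fromℕ 12 * (r * c))
        ≈⟨ *-cong 12rc 12rc ⟩
      P * P ∎) ,
    λ 0≤P → 0≤x*y (*-cancelˡ-≤ 0<12 (≤-respˡ-≈ (sym (zeroʳ _)) (≤-respʳ-≈ (sym 12C≈P) 0≤P))) (<⇒≤ (0<x⁻¹ 0<r))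
    where
    r = √ (A * B)
    c = C / r
    0<12 : 0# < fromℕ 12
    0<12 = 0<fromℕ {12} (ℕ.s≤s ℕ.z≤n)
    144AB : fromℕ 144 * (A * B) ≈ V * W
    144AB = trans (solve 2 (λ a b → con (pos 144) :* (a :* b) := con (pos 12) :* a :* (con (pos 12) :* b)) refl A B)
      (*-cong 12A≈V 12B≈W)
    0<AB : 0# < A * B
    0<AB = *-cancelˡ-< (0≤fromℕ 144) (<-respˡ-≈ (sym (zeroʳ _)) (<-respʳ-≈ (sym 144AB) 0<VW))
    r-spec = root-spec 1 (<⇒≤ 0<AB)
    r²≈ : r * r ≈ A * B
    r²≈ = trans (*-congˡ (sym (*-identityʳ r))) (proj₂ r-spec)
    0<r : 0# < r
    0<r = *-cancelˡ-< (proj₁ r-spec) (<-respˡ-≈ (sym (zeroʳ _)) (<-respʳ-≈ (sym r²≈) 0<AB))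
    12rc : fromℕ 12 * (r * c) ≈ P
    12rc = trans (*-congˡ (x*[y/x]≈y 0<r C)) 12C≈P

  -- `(γ + κ)² ≤ 2 (γ² + κ²) ≤ 2 η M (β + N)`, and `M` is at most `α + M`. Only `α` is compared with
  -- its partner; `β` may exceed `N`.
  square-small : ∀ {c α β γ κ M N η} → 0# ≤ η → 0# ≤ α → 0# ≤ β → 0# < M → 0# < N →
                 c * c * ((α + M) * (β + N)) ≈ (γ + κ) * (γ + κ) → γ * γ ≤ α * β →
                 α ≤ η * M → κ * κ ≤ η * M * N → c * c ≤ fromℕ 2 * η
  square-small {c} {α} {β} {γ} {κ} {M} {N} {η} 0≤η 0≤α 0≤β 0<M 0<N c² γ²≤αβ α≤ηM κ²≤ηMN =
    *-cancelˡ-≤ (*-pos (0<+ 0≤α 0<M) (0<+ 0≤β 0<N)) (begin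
      (α + M) * (β + N) * (c * c)
        ≈⟨ trans (*-comm _ _) c² ⟩
      (γ + κ) * (γ + κ)
        ≤⟨ ≤-by (0≤x² (γ - κ)) (solve 2 (λ g k → con (pos 2) :* (g :* g :+ k :* k) :- (g :+ k) :* (g :+ k) := (g :- k) :* (g :- k)) refl γ κ) ⟩
      fromℕ 2 * (γ * γ + κ * κ)
        ≤⟨ *-monoˡ-≤ (0≤fromℕ 2) (+-mono-≤ (≤-trans γ²≤αβ (*-mono-≤ 0≤α 0≤β α≤ηM ≤-refl)) κ²≤ηMN) ⟩
      fromℕ 2 * (η * M * β + η * M * N)
        ≤⟨ ≤-by (0≤x*y (0≤x*y (0≤x*y (0≤fromℕ 2) 0≤η) 0≤α) (<⇒≤ (0<+ 0≤β 0<N)))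
             (solve 5 (λ a b M N e → (a :+ M) :* (b :+ N) :* (con (pos 2) :* e) :- con (pos 2) :* (e :* M :* b :+ e :* M :* N)
                                  := con (pos 2) :* e :* a :* (b :+ N)) refl α β M N η) ⟩
      (α + M) * (β + N) * (fromℕ 2 * η) ∎)
    where
    0<+ : ∀ {x y} → 0# ≤ x → 0# < y → 0# < x + y
    0<+ 0≤x 0<y = <-respʳ-≈ (+-comm _ _) (0<x+y 0<y 0≤x)

  ∣x*y∣≤ : ∀ {x y a b} → ∣ x ∣ ≤ a → ∣ y ∣ ≤ b → ∣ x * y ∣ ≤ a * b
  ∣x*y∣≤ {x} {y} ∣x∣≤a ∣y∣≤b = ≤-respˡ-≈ (sym (∣x*y∣≈∣x∣*∣y∣ x y)) (*-mono-≤ (0≤∣x∣ x) (0≤∣x∣ y) ∣x∣≤a ∣y∣≤b)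

  ∣x+y∣≤ : ∀ {x y a b} → ∣ x ∣ ≤ a → ∣ y ∣ ≤ b → ∣ x + y ∣ ≤ a + b
  ∣x+y∣≤ {x} {y} ∣x∣≤a ∣y∣≤b = ≤-trans (∣x+y∣≤∣x∣+∣y∣ x y) (+-mono-≤ ∣x∣≤a ∣y∣≤b)

  ∣x-y∣≤ : ∀ {x y a b} → ∣ x ∣ ≤ a → ∣ y ∣ ≤ b → ∣ x - y ∣ ≤ a + b
  ∣x-y∣≤ {x} {y} ∣x∣≤a ∣y∣≤b = ∣x+y∣≤ ∣x∣≤a (≤-respˡ-≈ (sym (∣∣-neg y)) ∣y∣≤b)

  -- With P ≈ n, V ≈ d n and W ≈ n up to L, the square c² = P²/(V W) is 1/d up to O(1/n).
  near-inverse-root : ∀ {c P V W n d r L} → 0# ≤ c → c * c * (V * W) ≈ P * P →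
                      ∣ P - n ∣ ≤ L → ∣ V - d * n ∣ ≤ L → ∣ W - n ∣ ≤ L →
                      1# ≤ d → d ≤ L → fromℕ 2 * L ≤ n → 0# ≤ r → r * r ≈ d →
                      ∣ c - 1# / r ∣ * n ≤ fromℕ 24 * (L * L)
  near-inverse-root {c} {P} {V} {W} {n} {d} {r} {L} 0≤c c² P≈ V≈ W≈ 1≤d d≤L 2L≤n 0≤r r²≈d = begin
    ∣ c - s ∣ * n
      ≤⟨ *-mono-≤ (0≤∣x∣ _) 0≤n ∣c-s∣≤ ≤-refl ⟩
    ∣ d * (c * c) - 1# ∣ * n
      ≤⟨ *-cancelˡ-≤ 0<n (begin
           n * (∣ d * (c * c) - 1# ∣ * n)
             ≈⟨ solve 2 (λ n x → n :* (x :* n) := x :* (n :* n)) refl n _ ⟩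
           ∣ d * (c * c) - 1# ∣ * (n * n)
             ≤⟨ *-monoˡ-≤ (0≤∣x∣ _) n²≤4VW ⟩
           ∣ d * (c * c) - 1# ∣ * (fromℕ 4 * (V * W))
             ≈⟨ solve 2 (λ x y → x :* (con (pos 4) :* y) := con (pos 4) :* (x :* y)) refl _ (V * W) ⟩
           fromℕ 4 * (∣ d * (c * c) - 1# ∣ * (V * W))
             ≈⟨ *-congˡ (trans (*-congˡ (sym (0≤x⇒∣x∣≈x 0≤VW))) (sym (∣x*y∣≈∣x∣*∣y∣ _ _))) ⟩
           fromℕ 4 * ∣ (d * (c * c) - 1#) * (V * W) ∣
             ≈⟨ *-congˡ (∣∣-cong difference) ⟩
           fromℕ 4 * ∣ T ∣
             ≤⟨ *-monoˡ-≤ (0≤fromℕ 4) ∣T∣≤ ⟩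
           fromℕ 4 * (fromℕ 6 * B)
             ≈⟨ solve 2 (λ L n → con (pos 4) :* (con (pos 6) :* (L :* L :* n)) := n :* (con (pos 24) :* (L :* L))) refl L n ⟩
           n * (fromℕ 24 * (L * L)) ∎) ⟩
    fromℕ 24 * (L * L) ∎
    where
    s = 1# / r
    1≤L : 1# ≤ L
    1≤L = ≤-trans 1≤d d≤L
    0≤L : 0# ≤ L
    0≤L = ≤-trans 0≤1 1≤L
    L≤n : L ≤ n
    L≤n = ≤-trans (≤-by 0≤L (solve 1 (λ L → con (pos 2) :* L :- L := L) refl L)) 2L≤n
    1≤n : 1# ≤ n
    1≤n = ≤-trans 1≤L L≤n
    0<n : 0# < n
    0<n = <-≤-trans 0<1 1≤n
    0≤n = <⇒≤ 0<n
    0≤d = ≤-trans 0≤1 1≤d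

    p = P - n
    v = V - d * n
    w = W - n
    B = L * L * n
    -- This is `d P² - V W` after the main terms `d n²` have cancelled. Each of the six terms is at
    -- most `B`; with `n² ≤ 4 V W` this accounts for the constant 24.
    T = (p * d * n + p * d * n) + p * d * p - (w * d * n + v * n + v * w)
    ∣d∣≤L : ∣ d ∣ ≤ L
    ∣d∣≤L = ≤-respˡ-≈ (sym (0≤x⇒∣x∣≈x 0≤d)) d≤L
    ∣n∣≤n : ∣ n ∣ ≤ n
    ∣n∣≤n = ≤-reflexive (0≤x⇒∣x∣≈x 0≤n)
    ≤B : ∀ {x a} → 0# ≤ a → ∣ x ∣ ≤ L * a → a ≤ L * n → ∣ x ∣ ≤ B
    ≤B 0≤a x≤ a≤ = ≤-trans x≤ (≤-respʳ-≈ (sym (*-assoc L L n)) (*-monoˡ-≤ 0≤L a≤))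
    ∣pdn∣≤ : ∀ {x} → ∣ x ∣ ≤ L → ∣ x * d * n ∣ ≤ B
    ∣pdn∣≤ x≤ = ∣x*y∣≤ (∣x*y∣≤ x≤ ∣d∣≤L) ∣n∣≤n
    n≤Ln : n ≤ L * n
    n≤Ln = ≤-respˡ-≈ (*-identityˡ n) (*-mono-≤ 0≤1 0≤n 1≤L ≤-refl)
    ∣T∣≤ : ∣ T ∣ ≤ fromℕ 6 * B
    ∣T∣≤ = ≤-trans
      (∣x-y∣≤ (∣x+y∣≤ (∣x+y∣≤ (∣pdn∣≤ P≈) (∣pdn∣≤ P≈)) (≤-trans (∣x*y∣≤ (∣x*y∣≤ P≈ ∣d∣≤L) P≈) (*-monoˡ-≤ (0≤x² L) L≤n)))
              (∣x+y∣≤ (∣x+y∣≤ (∣pdn∣≤ W≈) (≤B 0≤n (∣x*y∣≤ V≈ ∣n∣≤n) n≤Ln))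
                      (≤B 0≤L (∣x*y∣≤ V≈ W≈) (≤-trans L≤n n≤Ln))))
      (≤-reflexive (solve 1 (λ B → B :+ B :+ B :+ (B :+ B :+ B) := con (pos 6) :* B) refl B))

    difference : (d * (c * c) - 1#) * (V * W) ≈ T
    difference = begin-equality
      (d * (c * c) - 1#) * (V * W)
        ≈⟨ solve 3 (λ d c y → (d :* c :- :1) :* y := d :* (c :* y) :- y) refl d (c * c) (V * W) ⟩
      d * (c * c * (V * W)) - V * W
        ≈⟨ +-congʳ (*-congˡ c²) ⟩
      d * (P * P) - V * W
        ≈⟨ solve 5 (λ d P V W n →
             d :* (P :* P) :- V :* W
             := ((P :- n) :* d :* n :+ (P :- n) :* d :* n) :+ (P :- n) :* d :* (P :- n)
                :- ((W :- n) :* d :* n :+ (V :- d :* n) :* n :+ (V :- d :* n) :* (W :- n)))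
             refl d P V W n ⟩
      T ∎

    n≤2V : n ≤ fromℕ 2 * V
    n≤2V = begin
      n                        ≤⟨ ≤-by (x≤y⇒0≤y-x 2L≤n) (solve 2 (λ n L → con (pos 2) :* (n :- L) :- n := n :- con (pos 2) :* L) refl n L) ⟩
      fromℕ 2 * (n - L)        ≤⟨ *-monoˡ-≤ (0≤fromℕ 2) (≤-by (0≤x+y (0≤x*y (x≤y⇒0≤y-x 1≤d) 0≤n) (x≤y⇒0≤y-x (≤-trans (-x≤∣x∣ v) V≈)))
                                    (solve 4 (λ n L d V → V :- (n :- L) := (d :- :1) :* n :+ (L :- :- (V :- d :* n))) refl n L d V)) ⟩
      fromℕ 2 * V              ∎
    n≤2W : n ≤ fromℕ 2 * W
    n≤2W = begin
      n                        ≤⟨ ≤-by (x≤y⇒0≤y-x 2L≤n) (solve 2 (λ n L → con (pos 2) :* (n :- L) :- n := n :- con (pos 2) :* L) refl n L) ⟩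
      fromℕ 2 * (n - L)        ≤⟨ *-monoˡ-≤ (0≤fromℕ 2) (≤-by (x≤y⇒0≤y-x (≤-trans (-x≤∣x∣ w) W≈))
                                    (solve 3 (λ n L W → W :- (n :- L) := L :- :- (W :- n)) refl n L W)) ⟩
      fromℕ 2 * W              ∎
    n²≤4VW : n * n ≤ fromℕ 4 * (V * W)
    n²≤4VW = ≤-trans (*-mono-≤ 0≤n 0≤n n≤2V n≤2W)
      (≤-reflexive (solve 2 (λ V W → con (pos 2) :* V :* (con (pos 2) :* W) := con (pos 4) :* (V :* W)) refl V W))
    0≤VW : 0# ≤ V * W
    0≤VW = *-cancelˡ-≤ (0<fromℕ {4} (ℕ.s≤s ℕ.z≤n)) (≤-respˡ-≈ (sym (zeroʳ _)) (≤-trans (0≤x² n) n²≤4VW))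

    1≤r : 1# ≤ r
    1≤r = square-cancel-≤ 0≤r (≤-respˡ-≈ (sym (*-identityˡ 1#)) (≤-respʳ-≈ (sym r²≈d) 1≤d))
    0<r = <-≤-trans 0<1 1≤r
    -- `d c² - 1` factors as `(c - s) r (r c + 1)`, and the cofactor is at least 1 because `r ≥ 1`
    -- and `c ≥ 0`.
    ∣c-s∣≤ : ∣ c - s ∣ ≤ ∣ d * (c * c) - 1# ∣
    ∣c-s∣≤ = begin
      ∣ c - s ∣                              ≈⟨ *-identityʳ _ ⟨
      ∣ c - s ∣ * 1#                         ≤⟨ *-monoˡ-≤ (0≤∣x∣ _) 1≤factor ⟩
      ∣ c - s ∣ * (r * (r * c + 1#))         ≈⟨ *-congˡ (sym (0≤x⇒∣x∣≈x (≤-trans 0≤1 1≤factor))) ⟩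
      ∣ c - s ∣ * ∣ r * (r * c + 1#) ∣       ≈⟨ ∣x*y∣≈∣x∣*∣y∣ _ _ ⟨
      ∣ (c - s) * (r * (r * c + 1#)) ∣       ≈⟨ ∣∣-cong factored ⟩
      ∣ d * (c * c) - 1# ∣                   ∎
      where
      1≤factor : 1# ≤ r * (r * c + 1#)
      1≤factor = ≤-respˡ-≈ (*-identityˡ 1#) (*-mono-≤ 0≤1 0≤1 1≤r
        (≤-respˡ-≈ (+-identityˡ 1#) (+-monoˡ-≤ 1# (0≤x*y 0≤r 0≤c))))
      factored : (c - s) * (r * (r * c + 1#)) ≈ d * (c * c) - 1#
      factored = begin-equality
        (c - s) * (r * (r * c + 1#))             ≈⟨ solve 3 (λ c s r → (c :- s) :* (r :* (r :* c :+ :1)) := (r :* c :- r :* s) :* (r :* c :+ :1)) refl c s r ⟩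
        (r * c - r * s) * (r * c + 1#)           ≈⟨ *-congʳ (+-congˡ (-‿cong (x*[y/x]≈y 0<r 1#))) ⟩
        (r * c - 1#) * (r * c + 1#)              ≈⟨ solve 2 (λ c r → (r :* c :- :1) :* (r :* c :+ :1) := r :* r :* (c :* c) :- :1) refl c r ⟩
        r * r * (c * c) - 1#                     ≈⟨ +-congʳ (*-congʳ r²≈d) ⟩
        d * (c * c) - 1#                         ∎

  module Correlation {n} (S : UniformSample n) {d₁ d₂ : ℕ}
    (1≤d₁ : 1 ℕ.≤ d₁) (d₁<n : d₁ ℕ.< n) (1≤d₂ : 1 ℕ.≤ d₂) (d₂<n : d₂ ℕ.< n) where
    open UniformSample S
    open Covariance S
    open Weights n
    private
      module I = Band (inv-band d₁)
      module D = Band (des-band d₂ 1≤d₂)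

    -- `α + M`, `β + N` and `γ + κ` are twelve times the variance of `Xinv`, the variance of `Xdes`
    -- and their covariance, each split into imbalance sum and entrywise sum.
    c D n# α M β N γ κ : R
    c  = correlation d₁ d₂
    D  = fromℕ d₁
    n# = fromℕ n
    α  = I.imbalance²
    M  = I.total
    β  = D.imbalance²
    N  = D.total
    γ  = sum λ m → imbalance (inv-weight d₁) m * imbalance (des-weight d₂) m
    κ  = ∑∑ λ i j → inv-weight d₁ i j * des-weight d₂ i j

    1≤D : 1# ≤ D
    1≤D = 1≤fromℕ 1≤d₁

    0≤D : 0# ≤ D
    0≤D = 0≤fromℕ d₁

    M≥ : (n# - D) * D ≤ M
    M≥ = ≤-respˡ-≈ (*-congʳ (fromℕ-∸ (ℕₚ.<⇒≤ d₁<n))) I.total-≥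

    N≥ : n# - fromℕ d₂ ≤ N
    N≥ = ≤-respˡ-≈ (trans (*-congʳ (fromℕ-∸ (ℕₚ.<⇒≤ d₂<n))) (trans (*-congˡ (+-identityʳ 1#)) (*-identityʳ _))) D.total-≥

    N≤ : N ≤ n#
    N≤ = ≤-respʳ-≈ (trans (*-congˡ (+-identityʳ 1#)) (*-identityʳ _)) D.total-≤

    β≤ : β ≤ fromℕ 2 * fromℕ d₂
    β≤ = ≤-respʳ-≈ (solve 1 (λ d → con (pos 2) :* d :* (con (pos 1) :* con (pos 1)) := con (pos 2) :* d) refl (fromℕ d₂)) D.imbalance²-≤

    fromℕ-< : ∀ {d} → d ℕ.< n → 0# < n# - fromℕ d
    fromℕ-< {d} d<n = <-≤-trans 0<1 (≤-by (x≤y⇒0≤y-x (fromℕ-mono-≤ d<n))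
      (solve 2 (λ N d → N :- d :- :1 := N :- (:1 :+ d)) refl n# (fromℕ d)))

    0<M : 0# < M
    0<M = <-≤-trans (*-pos (fromℕ-< d₁<n) (0<fromℕ 1≤d₁)) M≥

    0<N : 0# < N
    0<N = <-≤-trans (fromℕ-< d₂<n) N≥

    correlation-square : c * c * ((α + M) * (β + N)) ≈ (γ + κ) * (γ + κ) × (0# ≤ γ + κ → 0# ≤ c)
    correlation-square = corr-square
      (12*Cov≈form I.supported D.supported (Xinv≈statistic d₁) (Xdes≈statistic d₂))
      (trans (12*Cov≈form I.supported I.supported (Xinv≈statistic d₁) (Xinv≈statistic d₁)) I.form≈)
      (trans (12*Cov≈form D.supported D.supported (Xdes≈statistic d₂) (Xdes≈statistic d₂)) D.form≈)
      (*-pos (<-respʳ-≈ (+-comm M α) (0<x+y 0<M I.0≤imbalance²)) (<-respʳ-≈ (+-comm N β) (0<x+y 0<N D.0≤imbalance²)))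

    γ²≤αβ : γ * γ ≤ α * β
    γ²≤αβ = cauchy-schwarz (imbalance (inv-weight d₁)) (imbalance (des-weight d₂))

    Des : Fin n → Fin n → Set
    Des i j = toℕ j ≡ toℕ i ℕ.+ d₂

    κ≈0 : d₁ ℕ.< d₂ → κ ≈ 0#
    κ≈0 d₁<d₂ = trans (sum-cong-≋ {n} λ i → trans (sum-cong-≋ {n} λ j → disjoint i j (lem {P = Des i j})) (sum-replicate-zero n))
      (sum-replicate-zero n)
      where
      disjoint : ∀ i j → Dec (Des i j) → inv-weight d₁ i j * des-weight d₂ i j ≈ 0#
      disjoint i j (no ¬des)  = trans (*-congˡ (⟦⟧-no ¬des)) (zeroʳ _)
      disjoint i j (yes des) = trans (*-congʳ (⟦⟧-no λ (_ , j∸i≤d₁) →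
        ℕₚ.<⇒≱ d₁<d₂ (≡.subst (ℕ._≤ d₁) (≡.trans (≡.cong (ℕ._∸ toℕ i) des) (ℕₚ.m+n∸m≡n (toℕ i) d₂)) j∸i≤d₁))) (zeroˡ _)

    -- Pairs at distance exactly `d₂` are then among those at distance at most `d₁`, so the
    -- inversion weight is 1 wherever the descent weight is.
    κ≈N : d₂ ℕ.≤ d₁ → κ ≈ N
    κ≈N d₂≤d₁ = ∑∑-cong {n} {n} λ i j → contained i j (lem {P = Des i j})
      where
      contained : ∀ i j → Dec (Des i j) → inv-weight d₁ i j * des-weight d₂ i j ≈ des-weight d₂ i j
      contained i j (no ¬des)  = trans (*-congˡ (⟦⟧-no ¬des)) (trans (zeroʳ _) (sym (⟦⟧-no ¬des)))
      contained i j (yes des) = trans (*-congʳ (⟦⟧-yes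
        ( ℕₚ.<-≤-trans (ℕₚ.m<m+n (toℕ i) 1≤d₂) (ℕₚ.≤-reflexive (≡.sym des))
        , ≡.subst (ℕ._≤ d₁) (≡.sym (≡.trans (≡.cong (ℕ._∸ toℕ i) des) (ℕₚ.m+n∸m≡n (toℕ i) d₂))) d₂≤d₁)))
        (*-identityˡ _)

    -- The 4 combines the 2 of `imbalance²-≤` with `n ≤ 2 (n - D)`. The last premise makes `κ`
    -- small: it is zero if `d₁ < d₂`; otherwise it equals `N`, which is at most `2 (n - D)` and
    -- hence at most `η M`, as `M` has the additional factor `D`.
    correlation²-small : ∀ {η δ} → 0# < η → 0# < δ → δ + δ ≤ 1# → fromℕ 4 * δ ≤ η → D * D ≤ δ * n# →
                         d₁ ℕ.< d₂ ⊎ (d₂ ℕ.≤ d₁ × fromℕ 2 ≤ η * D) → c * c ≤ fromℕ 2 * η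
    correlation²-small {η} {δ} 0<η 0<δ 2δ≤1 4δ≤η D²≤δn gap =
      square-small (<⇒≤ 0<η) I.0≤imbalance² D.0≤imbalance² 0<M 0<N (proj₁ correlation-square) γ²≤αβ α≤ηM (κ²≤ gap)
      where
      0≤n-D : 0# ≤ n# - D
      0≤n-D = <⇒≤ (fromℕ-< d₁<n)
      0≤η = <⇒≤ 0<η

      n≤2[n-D] : n# ≤ fromℕ 2 * (n# - D)
      n≤2[n-D] = ≤-by (x≤y⇒0≤y-x 2D≤n) (solve 2 (λ n D → con (pos 2) :* (n :- D) :- n := n :- con (pos 2) :* D) refl n# D)
        where
        2D≤n : fromℕ 2 * D ≤ n#
        2D≤n = begin
          fromℕ 2 * D            ≈⟨ solve 1 (λ D → con (pos 2) :* D := con (pos 2) :* (:1 :* D)) refl D ⟩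
          fromℕ 2 * (1# * D)     ≤⟨ *-monoˡ-≤ (0≤fromℕ 2) (*-mono-≤ 0≤1 0≤D 1≤D ≤-refl) ⟩
          fromℕ 2 * (D * D)      ≤⟨ *-monoˡ-≤ (0≤fromℕ 2) D²≤δn ⟩
          fromℕ 2 * (δ * n#)     ≈⟨ solve 2 (λ δ n → con (pos 2) :* (δ :* n) := (δ :+ δ) :* n) refl δ n# ⟩
          (δ + δ) * n#           ≤⟨ *-mono-≤ (0≤x+y (<⇒≤ 0<δ) (<⇒≤ 0<δ)) (0≤fromℕ n) 2δ≤1 ≤-refl ⟩
          1# * n#                ≈⟨ *-identityˡ _ ⟩
          n#                     ∎

      α≤ηM : α ≤ η * M
      α≤ηM = begin
        α                                    ≤⟨ I.imbalance²-≤ ⟩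
        fromℕ 2 * D * (D * D)                ≤⟨ *-monoˡ-≤ (0≤x*y (0≤fromℕ 2) 0≤D) (≤-trans D²≤δn (*-monoˡ-≤ (<⇒≤ 0<δ) n≤2[n-D])) ⟩
        fromℕ 2 * D * (δ * (fromℕ 2 * (n# - D)))  ≈⟨ solve 3 (λ D δ x → con (pos 2) :* D :* (δ :* (con (pos 2) :* x)) := con (pos 4) :* δ :* (x :* D)) refl D δ (n# - D) ⟩
        fromℕ 4 * δ * ((n# - D) * D)         ≤⟨ *-mono-≤ (0≤x*y (0≤fromℕ 4) (<⇒≤ 0<δ)) (0≤x*y 0≤n-D 0≤D) 4δ≤η M≥ ⟩
        η * M                                ∎

      κ²≤ : d₁ ℕ.< d₂ ⊎ (d₂ ℕ.≤ d₁ × fromℕ 2 ≤ η * D) → κ * κ ≤ η * M * N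
      κ²≤ (inj₁ d₁<d₂) = ≤-respˡ-≈ (sym (trans (*-congʳ (κ≈0 d₁<d₂)) (zeroˡ κ)))
        (0≤x*y (0≤x*y 0≤η (<⇒≤ 0<M)) (<⇒≤ 0<N))
      κ²≤ (inj₂ (d₂≤d₁ , 2≤ηD)) = ≤-respˡ-≈ (sym (*-cong (κ≈N d₂≤d₁) (κ≈N d₂≤d₁)))
        (*-mono-≤ (<⇒≤ 0<N) (<⇒≤ 0<N) (begin
          N                         ≤⟨ ≤-trans N≤ n≤2[n-D] ⟩
          fromℕ 2 * (n# - D)        ≤⟨ *-mono-≤ (0≤fromℕ 2) 0≤n-D 2≤ηD ≤-refl ⟩
          η * D * (n# - D)          ≈⟨ solve 3 (λ η D x → η :* D :* x := η :* (x :* D)) refl η D (n# - D) ⟩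
          η * ((n# - D) * D)        ≤⟨ *-monoˡ-≤ 0≤η M≥ ⟩
          η * M                     ∎) ≤-refl)

    -- One bound `L = 3 K³` covers every deviation: at most `K³ + 2 K` for the covariance, `2 K³`
    -- for the variance of `Xinv` and `2 K` for that of `Xdes`, all times twelve. It depends on `K`
    -- alone, so the estimate is uniform in `d₁`.
    correlation-near : ∀ {K} → d₁ ℕ.≤ K → d₂ ℕ.≤ d₁ → let L = fromℕ 3 * (fromℕ K * fromℕ K * fromℕ K) in
                       fromℕ 2 * L ≤ n# → ∣ c - 1# / (√ D) ∣ * n# ≤ fromℕ 24 * (L * L)
    correlation-near {K} d₁≤K d₂≤d₁ 2L≤n = near-inverse-root (proj₂ correlation-square 0≤P) (proj₁ correlation-square)
      (∣x∣≤ (≤-by (0≤x+y 0≤L-g (x≤y⇒0≤y-x P≤)) (solve 4 (λ L P n g → L :- (P :- n) := (L :- g) :+ (n :+ g :- P)) refl L P n# g))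
            (≤-by (0≤x+y 0≤L-[g+k] (x≤y⇒0≤y-x P≥)) (solve 5 (λ L P n g k → L :- :- (P :- n) := (L :- (g :+ k)) :+ (P :- (n :- (g :+ k)))) refl L P n# g k)))
      (∣x∣≤ (≤-by (0≤x+y 0≤L-2k³ (0≤x+y (x≤y⇒0≤y-x α≤) (x≤y⇒0≤y-x I.total-≤)))
              (solve 6 (λ L a M n D q → L :- (a :+ M :- D :* n) := (L :- con (pos 2) :* q) :+ (con (pos 2) :* q :- a :+ (n :* D :- M))) refl L α M n# D k³))
            (≤-by (0≤x+y 0≤L-D² (0≤x+y I.0≤imbalance² (x≤y⇒0≤y-x M≥)))
              (solve 5 (λ L a M n D → L :- :- (a :+ M :- D :* n) := (L :- D :* D) :+ (a :+ (M :- (n :- D) :* D))) refl L α M n# D)))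
      (∣x∣≤ (≤-by (0≤x+y 0≤L-2k (0≤x+y (x≤y⇒0≤y-x β≤2k) (x≤y⇒0≤y-x N≤)))
              (solve 5 (λ L b N n k → L :- (b :+ N :- n) := (L :- con (pos 2) :* k) :+ (con (pos 2) :* k :- b :+ (n :- N))) refl L β N n# k))
            (≤-by (0≤x+y 0≤L-k (0≤x+y D.0≤imbalance² (x≤y⇒0≤y-x N≥k)))
              (solve 5 (λ L b N n k → L :- :- (b :+ N :- n) := (L :- k) :+ (b :+ (N :- (n :- k)))) refl L β N n# k)))
      1≤D D≤L 2L≤n (proj₁ √-spec) (trans (*-congˡ (sym (*-identityʳ _))) (proj₂ √-spec))
      where
      √-spec = root-spec 1 0≤D
      k = fromℕ K
      k³ = k * k * k
      L = fromℕ 3 * k³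
      g = k³ + k
      P = γ + κ
      D≤k : D ≤ k
      D≤k = fromℕ-mono-≤ d₁≤K
      d₂≤k : fromℕ d₂ ≤ k
      d₂≤k = fromℕ-mono-≤ (ℕₚ.≤-trans d₂≤d₁ d₁≤K)
      1≤k : 1# ≤ k
      1≤k = ≤-trans 1≤D D≤k
      0≤k : 0# ≤ k
      0≤k = ≤-trans 0≤1 1≤k
      k≤k² : k ≤ k * k
      k≤k² = ≤-respˡ-≈ (*-identityʳ k) (*-monoˡ-≤ 0≤k 1≤k)
      k²≤k³ : k * k ≤ k³
      k²≤k³ = ≤-respˡ-≈ (*-identityʳ _) (*-monoˡ-≤ (0≤x² k) 1≤k)
      k≤k³ : k ≤ k³
      k≤k³ = ≤-trans k≤k² k²≤k³
      0≤k³ : 0# ≤ k³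
      0≤k³ = ≤-trans 0≤k k≤k³
      0≤k³-k : 0# ≤ k³ - k
      0≤k³-k = x≤y⇒0≤y-x k≤k³
      0≤L-g : 0# ≤ L - g
      0≤L-g = ≤-respʳ-≈ (solve 2 (λ q k → q :+ (q :- k) := con (pos 3) :* q :- (q :+ k)) refl k³ k) (0≤x+y 0≤k³ 0≤k³-k)
      0≤L-[g+k] : 0# ≤ L - (g + k)
      0≤L-[g+k] = ≤-respʳ-≈ (solve 2 (λ q k → (q :- k) :+ (q :- k) := con (pos 3) :* q :- (q :+ k :+ k)) refl k³ k) (0≤x+y 0≤k³-k 0≤k³-k)
      0≤L-2k³ : 0# ≤ L - fromℕ 2 * k³
      0≤L-2k³ = ≤-respʳ-≈ (solve 1 (λ q → q := con (pos 3) :* q :- con (pos 2) :* q) refl k³) 0≤k³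
      0≤L-k : 0# ≤ L - k
      0≤L-k = ≤-respʳ-≈ (solve 2 (λ q k → (q :- k) :+ (q :+ q) := con (pos 3) :* q :- k) refl k³ k) (0≤x+y 0≤k³-k (0≤x+y 0≤k³ 0≤k³))
      0≤L-2k : 0# ≤ L - fromℕ 2 * k
      0≤L-2k = ≤-respʳ-≈ (solve 2 (λ q k → (q :- k) :+ ((q :- k) :+ q) := con (pos 3) :* q :- con (pos 2) :* k) refl k³ k) (0≤x+y 0≤k³-k (0≤x+y 0≤k³-k 0≤k³))
      k≤L : k ≤ L
      k≤L = ≤-by 0≤L-k refl
      D≤L : D ≤ L
      D≤L = ≤-trans D≤k k≤L
      0≤L-D² : 0# ≤ L - D * D
      0≤L-D² = x≤y⇒0≤y-x (≤-trans (*-mono-≤ 0≤D 0≤D D≤k D≤k) (≤-trans k²≤k³ (≤-by (0≤x+y 0≤k³ 0≤k³)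
        (solve 1 (λ q → con (pos 3) :* q :- q := q :+ q) refl k³))))
      α≤ : α ≤ fromℕ 2 * k³
      α≤ = ≤-trans I.imbalance²-≤ (≤-respʳ-≈ (solve 1 (λ k → con (pos 2) :* k :* (k :* k) := con (pos 2) :* (k :* k :* k)) refl k)
        (*-mono-≤ (0≤x*y (0≤fromℕ 2) 0≤D) (0≤x² D) (*-monoˡ-≤ (0≤fromℕ 2) D≤k) (*-mono-≤ 0≤D 0≤D D≤k D≤k)))
      β≤2k : β ≤ fromℕ 2 * k
      β≤2k = ≤-trans β≤ (*-monoˡ-≤ (0≤fromℕ 2) d₂≤k)
      N≥k : n# - k ≤ N
      N≥k = ≤-trans (+-monoʳ-≤ n# (-‿anti-≤ d₂≤k)) N≥
      α+β≤2g : α + β ≤ fromℕ 2 * g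
      α+β≤2g = ≤-respʳ-≈ (sym (distribˡ _ _ _)) (+-mono-≤ α≤ β≤2k)
      0≤g : 0# ≤ g
      0≤g = 0≤x+y 0≤k³ 0≤k
      -- From `4 α β ≤ (α + β)²`, where `g` is half of the bound on `α + β`.
      γ²≤g² : γ * γ ≤ g * g
      γ²≤g² = *-cancelˡ-≤ (0<fromℕ {4} (ℕ.s≤s ℕ.z≤n)) (begin
        fromℕ 4 * (γ * γ)          ≤⟨ *-monoˡ-≤ (0≤fromℕ 4) γ²≤αβ ⟩
        fromℕ 4 * (α * β)          ≤⟨ ≤-by (0≤x² (α - β)) (solve 2 (λ a b → (a :+ b) :* (a :+ b) :- con (pos 4) :* (a :* b) := (a :- b) :* (a :- b)) refl α β) ⟩
        (α + β) * (α + β)          ≤⟨ *-mono-≤ 0≤α+β 0≤α+β α+β≤2g α+β≤2g ⟩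
        fromℕ 2 * g * (fromℕ 2 * g)  ≈⟨ solve 1 (λ g → con (pos 2) :* g :* (con (pos 2) :* g) := con (pos 4) :* (g :* g)) refl g ⟩
        fromℕ 4 * (g * g)          ∎)
        where
        0≤α+β : 0# ≤ α + β
        0≤α+β = 0≤x+y I.0≤imbalance² D.0≤imbalance²
      γ≤g : γ ≤ g
      γ≤g = square-cancel-≤ 0≤g γ²≤g²
      -γ≤g : - γ ≤ g
      -γ≤g = square-cancel-≤ 0≤g (≤-respˡ-≈ (solve 1 (λ x → x :* x := :- x :* :- x) refl γ) γ²≤g²)
      P≤ : P ≤ n# + g
      P≤ = ≤-respʳ-≈ (+-comm g n#) (+-mono-≤ γ≤g (≤-trans (≤-reflexive (κ≈N d₂≤d₁)) N≤))
      P≥ : n# - (g + k) ≤ P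
      P≥ = ≤-by (0≤x+y (x≤y⇒0≤y-x -γ≤g) (x≤y⇒0≤y-x (≤-trans N≥k (≤-reflexive (sym (κ≈N d₂≤d₁))))))
        (solve 5 (λ γ κ n g k → γ :+ κ :- (n :- (g :+ k)) := (g :- :- γ) :+ (κ :- (n :- k))) refl γ κ n# g k)
      0≤P : 0# ≤ P
      0≤P = ≤-trans (x≤y⇒0≤y-x g+k≤n) P≥
        where
        g+k≤n : g + k ≤ n#
        g+k≤n = ≤-trans (≤-by 0≤L-[g+k] refl) (≤-trans (≤-by (0≤x+y 0≤L-k 0≤k) (solve 2 (λ L k → con (pos 2) :* L :- L := L :- k :+ k) refl L k)) 2L≤n)

  -- Limits

  -- As `s² p` and `t² q` are 1, `q - p` factors as `(s - t) (s + t) p q`, with `s` and `t` at most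
  -- 1. Inverse roots of distinct integers up to `k` thus keep a uniform distance.
  inverse-roots-apart : ∀ {p q k s t} → 1# ≤ p → 1# ≤ q → p ≤ k → q ≤ k → 1# ≤ ∣ q - p ∣ →
                        0# ≤ s → 0# ≤ t → s * s * p ≈ 1# → t * t * q ≈ 1# →
                        1# ≤ fromℕ 2 * (k * k) * ∣ s - t ∣
  inverse-roots-apart {p} {q} {k} {s} {t} 1≤p 1≤q p≤k q≤k apart 0≤s 0≤t s²p≈1 t²q≈1 = begin
    1#
      ≤⟨ apart ⟩
    ∣ q - p ∣
      ≈⟨ ∣∣-cong (begin-equality
           q - p                                ≈⟨ solve 2 (λ p q → q :- p := :1 :* q :- :1 :* p) refl p q ⟩
           1# * q - 1# * p                      ≈⟨ +-cong (*-congʳ s²p≈1) (-‿cong (*-congʳ t²q≈1)) ⟨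
           s * s * p * q - t * t * q * p        ≈⟨ solve 4 (λ s t p q → s :* s :* p :* q :- t :* t :* q :* p := (s :- t) :* ((s :+ t) :* (p :* q))) refl s t p q ⟩
           (s - t) * ((s + t) * (p * q))        ∎) ⟩
    ∣ (s - t) * ((s + t) * (p * q)) ∣
      ≈⟨ trans (∣x*y∣≈∣x∣*∣y∣ _ _) (*-congˡ (0≤x⇒∣x∣≈x (0≤x*y (0≤x+y 0≤s 0≤t) 0≤pq))) ⟩
    ∣ s - t ∣ * ((s + t) * (p * q))
      ≤⟨ *-monoˡ-≤ (0≤∣x∣ _) (*-mono-≤ (0≤x+y 0≤s 0≤t) 0≤pq (+-mono-≤ (≤1 0≤s 1≤p s²p≈1) (≤1 0≤t 1≤q t²q≈1))
           (*-mono-≤ (≤-trans 0≤1 1≤p) (≤-trans 0≤1 1≤q) p≤k q≤k)) ⟩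
    ∣ s - t ∣ * ((1# + 1#) * (k * k))
      ≈⟨ solve 2 (λ d k → d :* ((:1 :+ :1) :* (k :* k)) := con (pos 2) :* (k :* k) :* d) refl _ k ⟩
    fromℕ 2 * (k * k) * ∣ s - t ∣ ∎
    where
    0≤pq : 0# ≤ p * q
    0≤pq = 0≤x*y (≤-trans 0≤1 1≤p) (≤-trans 0≤1 1≤q)
    ≤1 : ∀ {x y} → 0# ≤ x → 1# ≤ y → x * x * y ≈ 1# → x ≤ 1#
    ≤1 {x} {y} 0≤x 1≤y x²y≈1 = square-cancel-≤ 0≤1 (begin
      x * x          ≈⟨ *-identityʳ _ ⟨
      x * x * 1#     ≤⟨ *-monoˡ-≤ (0≤x² x) 1≤y ⟩
      x * x * y      ≈⟨ x²y≈1 ⟩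
      1#             ≈⟨ *-identityˡ 1# ⟨
      1# * 1#        ∎)

  fromℕ-apart : ∀ {p q} → p ≢ q → 1# ≤ ∣ fromℕ q - fromℕ p ∣
  fromℕ-apart {p} {q} p≢q with ℕₚ.<-cmp p q
  ... | tri< p<q _ _ = ≤-trans (≤-by (x≤y⇒0≤y-x (fromℕ-mono-≤ p<q))
          (solve 2 (λ p q → q :- p :- :1 := q :- (:1 :+ p)) refl (fromℕ p) (fromℕ q))) (x≤∣x∣ _)
  ... | tri≈ _ p≡q _ = contradiction p≡q p≢q
  ... | tri> _ _ q<p = ≤-trans (≤-by (x≤y⇒0≤y-x (fromℕ-mono-≤ q<p))
          (solve 2 (λ p q → :- (q :- p) :- :1 := p :- (:1 :+ q)) refl (fromℕ p) (fromℕ q))) (-x≤∣x∣ _)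

  inverse-root-spec : ∀ {p} → 1# ≤ p → 0# ≤ 1# / (√ p) × (1# / (√ p)) * (1# / (√ p)) * p ≈ 1#
  inverse-root-spec {p} 1≤p = <⇒≤ (0<x/y 0<1 0<r) , (begin-equality
    s * s * p              ≈⟨ *-congˡ (proj₂ r-spec) ⟨
    s * s * (r ^ 2)        ≈⟨ solve 2 (λ s r → s :* s :* r :^ 2 := r :* s :* (r :* s)) refl s r ⟩
    r * s * (r * s)        ≈⟨ *-cong (x*[y/x]≈y 0<r 1#) (x*[y/x]≈y 0<r 1#) ⟩
    1# * 1#                ≈⟨ *-identityˡ 1# ⟩
    1#                     ∎)
    where
    r = √ p
    s = 1# / r
    0<p : 0# < p
    0<p = <-≤-trans 0<1 1≤p
    r-spec = root-spec 1 (<⇒≤ 0<p)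
    0<r : 0# < r
    0<r = *-cancelˡ-< (proj₁ r-spec) (<-respˡ-≈ (sym (zeroʳ r))
      (<-respʳ-≈ (trans (sym (proj₂ r-spec)) (*-congˡ (*-identityʳ r))) 0<p))

  -- The balls around `a` and `b` of radius half their distance are disjoint, and each is visited
  -- beyond every `N`.
  accumulation-points-separate : ∀ {u a b} → ¬ (a ≈ b) → IsAccumulationPoint u a → IsAccumulationPoint u b →
                                 ∀ N → ∃₂ λ m n → N ℕ.≤ m × N ℕ.≤ n × ¬ (u m ≈ u n)
  accumulation-points-separate {u} {a} {b} a≉b u-a u-b N = m , n , proj₁ (proj₂ near-a) , proj₁ (proj₂ near-b) , separate
    where
    gap = ∣ a - b ∣
    0<gap : 0# < gap
    0<gap = ≰⇒> λ gap≤0 → a≉b (≤-antisym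
      (≤-by (0≤-x (≤-trans (x≤∣x∣ (a - b)) gap≤0)) (solve 2 (λ a b → b :- a := :- (a :- b)) refl a b))
      (≤-by (0≤-x (≤-trans (-x≤∣x∣ (a - b)) gap≤0)) (solve 2 (λ a b → a :- b := :- :- (a :- b)) refl a b)))
    near-a = u-a (half gap) (0<half 0<gap) N
    near-b = u-b (half gap) (0<half 0<gap) N
    m = proj₁ near-a
    n = proj₁ near-b
    separate : ¬ (u m ≈ u n)
    separate um≈un = <-irrefl refl (begin-strict
      gap                                ≈⟨ ∣∣-cong (trans (solve 3 (λ a b x → a :- b := :- (x :- a) :+ (x :- b)) refl a b (u m)) (+-congˡ (+-congʳ um≈un))) ⟩
      ∣ - (u m - a) + (u n - b) ∣        ≤⟨ ∣x+y∣≤∣x∣+∣y∣ _ _ ⟩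
      ∣ - (u m - a) ∣ + ∣ u n - b ∣      ≤⟨ +-monoˡ-≤ _ (≤-trans (≤-reflexive (∣∣-neg _)) (<⇒≤ (proj₂ (proj₂ near-a)))) ⟩
      half gap + ∣ u n - b ∣             <⟨ +-monoʳ-< _ (proj₂ (proj₂ near-b)) ⟩
      half gap + half gap                ≈⟨ half+half gap ⟩
      gap                                ∎)

  eventually-large : ∀ {d : ℕ → ℕ} → (∀ K → ∃ λ N → ∀ n → N ℕ.≤ n → K ℕ.≤ d n) →
                     ∀ η → 0# < η → ∃ λ N → ∀ n → N ℕ.≤ n → fromℕ 2 ≤ η * fromℕ (d n)
  eventually-large {d} d→∞ η 0<η = proj₁ large , λ n N≤n → begin
    fromℕ 2                              ≈⟨ solve 0 (con (pos 2) := :1 :+ :1) refl ⟩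
    1# + 1#                              ≤⟨ +-mono-≤ (proj₂ arch) (proj₂ arch) ⟩
    K * half η + K * half η              ≈⟨ distribˡ K (half η) (half η) ⟨
    K * (half η + half η)                ≈⟨ *-congˡ (half+half η) ⟩
    K * η                                ≈⟨ *-comm K η ⟩
    η * K                                ≤⟨ *-monoˡ-≤ (<⇒≤ 0<η) (fromℕ-mono-≤ (proj₂ large n N≤n)) ⟩
    η * fromℕ (d n)                      ∎
    where
    arch = archimedean-inv (0<half 0<η)
    large = d→∞ (suc (proj₁ arch))
    K = fromℕ (suc (proj₁ arch))

  -- No `d` satisfies `1 ≤ d < n` when `n ≤ 1`, so the ranges are required only from `n₀` on; values
  -- below it do not influence limits.
  module Limits (S : ∀ n → UniformSample n) (n₀ : ℕ) (d₁ d₂ : ℕ → ℕ)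
    (d₁-range : ∀ n → n₀ ℕ.≤ n → 1 ℕ.≤ d₁ n × d₁ n ℕ.< n)
    (d₂-range : ∀ n → n₀ ℕ.≤ n → 1 ℕ.≤ d₂ n × d₂ n ℕ.< n) where

    corr : ℕ → R
    corr n = UniformSample.correlation (S n) (d₁ n) (d₂ n)

    D : ℕ → R
    D n = fromℕ (d₁ n)

    module At {n} (n₀≤n : n₀ ℕ.≤ n) = Correlation (S n)
      (proj₁ (d₁-range n n₀≤n)) (proj₂ (d₁-range n n₀≤n)) (proj₁ (d₂-range n n₀≤n)) (proj₂ (d₂-range n n₀≤n))

    -- Covers both vanishing cases: the disjunction holds by its left side if `d₁ < d₂`, and by its
    -- right side if `d₁` tends to infinity.
    corr⟶0 : D =o growthBound →
             (∀ η → 0# < η → ∃ λ N → ∀ n → N ℕ.≤ n → d₁ n ℕ.< d₂ n ⊎ (d₂ n ℕ.≤ d₁ n × fromℕ 2 ≤ η * D n)) →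
             corr ⟶ 0#
    corr⟶0 D=o gap ε 0<ε = n₀ ℕ.+ N ℕ.+ M , λ n bound≤n →
      let n₀+N≤n = ℕₚ.≤-trans (ℕₚ.m≤m+n (n₀ ℕ.+ N) M) bound≤n
          small = At.correlation²-small (ℕₚ.≤-trans (ℕₚ.m≤m+n n₀ N) n₀+N≤n) 0<η 0<δ
            (proj₁ (proj₂ (proj₂ δ-factor))) (proj₂ (proj₂ (proj₂ δ-factor)))
            (proj₂ d²≤δn n (ℕₚ.≤-trans (ℕₚ.m≤n+m M (n₀ ℕ.+ N)) bound≤n))
            (proj₂ (gap η 0<η) n (ℕₚ.≤-trans (ℕₚ.m≤n+m N n₀) n₀+N≤n))
          c = corr n
      in ≤-<-trans (≤-reflexive (∣∣-cong (solve 1 (λ c → c :- :0 := c) refl c)))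
        (square-cancel-< (<⇒≤ 0<ε) (begin-strict
          ∣ c ∣ * ∣ c ∣    ≈⟨ ∣x∣²≈x² c ⟩
          c * c            ≤⟨ small ⟩
          fromℕ 2 * η      <⟨ <-by (*-pos 0<2 0<η) (solve 1 (λ η → con (pos 4) :* η :- con (pos 2) :* η := con (pos 2) :* η) refl η) ⟩
          fromℕ 4 * η      ≤⟨ proj₂ (proj₂ (proj₂ η-factor)) ⟩
          ε * ε            ∎))
      where
      0<4 : 0# < fromℕ 4
      0<4 = 0<fromℕ {4} (ℕ.s≤s ℕ.z≤n)
      -- The square of the correlation is at most `2 η`; asking for `4 η ≤ ε²` makes the final
      -- inequality strict.
      η-factor = small-factor (*-pos 0<ε 0<ε) 0<4
      η = proj₁ η-factor
      0<η = proj₁ (proj₂ η-factor)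
      δ-factor = small-factor 0<η 0<4
      δ = proj₁ δ-factor
      0<δ = proj₁ (proj₂ δ-factor)
      d²≤δn = o-growthBound⇒square-small {d₁} D=o δ 0<δ
      M = proj₁ d²≤δn
      N = proj₁ (gap η 0<η)

    -- The target moves with `n`, so the estimate needs `d₁` bounded but not constant and serves
    -- convergence and divergence alike.
    corr-near : ∀ {K N} → (∀ n → N ℕ.≤ n → d₁ n ℕ.≤ K × d₂ n ℕ.≤ d₁ n) →
                ∀ ε → 0# < ε → ∃ λ M → ∀ n → M ℕ.≤ n → n₀ ℕ.≤ n × N ℕ.≤ n × ∣ corr n - 1# / (√ (D n)) ∣ < ε
    corr-near {K} {N} bounded ε 0<ε = n₀ ℕ.+ N ℕ.+ (proj₁ a ℕ.+ proj₁ b) , λ n M≤n →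
      let n₀+N≤n = ℕₚ.≤-trans (ℕₚ.m≤m+n (n₀ ℕ.+ N) _) M≤n
          n₀≤n = ℕₚ.≤-trans (ℕₚ.m≤m+n n₀ N) n₀+N≤n
          N≤n = ℕₚ.≤-trans (ℕₚ.m≤n+m N n₀) n₀+N≤n
          a+b≤n = ℕₚ.≤-trans (ℕₚ.m≤n+m (proj₁ a ℕ.+ proj₁ b) (n₀ ℕ.+ N)) M≤n
          d₁≤K , d₂≤d₁ = bounded n N≤n
      in n₀≤n , N≤n , *-cancelˡ-< (0≤fromℕ n) (begin-strict
        fromℕ n * ∣ corr n - 1# / (√ (D n)) ∣   ≈⟨ *-comm _ _ ⟩
        ∣ corr n - 1# / (√ (D n)) ∣ * fromℕ n   ≤⟨ At.correlation-near n₀≤n d₁≤K d₂≤d₁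
          (≤-trans (<⇒≤ (proj₂ a)) (fromℕ-mono-≤ (ℕₚ.≤-trans (ℕₚ.m≤m+n (proj₁ a) (proj₁ b)) a+b≤n))) ⟩
        B                                       ≈⟨ x*[y/x]≈y 0<ε B ⟨
        ε * (B / ε)                             <⟨ *-monoˡ-< 0<ε (<-≤-trans (proj₂ b)
          (fromℕ-mono-≤ (ℕₚ.≤-trans (ℕₚ.m≤n+m (proj₁ b) (proj₁ a)) a+b≤n))) ⟩
        ε * fromℕ n                             ≈⟨ *-comm ε _ ⟩
        fromℕ n * ε                             ∎)
      where
      L = fromℕ 3 * (fromℕ K * fromℕ K * fromℕ K)
      B = fromℕ 24 * (L * L)
      a = archimedean (fromℕ 2 * L)
      b = archimedean (B / ε)

    corr⟶1/√ : (∀ n → n₀ ℕ.≤ n → d₂ n ℕ.≤ d₁ n) → ∀ c → (∃ λ N → ∀ n → N ℕ.≤ n → d₁ n ≡ c) →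
               corr ⟶ 1# / (√ (fromℕ c))
    corr⟶1/√ d₂≤d₁ c (N , d₁≡c) ε 0<ε = proj₁ near , λ n M≤n →
      let _ , n₀+N≤n , close = proj₂ near n M≤n in
      ≡.subst (λ d → ∣ corr n - 1# / (√ (fromℕ d)) ∣ < ε) (d₁≡c n (ℕₚ.≤-trans (ℕₚ.m≤n+m N n₀) n₀+N≤n)) close
      where
      near = corr-near {c} {n₀ ℕ.+ N} (λ n n₀+N≤n →
        ℕₚ.≤-reflexive (d₁≡c n (ℕₚ.≤-trans (ℕₚ.m≤n+m N n₀) n₀+N≤n)) ,
        d₂≤d₁ n (ℕₚ.≤-trans (ℕₚ.m≤m+n n₀ N) n₀+N≤n)) ε 0<ε

    -- A limit `ρ` would draw the inverse roots of all late values of `d₁` together, yet two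
    -- distinct values recur arbitrarily late and `inverse-roots-apart` keeps their inverse roots
    -- apart.
    corr-diverges : (∀ n → n₀ ℕ.≤ n → d₂ n ℕ.≤ d₁ n) → (∃ λ K → ∀ n → n₀ ℕ.≤ n → d₁ n ℕ.≤ K) →
                    (∃₂ λ a b → ¬ (a ≈ b) × IsAccumulationPoint D a × IsAccumulationPoint D b) →
                    ¬ (∃ λ ρ → corr ⟶ ρ)
    corr-diverges d₂≤d₁ (K , d₁≤K) (a , b , a≉b , D-a , D-b) (ρ , corr⟶ρ) = <-irrefl refl (begin-strict
      1#
        ≤⟨ inverse-roots-apart (1≤D m₀≤) (1≤D n₀≤) (D≤k m₀≤) (D≤k n₀≤) (fromℕ-apart {d₁ m} {d₁ n} λ eq → Dm≉Dn (reflexive (≡.cong fromℕ eq)))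
             (proj₁ (inverse-root-spec (1≤D m₀≤))) (proj₁ (inverse-root-spec (1≤D n₀≤)))
             (proj₂ (inverse-root-spec (1≤D m₀≤))) (proj₂ (inverse-root-spec (1≤D n₀≤))) ⟩
      fromℕ 2 * (k * k) * ∣ limit m - limit n ∣
        ≤⟨ *-monoˡ-≤ 0≤2k² close ⟩
      fromℕ 2 * (k * k) * (fromℕ 4 * ε)
        <⟨ <-by 0<ε (solve 2 (λ x e → (:1 :+ x :* con (pos 4)) :* e :- x :* (con (pos 4) :* e) := e) refl (fromℕ 2 * (k * k)) ε) ⟩
      (1# + fromℕ 2 * (k * k) * fromℕ 4) * ε
        ≤⟨ proj₂ (proj₂ (proj₂ factor)) ⟩
      1# ∎)
      where
      k = fromℕ K
      limit : ℕ → R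
      limit n = 1# / (√ (D n))
      0≤2k² : 0# ≤ fromℕ 2 * (k * k)
      0≤2k² = 0≤x*y (0≤fromℕ 2) (0≤x² k)
      -- The two inverse roots are within `4 ε`, so `2 k² · 4 ε < 1` gives the contradiction; the
      -- added 1 in the factor makes this strict.
      factor = small-factor 0<1 (0<x+y 0<1 (0≤x*y 0≤2k² (0≤fromℕ 4)))
      ε = proj₁ factor
      0<ε = proj₁ (proj₂ factor)
      near = corr-near {K} {n₀} (λ n n₀≤n → d₁≤K n n₀≤n , d₂≤d₁ n n₀≤n) ε 0<ε
      near-ρ = corr⟶ρ ε 0<ε
      N = proj₁ near
      M = proj₁ near-ρ
      1≤D : ∀ {n} → n₀ ℕ.≤ n → 1# ≤ D n
      1≤D n₀≤n = 1≤fromℕ (proj₁ (d₁-range _ n₀≤n))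
      D≤k : ∀ {n} → n₀ ℕ.≤ n → D n ≤ k
      D≤k n₀≤n = fromℕ-mono-≤ (d₁≤K _ n₀≤n)

      limit-near-ρ : ∀ n → N ℕ.+ M ℕ.≤ n → ∣ limit n - ρ ∣ ≤ ε + ε
      limit-near-ρ n N+M≤n = begin
        ∣ limit n - ρ ∣                              ≈⟨ ∣∣-cong (solve 3 (λ l c r → l :- r := :- (c :- l) :+ (c :- r)) refl (limit n) (corr n) ρ) ⟩
        ∣ - (corr n - limit n) + (corr n - ρ) ∣      ≤⟨ ∣x+y∣≤ (≤-trans (≤-reflexive (∣∣-neg _))
              (<⇒≤ (proj₂ (proj₂ (proj₂ near n (ℕₚ.≤-trans (ℕₚ.m≤m+n N M) N+M≤n))))))
              (<⇒≤ (proj₂ near-ρ n (ℕₚ.≤-trans (ℕₚ.m≤n+m M N) N+M≤n))) ⟩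
        ε + ε                                        ∎

      separated = accumulation-points-separate {D} a≉b D-a D-b (N ℕ.+ M)
      m = proj₁ separated
      n = proj₁ (proj₂ separated)
      N+M≤m = proj₁ (proj₂ (proj₂ separated))
      N+M≤n = proj₁ (proj₂ (proj₂ (proj₂ separated)))
      Dm≉Dn = proj₂ (proj₂ (proj₂ (proj₂ separated)))
      m₀≤ = proj₁ (proj₂ near m (ℕₚ.≤-trans (ℕₚ.m≤m+n N M) N+M≤m))
      n₀≤ = proj₁ (proj₂ near n (ℕₚ.≤-trans (ℕₚ.m≤m+n N M) N+M≤n))

      close : ∣ limit m - limit n ∣ ≤ fromℕ 4 * ε
      close = begin
        ∣ limit m - limit n ∣                  ≈⟨ ∣∣-cong (solve 3 (λ x y r → x :- y := (x :- r) :- (y :- r)) refl (limit m) (limit n) ρ) ⟩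
        ∣ (limit m - ρ) - (limit n - ρ) ∣      ≤⟨ ∣x-y∣≤ (limit-near-ρ m N+M≤m) (limit-near-ρ n N+M≤n) ⟩
        ε + ε + (ε + ε)                        ≈⟨ solve 1 (λ e → e :+ e :+ (e :+ e) := con (pos 4) :* e) refl ε ⟩
        fromℕ 4 * ε                            ∎

theorem3p13 :
  (lem : ∀ {ℓ} → ExcludedMiddle ℓ) (ℝ : CompleteOrderedField) →
  let open Probability lem ℝ in
  (S : ∀ n → UniformSample n)
  (n₀ : ℕ) (d₁ d₂ : ℕ → ℕ) →
  (∀ n → n₀ ℕ.≤ n → 1 ℕ.≤ d₁ n × d₁ n ℕ.< n) →
  (∀ n → n₀ ℕ.≤ n → 1 ℕ.≤ d₂ n × d₂ n ℕ.< n) →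
  (λ n → fromℕ (d₁ n)) =o growthBound →
  let corr : ℕ → R
      corr n = UniformSample.correlation (S n) (d₁ n) (d₂ n)
  in
  ((∀ n → n₀ ℕ.≤ n → d₁ n ℕ.< d₂ n) → corr ⟶ 0#)
  ×
  ((∀ n → n₀ ℕ.≤ n → d₂ n ℕ.≤ d₁ n) →
    (∀ c → (∃ λ N → ∀ n → N ℕ.≤ n → d₁ n ≡ c) → corr ⟶ 1# / (√ (fromℕ c)))
    ×
    ((∃ λ K → ∀ n → n₀ ℕ.≤ n → d₁ n ℕ.≤ K) →
     (∃₂ λ a b → ¬ (a ≈ b) ×
       IsAccumulationPoint (λ n → fromℕ (d₁ n)) a ×
       IsAccumulationPoint (λ n → fromℕ (d₁ n)) b) →
     ¬ (∃ λ ρ → corr ⟶ ρ)))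
  ×
  ((∀ n → n₀ ℕ.≤ n → d₂ n ℕ.≤ d₁ n) →
   (∀ K → ∃ λ N → ∀ n → N ℕ.≤ n → K ℕ.≤ d₁ n) →
   corr ⟶ 0#)
theorem3p13 lem ℝ S n₀ d₁ d₂ d₁-range d₂-range d₁=o =
  (λ d₁<d₂ → corr⟶0 d₁=o λ _ _ → n₀ , λ n n₀≤n → inj₁ (d₁<d₂ n n₀≤n)) ,
  (λ d₂≤d₁ → corr⟶1/√ d₂≤d₁ , corr-diverges d₂≤d₁) ,
  (λ d₂≤d₁ d₁→∞ → corr⟶0 d₁=o λ η 0<η →
    let N , large = eventually-large d₁→∞ η 0<η in
    n₀ ℕ.+ N , λ n n₀+N≤n → inj₂
      (d₂≤d₁ n (ℕₚ.≤-trans (ℕₚ.m≤m+n n₀ N) n₀+N≤n) , large n (ℕₚ.≤-trans (ℕₚ.m≤n+m N n₀) n₀+N≤n)))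
  where
  open Development lem ℝ
  open Limits S n₀ d₁ d₂ d₁-range d₂-range
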